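{- Let $A=(a_{i,j})$ and $B=(b_{i,j})$ be $m\times n$ matrices over a commutative ring with unity, $m\le n$. Write $R(x;z;A)=\sum_{l=0}^m r_l(z;A)x^l$ with $r_0(z;A)=1$ and $R(x;A)=\sum_{l=0}^m r_l(A)x^l$ with $r_0(A)=1$. Then $$R(x;z;A+B)=\sum_{s=0}^m\sum_{\bar\alpha\in Q_{s,m}}\sum_{\varphi\in\mathrm{Inj}(\{\bar\alpha\},N_n)}z^{|\varphi|}\Big(\prod_{i\in\{\bar\alpha\}}a_{i,\varphi(i)}\Big)x^sR\big(x;z;B[N_m\setminus\{\bar\alpha\}\,|\,\bar\varphi(N_n)]\big);$$ $$r_l(z;A+B)=\sum_{s=0}^l\sum_{\bar\alpha\in Q_{s,m}}\sum_{\varphi\in\mathrm{Inj}(\{\bar\alpha\},N_n)}z^{|\varphi|}\Big(\prod_{i\in\{\bar\alpha\}}a_{i,\varphi(i)}\Big)r_{l-s}\big(z;B[N_m\setminus\{\bar\alpha\}\,|\,\bar\varphi(N_n)]\big);$$ $$\mathrm{per}(z;A+B)=\sum_{s=0}^m\sum_{\bar\alpha\in Q_{s,m}}\sum_{\varphi\in\mathrm{Inj}(\{\bar\alpha\},N_n)}z^{|\varphi|}\Big(\prod_{i\in\{\bar\alpha\}}a_{i,\varphi(i)}\Big)\mathrm{per}\big(z;B[N_m\setminus\{\bar\alpha\}\,|\,\bar\varphi(N_n)]\big);$$ $$R(x;A+B)=\sum_{s=0}^m\sum_{\bar\alpha\in Q_{s,m},\,\bar\beta\in Q_{s,n}}\mathrm{per}(A[\bar\alpha|\bar\beta])\,x^sR(x;B(\bar\alpha|\bar\beta));$$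 $$r_l(A+B)=\sum_{s=0}^l\sum_{\bar\alpha\in Q_{s,m},\,\bar\beta\in Q_{s,n}}\mathrm{per}(A[\bar\alpha|\bar\beta])\,r_{l-s}(B(\bar\alpha|\bar\beta));$$ $$\mathrm{per}(A+B)=\sum_{s=0}^m\sum_{\bar\alpha\in Q_{s,m},\,\bar\beta\in Q_{s,n}}\mathrm{per}(A[\bar\alpha|\bar\beta])\,\mathrm{per}(B(\bar\alpha|\bar\beta)).$$
   Context: $N_n=\{1,\dots,n\}$; $Q_{s,m}$ is the set of strictly increasing sequences of length $s$ with entries in $N_m$ ($Q_{0,m}$ contains only the empty sequence), and $\{\bar\alpha\}$ is the set of entries of $\bar\alpha$. For $S\subseteq N_n$, $\mathrm{Inj}(S,N_n)$ is the set of injective maps $S\to N_n$; for $\varphi\in\mathrm{Inj}(S,N_n)$, $|\varphi|$ is the number of cycles of $\varphi$, i.e. the number of nonempty sets $C\subseteq S$ of the form $\{j,\varphi(j),\dots,\varphi^{p-1}(j)\}$ with $\varphi^p(j)=j$. For a $p\times q$ matrix $C=(c_{i,j})$, $p\le q$: $r_l(z;C)=\sum_{S\subseteq N_p,|S|=l}\sum_{\varphi\in\mathrm{Inj}(S,N_q)}z^{|\varphi|}\prod_{i\in S}c_{i,\varphi(i)}$, $R(x;z;C)=\sum_{l=0}^p r_l(z;C)x^l$, $\mathrm{per}(z;C)=r_p(z;C)$ (the cyclic permanent); the ordinary permanent of a square matrix is $\mathrm{per}$, the ordinary rook numbers are $r_l(C)=\sum_{\bar\alpha\in Q_{l,p},\bar\beta\in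 Q_{l,q}}\mathrm{per}(C[\bar\alpha|\bar\beta])$ and $R(x;C)=\sum_{l=0}^p r_l(C)x^l$; for a matrix with no rows these quantities ($R$, $r_0$, $\mathrm{per}$) equal $1$. $C[\bar\alpha|\bar\beta]$ is the submatrix with rows $\bar\alpha$ and columns $\bar\beta$, and $C(\bar\alpha|\bar\beta)$ is the submatrix obtained by deleting the rows in $\bar\alpha$ and the columns in $\bar\beta$. For a set $T$ of row indices and a sequence $(c_1,\dots,c_q)$ of column indices, $B[T\,|\,c_1,\dots,c_q]$ is the matrix formed by the rows of $B$ indexed by $T$ in increasing order whose $s$-th column is column $c_s$ of $B$, re-indexed by $1,2,\dots$ in rows and columns before computing cyclic quantities. For $S\subseteq N_n$ and $\varphi\in\mathrm{Inj}(S,N_n)$ define $\varphi^*:\varphi(S)\setminus S\to S\setminus\varphi(S)$: for $j\in\varphi(S)\setminus S$, $j_0=j$, $j_l=\varphi^{ -1}(j_{l-1})$ while $j_{l-1}\in\varphi(S)$, and $\varphi^*(j)$ is the first $j_l$ in $S\setminus\varphi(S)$. For a sequence $(x_1,\dots,x_n)$, $\bar\varphi(x_1,\dots,x_n)=(y_j)_{j\in N_n\setminus S}$ in increasing order of $j$, with $y_j=x_j$ if $j\notin\varphi(S)$ and $y_j=x_{\varphi^*(j)}$ if $j\in\varphi(S)\setminus S$; $\bar\varphi(N_n)=\bar\varphi(1,\dots,n)$. -}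

module Defs where

open import Level using (Level)
open import Algebra.Bundles using (CommutativeRing)
open import Data.Bool using (Bool; true; false; _∧_; _∨_; not; if_then_else_)
open import Data.Nat using (ℕ; zero; suc; _≡ᵇ_; _<ᵇ_; _≤_; _∸_)
open import Data.Fin using (Fin; toℕ; inject≤)
open import Data.Maybe using (Maybe; just; nothing; maybe; _>>=_; is-just)
open import Data.Vec using (Vec; []; _∷_; lookup)
open import Data.List using (List; []; _∷_; map; concatMap; filterᵇ; allFin; upTo; length; foldr)
open import Data.Bool.ListAction using (all; any)
import Data.List as L

_⇔ᵇ_ : Bool → Bool → Bool
true  ⇔ᵇ b = b
false ⇔ᵇ b = not b

_≟ᶠ_ : ∀ {n} → Fin n → Fin n → Bool
i ≟ᶠ j = toℕ i ≡ᵇ toℕ j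

eqM : Maybe ℕ → ℕ → Bool
eqM nothing  k = false
eqM (just a) k = a ≡ᵇ k

allSubsets : ∀ p → List (Vec Bool p)
allSubsets zero    = [] ∷ []
allSubsets (suc p) = concatMap (λ v → (true ∷ v) ∷ (false ∷ v) ∷ []) (allSubsets p)

size : ∀ {p} → Vec Bool p → ℕ
size []          = 0
size (true ∷ v)  = suc (size v)
size (false ∷ v) = size v

elems : ∀ {p} → Vec Bool p → List (Fin p)
elems {p} S = filterᵇ (lookup S) (allFin p)

-- Q_{s,p}: strictly increasing sequences of length s with entries in N_p
-- (indices are 0-based: Fin p = {0,…,p-1} stands for N_p = {1,…,p})
Q : ℕ → (p : ℕ) → List (List (Fin p))
Q s p = map elems (filterᵇ (λ S → size S ≡ᵇ s) (allSubsets p))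

memᶠ : ∀ {p} → Fin p → List (Fin p) → Bool
memᶠ i α = any (i ≟ᶠ_) α

memℕ : ∀ {p} → ℕ → List (Fin p) → Bool
memℕ k α = any (λ i → toℕ i ≡ᵇ k) α

-- Partial maps N_p ⇀ N_q.  A map φ ∈ Inj(S, N_q) with S ⊆ N_p is
-- represented by the vector (φ(i) if i ∈ S, nothing otherwise).

PMap : ℕ → ℕ → Set
PMap p q = Vec (Maybe (Fin q)) p

allPMaps : ∀ p q → List (PMap p q)
allPMaps zero    q = [] ∷ []
allPMaps (suc p) q =
  concatMap (λ v → map (_∷ v) (nothing ∷ map just (allFin q))) (allPMaps p q)

isInj : ∀ {p q} → PMap p q → Bool
isInj {p} φ = all (λ i → all (λ i' → (i ≟ᶠ i') ∨ distinct (lookup φ i) (lookup φ i'))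
                             (allFin p)) (allFin p)
  where
  distinct : ∀ {q} → Maybe (Fin q) → Maybe (Fin q) → Bool
  distinct (just a) (just b) = not (a ≟ᶠ b)
  distinct _        _        = true

domIs : ∀ {p q} → (Fin p → Bool) → PMap p q → Bool
domIs {p} P φ = all (λ i → is-just (lookup φ i) ⇔ᵇ P i) (allFin p)

injOn : ∀ {p} q → (Fin p → Bool) → List (PMap p q)
injOn {p} q P = filterᵇ (λ φ → isInj φ ∧ domIs P φ) (allPMaps p q)

totalInj : ∀ p q → List (PMap p q)
totalInj p q = injOn q (λ _ → true)

-- Cycles.  φ is viewed as a partial self-map of ℕ (indices compared
-- as numbers): φ(j) is defined iff j < p and j ∈ S.

appℕ : ∀ {p q} → PMap p q → ℕ → Maybe ℕ
appℕ []      _       = nothing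
appℕ (x ∷ v) zero    = Data.Maybe.map toℕ x
appℕ (x ∷ v) (suc j) = appℕ v j

iter : ∀ {p q} → PMap p q → ℕ → ℕ → Maybe ℕ
iter φ zero    j = just j
iter φ (suc k) j = iter φ k j >>= appℕ φ

inSet : ∀ {p} → Vec Bool p → ℕ → Bool
inSet []      _       = false
inSet (b ∷ v) zero    = b
inSet (b ∷ v) (suc k) = inSet v k

inOrbit : ∀ {p q} → PMap p q → ℕ → ℕ → ℕ → Bool
inOrbit φ j e k = any (λ t → eqM (iter φ t j) k) (upTo e)

-- C is a nonempty set of the form {j, φ(j), …, φ^{e-1}(j)} with φ^e(j) = j.
-- (It suffices to look at 1 ≤ e ≤ p and at k < p, since such C ⊆ S ⊆ N_p.)
isCycleSet : ∀ {p q} → PMap p q → Vec Bool p → Bool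
isCycleSet {p} φ C =
  any (λ j → any (λ e → eqM (iter φ e j) j ∧
                        all (λ k → inSet C k ⇔ᵇ inOrbit φ j e k) (upTo p))
                 (map suc (upTo p)))
      (upTo p)

numCycles : ∀ {p q} → PMap p q → ℕ
numCycles {p} φ = length (filterᵇ (isCycleSet φ) (allSubsets p))

inImg : ∀ {m n} → PMap m n → Fin n → Bool
inImg {m} φ j = any (λ i → maybe (_≟ᶠ j) false (lookup φ i)) (allFin m)

preimage : ∀ {m n} → PMap m n → Fin n → Maybe (Fin m)
preimage {m} φ j = L.head (filterᵇ (λ i → maybe (_≟ᶠ j) false (lookup φ i)) (allFin m))

-- φ*(j), computed with fuel (the chain has length ≤ |S| ≤ m)
star : ∀ {m n} → .(m ≤ n) → ℕ → PMap m n → Fin n → Fin n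
star m≤n zero     φ j = j
star m≤n (suc f)  φ j with preimage φ j
... | nothing = j
... | just i  = if inImg φ (inject≤ i m≤n)
                  then star m≤n f φ (inject≤ i m≤n)
                  else inject≤ i m≤n

phiBar : ∀ {m n} → .(m ≤ n) → List (Fin m) → PMap m n → List (Fin n)
phiBar {m} {n} m≤n α φ =
  map (λ j → if inImg φ j then star m≤n (suc m) φ j else j)
      (filterᵇ (λ j → not (memℕ (toℕ j) α)) (allFin n))

compl : ∀ {p} → List (Fin p) → List (Fin p)
compl {p} α = filterᵇ (λ i → not (memᶠ i α)) (allFin p)

module Rook {c ℓ : Level} (CR : CommutativeRing c ℓ) where
  open CommutativeRing CR

  Mat : ℕ → ℕ → Set c
  Mat p q = Fin p → Fin q → Carrier

  _⊕_ : ∀ {p q} → Mat p q → Mat p q → Mat p q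
  (A ⊕ B) i j = A i j + B i j

  sub : ∀ {p q} → Mat p q → (rs : List (Fin p)) → (cs : List (Fin q)) →
        Mat (length rs) (length cs)
  sub C rs cs a b = C (L.lookup rs a) (L.lookup cs b)

  Σ : List Carrier → Carrier
  Σ = foldr _+_ 0#

  Π : List Carrier → Carrier
  Π = foldr _*_ 1#

  pow : Carrier → ℕ → Carrier
  pow z zero    = 1#
  pow z (suc k) = z * pow z k

  weight : ∀ {p q} → Mat p q → PMap p q → Carrier
  weight {p} C φ = Π (map (λ i → maybe (C i) 1# (lookup φ i)) (allFin p))

  cycRook : ∀ {p q} → Carrier → ℕ → Mat p q → Carrier
  cycRook {p} {q} z l C =
    Σ (concatMap (λ S → map (λ φ → pow z (numCycles φ) * weight C φ) (injOn q (lookup S)))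
                 (filterᵇ (λ S → size S ≡ᵇ l) (allSubsets p)))

  cycR : ∀ {p q} → Carrier → Carrier → Mat p q → Carrier
  cycR {p} x z C = Σ (map (λ l → cycRook z l C * pow x l) (upTo (suc p)))

  cycPer : ∀ {p q} → Carrier → Mat p q → Carrier
  cycPer {p} z C = cycRook z p C

  per : ∀ {p q} → Mat p q → Carrier
  per {p} {q} C = Σ (map (weight C) (totalInj p q))

  rook : ∀ {p q} → ℕ → Mat p q → Carrier
  rook {p} {q} l C = Σ (concatMap (λ α → map (λ β → per (sub C α β)) (Q l q)) (Q l p))

  rookR : ∀ {p q} → Carrier → Mat p q → Carrier
  rookR {p} x C = Σ (map (λ l → rook l C * pow x l) (upTo (suc p)))

{-# OPTIONS --safe #-}

-- Expand both sides along a row of A.  Choosing the entry of A in row k and column j contracts the arc k → j: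
-- row k and column k disappear, and column j is replaced by column k.  A contraction keeps the number of cycles,
-- except that a loop k → k contributes a factor z; and contracting the arcs of φ one after another turns B into
-- B[N_m∖S | φ̄(N_n)], because φ*(j) is the unique vertex without predecessor from which φ leads to j.
-- Removing the rows of A one by one therefore gives the cyclic identities.  To treat R, r_l and per at once, the sums
-- are weighted by an arbitrary function h of the number of chosen entries.
-- The ordinary identities come from the Laplace expansion of per(A+B), whose combinatorial core is that
-- "split a list, then pick an element of one part" is the same as "pick an element, then split the rest".

module Submission where

open import Defs
open import Level using (Level)
open import Algebra.Bundles using (CommutativeRing)
open import Data.Nat using (ℕ; suc; _≤_; _∸_)
open import Data.Fin using (toℕ)
open import Data.List using (map; concatMap; upTo; length)
open import Data.Product using (_×_)
import Algebra.Properties.CommutativeSemigroup as CommSemigroup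
open import Data.Bool using (Bool; true; false; _∧_; _∨_; not; if_then_else_; T; T?)
import Data.Bool.ListAction
open import Data.Bool.ListAction using (all; any)
open import Data.Bool.Properties using (T-≡)
open import Data.Empty using (⊥-elim)
open import Data.Fin as Fin using (Fin; zero; suc; fromℕ<; punchIn; inject≤)
import Data.Fin.Properties as FinP
open import Data.List using (List; []; _∷_; filterᵇ; allFin; tabulate; _++_)
import Data.List as L
import Data.List.Properties as List
open import Data.List.Membership.Propositional using (_∈_)
open import Data.List.Membership.Propositional.Properties
  using (∈-allFin; ∈-upTo⁺; ∈-upTo⁻; ∈-map⁺; ∈-map⁻; ∈-filter⁺; ∈-filter⁻)
open import Data.List.Relation.Unary.Any using (here; there)
open import Data.Maybe using (Maybe; just; nothing; maybe; _>>=_; is-just)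
import Data.Maybe as Maybe
open import Data.Maybe.Properties using (just-injective)
open import Data.Nat using (zero; _<_; _≡ᵇ_; _<ᵇ_; z≤n; s≤s; z<s; s<s; _%_; _/_)
import Data.Nat.Base as N
open import Data.Nat.DivMod using (m≡m%n+[m/n]*n; m%n<n)
import Data.Nat.Properties as ℕ
open import Data.Product using (∃; ∃₂; _,_; proj₁; proj₂)
open import Data.Sum using (inj₁; inj₂)
open import Data.Vec using (Vec; []; _∷_; lookup; insertAt)
import Data.Vec as Vec
import Data.Vec.Properties as VecP
open import Function using (_∘_; Equivalence)
open import Relation.Binary.PropositionalEquality
  using (_≡_; _≢_; refl; sym; trans; cong; cong₂; subst; subst₂; module ≡-Reasoning)
open import Relation.Nullary using (¬_; contradiction; yes; no)
open CommSemigroup ℕ.+-commutativeSemigroup using () renaming (interchange to ℕ-interchange)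

-- Contraction commutes with matrix addition and leaves a problem of the same kind with one row and
-- one column fewer; only the number of entries chosen so far and the cycle count change. The
-- induction is therefore stated for every weight `h`, which turns into `h ∘ suc`, and for all
-- dimensions at once. The obstacle is that two ingredients of the statement are algorithms that do
-- not follow a contraction: cycle sets come from a bounded search with a base point and a length,
-- φ* from a recursion with fuel. Each is first replaced by a specification that does follow it,
-- `IsCycle` and `IsSource`. Both speak of partial functions on numbers, because a row index and a
-- column index can be the same vertex while having different types. The sums over s, α and φ are
-- merged into a single sum over all injective partial maps, with α recovered as the domain. In the
-- ordinary case rows and columns are not identified, so the argument runs over lists of remaining
-- rows and columns instead.

bool-ext : ∀ {a b} → (a ≡ true → b ≡ true) → (b ≡ true → a ≡ true) → a ≡ b
bool-ext {true}  {b}     f g = sym (f refl)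
bool-ext {false} {true}  f g = g refl
bool-ext {false} {false} f g = refl

∧-true⁻ : ∀ {a b} → a ∧ b ≡ true → a ≡ true × b ≡ true
∧-true⁻ {true} {true} _ = refl , refl

∧-true⁺ : ∀ {a b} → a ≡ true → b ≡ true → a ∧ b ≡ true
∧-true⁺ refl refl = refl

⇔ᵇ⇒≡ : ∀ {a b} → (a ⇔ᵇ b) ≡ true → a ≡ b
⇔ᵇ⇒≡ {true}  {true}  _ = refl
⇔ᵇ⇒≡ {false} {false} _ = refl

⇔ᵇ-refl : ∀ a → (a ⇔ᵇ a) ≡ true
⇔ᵇ-refl true  = refl
⇔ᵇ-refl false = refl

≡ᵇ⇒≡ : ∀ {a b} → (a ≡ᵇ b) ≡ true → a ≡ b
≡ᵇ⇒≡ {a} {b} e = ℕ.≡ᵇ⇒≡ a b (subst T (sym e) _)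

≡ᵇ-refl : ∀ a → (a ≡ᵇ a) ≡ true
≡ᵇ-refl zero    = refl
≡ᵇ-refl (suc a) = ≡ᵇ-refl a

≢⇒≡ᵇ : ∀ {a b} → a ≢ b → (a ≡ᵇ b) ≡ false
≢⇒≡ᵇ {a} {b} ne with a ≡ᵇ b in e
... | true  = contradiction (≡ᵇ⇒≡ e) ne
... | false = refl

eqM⇒≡ : ∀ {x k} → eqM x k ≡ true → x ≡ just k
eqM⇒≡ {just a} e = cong just (≡ᵇ⇒≡ e)

≡⇒eqM : ∀ {x k} → x ≡ just k → eqM x k ≡ true
≡⇒eqM {k = k} refl = ≡ᵇ-refl k

module _ {A : Set} (P : A → Bool) where
  all-true⁻ : ∀ xs → all P xs ≡ true → ∀ {x} → x ∈ xs → P x ≡ true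
  all-true⁻ (x ∷ xs) e (here refl) = proj₁ (∧-true⁻ e)
  all-true⁻ (x ∷ xs) e (there i)   = all-true⁻ xs (proj₂ (∧-true⁻ {P x} e)) i

  all-true⁺ : ∀ xs → (∀ {x} → x ∈ xs → P x ≡ true) → all P xs ≡ true
  all-true⁺ []       h = refl
  all-true⁺ (x ∷ xs) h = ∧-true⁺ (h (here refl)) (all-true⁺ xs (h ∘ there))

  any-true⁻ : ∀ xs → any P xs ≡ true → ∃ λ x → x ∈ xs × P x ≡ true
  any-true⁻ (x ∷ xs) e with P x in eq
  ... | true  = x , here refl , eq
  ... | false with any-true⁻ xs e
  ...   | y , i , p = y , there i , p

  any-true⁺ : ∀ xs {x} → x ∈ xs → P x ≡ true → any P xs ≡ true
  any-true⁺ (x ∷ xs) (here refl) e rewrite e = refl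
  any-true⁺ (x ∷ xs) (there i)   e with P x
  ... | true  = refl
  ... | false = any-true⁺ xs i e

nothing≢just : ∀ {A : Set} {x : Maybe A} {a} → x ≡ nothing → x ≢ just a
nothing≢just refl ()

true≢false : ∀ {b} → b ≡ true → b ≢ false
true≢false refl ()

-- Cycles and contractions of partial functions

PF : Set
PF = ℕ → Maybe ℕ

Injective : PF → Set
Injective f = ∀ a b c → f a ≡ just c → f b ≡ just c → a ≡ b

data Reach (f : PF) (a : ℕ) : ℕ → Set where
  stop : Reach f a a
  _▸_  : ∀ {b c} → Reach f a b → f b ≡ just c → Reach f a c

infixl 5 _▸_

Reach-trans : ∀ {f a b c} → Reach f a b → Reach f b c → Reach f a c
Reach-trans r stop    = r
Reach-trans r (s ▸ e) = Reach-trans r s ▸ e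

Closed : PF → (ℕ → Bool) → Set
Closed f C = ∀ a → C a ≡ true → ∃ λ b → f a ≡ just b × C b ≡ true

-- Nonempty, closed and strongly connected: no base point and no length occur, so the description
-- survives a contraction, which shortens the cycles through the contracted arc.
record IsCycle (f : PF) (C : ℕ → Bool) : Set where
  constructor cyc
  field
    base   : ∃ λ a → C a ≡ true
    closed : Closed f C
    conn   : ∀ a b → C a ≡ true → C b ≡ true → Reach f a b
open IsCycle

closed-Reach : ∀ {f} C {a b} → Closed f C → C a ≡ true → Reach f a b → C b ≡ true
closed-Reach C cl ca stop = ca
closed-Reach C cl ca (_▸_ {b} r e) with cl b (closed-Reach C cl ca r)
... | d , e' , cd = subst (λ x → C x ≡ true) (just-injective (trans (sym e') e)) cd

-- Step forward from `b` to `c` and return along the path given by `conn`: its last arc enters `b`.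
-- An empty return path means that `b` is a loop.
cycle-pred : ∀ {f C b} → IsCycle f C → C b ≡ true → ∃ λ a → C a ≡ true × f a ≡ just b
cycle-pred {f} {C} {b} h cb with closed h b cb
... | c , e , cc with conn h c b cc cb
...   | stop    = b , cb , e
...   | _▸_ {a} r e' = a , closed-Reach C (closed h) cc r , e'

-- `punchIn` on plain numbers: the increasing enumeration of the naturals other than `k`.
pin : ℕ → ℕ → ℕ
pin zero    a       = suc a
pin (suc k) zero    = zero
pin (suc k) (suc a) = suc (pin k a)

pin≢ : ∀ k a → pin k a ≢ k
pin≢ (suc k) (suc a) e = pin≢ k a (ℕ.suc-injective e)

pin-injective : ∀ k {a b} → pin k a ≡ pin k b → a ≡ b
pin-injective zero    e = ℕ.suc-injective e
pin-injective (suc k) {zero}  {zero}  e = refl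
pin-injective (suc k) {suc a} {suc b} e = cong suc (pin-injective k (ℕ.suc-injective e))

data PinView (k : ℕ) : ℕ → Set where
  is-k   : PinView k k
  is-pin : ∀ a → PinView k (pin k a)

pinView : ∀ k a → PinView k a
pinView zero    zero    = is-k
pinView zero    (suc a) = is-pin a
pinView (suc k) zero    = is-pin zero
pinView (suc k) (suc a) with pinView k a
... | is-k     = is-k
... | is-pin b = is-pin (suc b)

-- Contracting the arc k → J renames the surviving vertices by `pin k` and redirects through k whatever used to enter J.
redirect : ℕ → ℕ → ℕ → ℕ
redirect k J b = if pin k b ≡ᵇ J then k else pin k b

redirect-≡ : ∀ k b → redirect k (pin k b) b ≡ k
redirect-≡ k b rewrite ≡ᵇ-refl (pin k b) = refl

redirect-≢ : ∀ k {J b} → pin k b ≢ J → redirect k J b ≡ pin k b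
redirect-≢ k ne rewrite ≢⇒≡ᵇ ne = refl

-- For `J = k` the test in `redirect` never succeeds and `k` is an isolated loop, so one record
-- serves for loops and for proper arcs.
record Contraction (f f' : PF) (k J : ℕ) : Set where
  constructor contr
  field
    at-k   : f k ≡ just J
    at-pin : ∀ a → f (pin k a) ≡ Maybe.map (redirect k J) (f' a)

map-just⁻ : ∀ {A B : Set} {g : A → B} {x y} → Maybe.map g x ≡ just y → ∃ λ a → x ≡ just a × g a ≡ y
map-just⁻ {x = just a} refl = a , refl , refl

module LoopContraction {f f' : PF} {k} (H : Contraction f f' k k) where
  open Contraction H

  step⁺ : ∀ {a b} → f' a ≡ just b → f (pin k a) ≡ just (pin k b)
  step⁺ {a} {b} e = trans (at-pin a) (trans (cong (Maybe.map _) e) (cong just (redirect-≢ k (pin≢ k b))))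

  step⁻ : ∀ {a y} → f (pin k a) ≡ just y → ∃ λ b → y ≡ pin k b × f' a ≡ just b
  step⁻ {a} e with map-just⁻ (trans (sym (at-pin a)) e)
  ... | b , e' , eq = b , trans (sym eq) (redirect-≢ k (pin≢ k b)) , e'

  reach⁺ : ∀ {a b} → Reach f' a b → Reach f (pin k a) (pin k b)
  reach⁺ stop    = stop
  reach⁺ (r ▸ e) = reach⁺ r ▸ step⁺ e

  reach⁻ : ∀ {a y} → Reach f (pin k a) y → ∃ λ b → y ≡ pin k b × Reach f' a b
  reach⁻ stop = _ , refl , stop
  reach⁻ (r ▸ e) with reach⁻ r
  ... | b , refl , r' with step⁻ e
  ...   | c , eq , e' = c , eq , r' ▸ e'

  stay : ∀ {y} → Reach f k y → y ≡ k
  stay stop = refl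
  stay (r ▸ e) rewrite stay r = sym (just-injective (trans (sym at-k) e))

  module _ (C : ℕ → Bool) where
    cycle-at⁻ : C k ≡ true → IsCycle f C → ∀ a → C (pin k a) ≡ false
    cycle-at⁻ ck h a with C (pin k a) in e
    ... | false = refl
    ... | true  = ⊥-elim (pin≢ k a (stay (conn h k (pin k a) ck e)))

    cycle-at⁺ : C k ≡ true → (∀ a → C (pin k a) ≡ false) → IsCycle f C
    cycle-at⁺ ck h = cyc (k , ck) (λ a ca → subst (λ a → ∃ λ b → f a ≡ just b × C b ≡ true) (sym (only a ca)) (k , at-k , ck))
      λ a b ca cb → subst₂ (Reach f) (sym (only a ca)) (sym (only b cb)) stop
      where
      only : ∀ a → C a ≡ true → a ≡ k
      only a ca with pinView k a
      ... | is-k     = refl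
      ... | is-pin b = contradiction (h b) (true≢false ca)

    cycle-off⁻ : C k ≡ false → IsCycle f C → IsCycle f' (C ∘ pin k)
    cycle-off⁻ ck h = cyc (bs (base h)) cl cn
      where
      bs : (∃ λ a → C a ≡ true) → ∃ λ a → C (pin k a) ≡ true
      bs (a , ca) with pinView k a
      ... | is-k     = contradiction ck (true≢false ca)
      ... | is-pin b = b , ca
      cl : ∀ a → C (pin k a) ≡ true → ∃ λ b → f' a ≡ just b × C (pin k b) ≡ true
      cl a ca with closed h (pin k a) ca
      ... | y , e , cy with step⁻ e
      ...   | b , refl , e' = b , e' , cy
      cn : ∀ a b → C (pin k a) ≡ true → C (pin k b) ≡ true → Reach f' a b
      cn a b ca cb with reach⁻ (conn h _ _ ca cb)
      ... | b' , eq , r = subst (Reach f' a) (sym (pin-injective k eq)) r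

    cycle-off⁺ : C k ≡ false → IsCycle f' (C ∘ pin k) → IsCycle f C
    cycle-off⁺ ck h = cyc (pin k (proj₁ (base h)) , proj₂ (base h)) cl cn
      where
      cl : ∀ a → C a ≡ true → ∃ λ b → f a ≡ just b × C b ≡ true
      cl a ca with pinView k a
      ... | is-k     = contradiction ck (true≢false ca)
      ... | is-pin a' with closed h a' ca
      ...   | b , e , cb = pin k b , step⁺ e , cb
      cn : ∀ a b → C a ≡ true → C b ≡ true → Reach f a b
      cn a b ca cb with pinView k a | pinView k b
      ... | is-k | _ = contradiction ck (true≢false ca)
      ... | _ | is-k = contradiction ck (true≢false cb)
      ... | is-pin a' | is-pin b' = reach⁺ (conn h a' b' ca cb)

module ArcContraction {f f' : PF} {k J'} (H : Contraction f f' k (pin k J')) where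
  open Contraction H

  J = pin k J'

  data Step (a : ℕ) : ℕ → Set where
    through : f' a ≡ just J' → Step a k
    direct  : ∀ {b} → f' a ≡ just b → b ≢ J' → Step a (pin k b)

  step⁻ : ∀ {a y} → f (pin k a) ≡ just y → Step a y
  step⁻ {a} e with map-just⁻ (trans (sym (at-pin a)) e)
  ... | b , e' , eq with b ℕ.≟ J'
  ...   | yes refl = subst (Step a) (trans (sym (redirect-≡ k J')) eq) (through e')
  ...   | no  ne   = subst (Step a) (trans (sym (redirect-≢ k (ne ∘ pin-injective k))) eq) (direct e' ne)

  step-through : ∀ {a} → f' a ≡ just J' → f (pin k a) ≡ just k
  step-through {a} e = trans (at-pin a) (trans (cong (Maybe.map _) e) (cong just (redirect-≡ k J')))

  step-direct : ∀ {a b} → f' a ≡ just b → b ≢ J' → f (pin k a) ≡ just (pin k b)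
  step-direct {a} e ne = trans (at-pin a) (trans (cong (Maybe.map _) e) (cong just (redirect-≢ k (ne ∘ pin-injective k))))

  step⁺ : ∀ {a b} → f' a ≡ just b → Reach f (pin k a) (pin k b)
  step⁺ {a} {b} e with b ℕ.≟ J'
  ... | yes refl = stop ▸ step-through e ▸ at-k
  ... | no  ne   = stop ▸ step-direct e ne

  reach⁺ : ∀ {a b} → Reach f' a b → Reach f (pin k a) (pin k b)
  reach⁺ stop    = stop
  reach⁺ (r ▸ e) = Reach-trans (reach⁺ r) (step⁺ e)

  -- Seen from `f'`, a path of `f` may stop in the middle of an arc, namely at `k`; `at-arc` then
  -- records the vertex `J'` about to be entered.
  data Trace (a : ℕ) : ℕ → Set where
    at-vertex : ∀ {b} → Reach f' a b → Trace a (pin k b)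
    at-arc    : Reach f' a J' → Trace a k

  reach⁻ : ∀ {a y} → Reach f (pin k a) y → Trace a y
  reach⁻ stop = at-vertex stop
  reach⁻ (r ▸ e) with reach⁻ r
  ... | at-arc r' = subst (Trace _) (just-injective (trans (sym at-k) e)) (at-vertex r')
  ... | at-vertex r' with step⁻ e
  ...   | through e'  = at-arc (r' ▸ e')
  ...   | direct e' _ = at-vertex (r' ▸ e')

  reach-pin⁻ : ∀ {a b} → Reach f (pin k a) (pin k b) → Reach f' a b
  reach-pin⁻ {a} {b} r = go (reach⁻ r) refl
    where
    go : ∀ {y} → Trace a y → y ≡ pin k b → Reach f' a b
    go (at-vertex r) e = subst (Reach f' a) (pin-injective k e) r
    go (at-arc r)    e = ⊥-elim (pin≢ k b (sym e))

  -- Every arc of `f'` into `J'` has been redirected to `k`, so only the arc from `k` still enters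
  -- `J`.
  pred-J : ∀ {a} → f a ≡ just J → a ≡ k
  pred-J {a} e with pinView k a
  ... | is-k     = refl
  ... | is-pin b = ⊥-elim (go (step⁻ e) refl)
    where
    go : ∀ {y} → Step b y → y ≢ J
    go (through _)   eq = pin≢ k J' (sym eq)
    go (direct _ ne) eq = ne (pin-injective k eq)

  module _ (C : ℕ → Bool) where
    -- The arc k → J is the only one out of `k` and the only one into `J`, so a cycle contains both
    -- ends or neither.
    cycle-agrees : IsCycle f C → C k ≡ C (pin k J')
    cycle-agrees h = bool-ext to from
      where
      to : C k ≡ true → C J ≡ true
      to ck with closed h k ck
      ... | b , e , cb = subst (λ x → C x ≡ true) (just-injective (trans (sym e) at-k)) cb
      from : C J ≡ true → C k ≡ true
      from cJ with cycle-pred h cJ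
      ... | a , ca , e = subst (λ x → C x ≡ true) (pred-J e) ca

    cycle⁻ : IsCycle f C → IsCycle f' (C ∘ pin k)
    cycle⁻ h = cyc (bs (base h)) cl cn
      where
      bs : (∃ λ a → C a ≡ true) → ∃ λ a → C (pin k a) ≡ true
      bs (a , ca) with pinView k a
      ... | is-k     = J' , trans (sym (cycle-agrees h)) ca
      ... | is-pin b = b , ca
      cl : ∀ a → C (pin k a) ≡ true → ∃ λ b → f' a ≡ just b × C (pin k b) ≡ true
      cl a ca with closed h (pin k a) ca
      ... | y , e , cy with step⁻ e
      ...   | through e'      = J' , e' , trans (sym (cycle-agrees h)) cy
      ...   | direct {b} e' _ = b , e' , cy
      cn : ∀ a b → C (pin k a) ≡ true → C (pin k b) ≡ true → Reach f' a b
      cn a b ca cb = reach-pin⁻ (conn h _ _ ca cb)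

    cycle⁺ : C k ≡ C (pin k J') → IsCycle f' (C ∘ pin k) → IsCycle f C
    cycle⁺ eq h = cyc (pin k (proj₁ (base h)) , proj₂ (base h)) cl cn
      where
      cl : ∀ a → C a ≡ true → ∃ λ b → f a ≡ just b × C b ≡ true
      cl a ca with pinView k a
      ... | is-k     = J , at-k , trans (sym eq) ca
      ... | is-pin a' with closed h a' ca
      ...   | b , e , cb with b ℕ.≟ J'
      ...     | yes refl = k , step-through e , trans eq cb
      ...     | no  ne   = pin k b , step-direct e ne , cb
      from-k : ∀ {y} → Reach f J y → Reach f k y
      from-k r = Reach-trans (stop ▸ at-k) r
      -- To arrive at `k`, go round the contracted cycle to a predecessor of `J'`: in `f` its arc
      -- leads to `k`.
      to-k : ∀ a → C (pin k a) ≡ true → C k ≡ true → Reach f (pin k a) k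
      to-k a ca ck with cycle-pred h (trans (sym eq) ck)
      ... | i , ci , e = reach⁺ (conn h a i ca ci) ▸ step-through e
      cn : ∀ a b → C a ≡ true → C b ≡ true → Reach f a b
      cn a b ca cb with pinView k a | pinView k b
      ... | is-k      | is-k      = stop
      ... | is-k      | is-pin b' = from-k (reach⁺ (conn h J' b' (trans (sym eq) ca) cb))
      ... | is-pin a' | is-k      = to-k a' ca cb
      ... | is-pin a' | is-pin b' = reach⁺ (conn h a' b' ca cb)

-- The bounded search for cycle sets decides `IsCycle`

appℕ-< : ∀ {p q} (φ : PMap p q) {a b} → appℕ φ a ≡ just b → a < p
appℕ-< (x ∷ φ) {zero}  e = z<s
appℕ-< (x ∷ φ) {suc a} e = s<s (appℕ-< φ e)

inSet-< : ∀ {p} (C : Vec Bool p) {a} → inSet C a ≡ true → a < p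
inSet-< (x ∷ C) {zero}  e = z<s
inSet-< (x ∷ C) {suc a} e = s<s (inSet-< C e)

>>=-just⁻ : ∀ {A B : Set} (x : Maybe A) {f : A → Maybe B} {b} → (x >>= f) ≡ just b → ∃ λ a → x ≡ just a × f a ≡ just b
>>=-just⁻ (just a) e = a , refl , e

module _ {p q} (φ : PMap p q) where
  private f = appℕ φ

  iter-step : ∀ t {a b c} → iter φ t a ≡ just b → f b ≡ just c → iter φ (suc t) a ≡ just c
  iter-step t e e' rewrite e = e'

  iter-+ : ∀ s t {a b} → iter φ t a ≡ just b → iter φ (s N.+ t) a ≡ iter φ s b
  iter-+ zero    t e = e
  iter-+ (suc s) t e = cong (_>>= f) (iter-+ s t e)

  iter-prefix : ∀ s t {a b} → iter φ (s N.+ t) a ≡ just b → ∃ λ c → iter φ t a ≡ just c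
  iter-prefix zero    t e = _ , e
  iter-prefix (suc s) t e = iter-prefix s t (proj₁ (proj₂ (>>=-just⁻ (iter φ (s N.+ t) _) e)))

  iter-cycle : ∀ {u} e → iter φ e u ≡ just u → ∀ k r → iter φ (r N.+ k N.* e) u ≡ iter φ r u
  iter-cycle {u} e eq k r = iter-+ r (k N.* e) (loop k)
    where
    loop : ∀ k → iter φ (k N.* e) u ≡ just u
    loop zero    = refl
    loop (suc k) = trans (iter-+ e (k N.* e) (loop k)) eq

  iter⇒Reach : ∀ t {a b} → iter φ t a ≡ just b → Reach f a b
  iter⇒Reach zero    refl = stop
  iter⇒Reach (suc t) e with >>=-just⁻ (iter φ t _) e
  ... | c , e₁ , e₂ = iter⇒Reach t e₁ ▸ e₂

  Reach⇒iter : ∀ {a b} → Reach f a b → ∃ λ t → iter φ t a ≡ just b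
  Reach⇒iter stop = 0 , refl
  Reach⇒iter (r ▸ e) with Reach⇒iter r
  ... | t , e' = suc t , iter-step t e' e

  inOrbit⁻ : ∀ {j e k} → inOrbit φ j e k ≡ true → ∃ λ t → t < e × iter φ t j ≡ just k
  inOrbit⁻ {j} {e} {k} h with any-true⁻ (λ t → eqM (iter φ t j) k) (upTo e) h
  ... | t , i , eq = t , ∈-upTo⁻ i , eqM⇒≡ eq

  inOrbit⁺ : ∀ {j e k t} → t < e → iter φ t j ≡ just k → inOrbit φ j e k ≡ true
  inOrbit⁺ {j} {e} {k} lt eq = any-true⁺ (λ t → eqM (iter φ t j) k) (upTo e) (∈-upTo⁺ lt) (≡⇒eqM eq)

  -- Pigeonhole: the exponents 0,...,p give `p + 1` iterates with values below `p`.
  iter-repeats : ∀ u → (∀ {t} → t ≤ p → ∃ λ x → iter φ t u ≡ just x × x < p) →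
    ∃₂ λ s t → s < t × t ≤ p × ∃ λ x → iter φ s u ≡ just x × iter φ t u ≡ just x
  iter-repeats u h with FinP.pigeonhole (ℕ.n<1+n p) (λ i → fromℕ< (proj₂ (proj₂ (h (ℕ.≤-pred (FinP.toℕ<n i))))))
  ... | i , j , i<j , eq with h (ℕ.≤-pred (FinP.toℕ<n i)) | h (ℕ.≤-pred (FinP.toℕ<n j))
  ...   | x , ex , x<p | y , ey , y<p =
    toℕ i , toℕ j , i<j , ℕ.≤-pred (FinP.toℕ<n j) , x , ex , trans ey (cong just (sym (FinP.fromℕ<-injective _ _ x<p y<p eq)))

  module _ (C : Vec Bool p) where
    isCycleSet⁻ : isCycleSet φ C ≡ true → IsCycle f (inSet C)
    isCycleSet⁻ h with any-true⁻ _ (upTo p) h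
    ... | j , j∈ , h₁ with any-true⁻ _ (map suc (upTo p)) h₁
    ...   | e , e∈ , h₂ with ∈-map⁻ suc e∈ | ∧-true⁻ {eqM (iter φ e j) j} h₂
    ...     | e' , _ , refl | h₃ , h₄ = cyc (j , point 0 refl z≤n) closed' conn'
      where
      per : iter φ e j ≡ just j
      per = eqM⇒≡ h₃
      orb : ∀ {k} → k < p → inSet C k ≡ inOrbit φ j e k
      orb lt = ⇔ᵇ⇒≡ (all-true⁻ _ (upTo p) h₄ (∈-upTo⁺ lt))
      -- `orb` covers only indices below `p`. For `t < e` a further iterate exists, so the point has
      -- an image and is a row index; for `t = e` it is `j` again.
      point : ∀ t {x} → iter φ t j ≡ just x → t ≤ e → inSet C x ≡ true
      point t {x} eq le with ℕ.m≤n⇒m<n∨m≡n le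
      ... | inj₂ refl rewrite just-injective (trans (sym eq) per) = point 0 refl z≤n
      ... | inj₁ lt with iter-prefix (e ∸ suc t) (suc t) (subst (λ t → iter φ t j ≡ just j) (sym (ℕ.m∸n+n≡m lt)) per)
      ...   | y , e₁ with >>=-just⁻ (iter φ t j) e₁
      ...     | x' , e₂ , e₃ rewrite just-injective (trans (sym e₂) eq) = trans (orb (appℕ-< φ e₃)) (inOrbit⁺ lt eq)
      unpoint : ∀ {x} → inSet C x ≡ true → ∃ λ t → t < e × iter φ t j ≡ just x
      unpoint cx = inOrbit⁻ {e = e} (trans (sym (orb (inSet-< C cx))) cx)
      closed' : Closed f (inSet C)
      closed' a ca with unpoint ca
      ... | t , lt , eq with iter-prefix (e ∸ suc t) (suc t) (subst (λ t → iter φ t j ≡ just j) (sym (ℕ.m∸n+n≡m lt)) per)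
      ...   | y , e₁ with >>=-just⁻ (iter φ t j) e₁
      ...     | x' , e₂ , e₃ rewrite just-injective (trans (sym e₂) eq) = y , e₃ , point (suc t) e₁ lt
      conn' : ∀ a b → inSet C a ≡ true → inSet C b ≡ true → Reach f a b
      conn' a b ca cb with unpoint ca | unpoint cb
      ... | t , lt , eq | s , _ , eq' = Reach-trans
        (iter⇒Reach (e ∸ t) (trans (sym (iter-+ (e ∸ t) t eq)) (trans (cong (λ t → iter φ t j) (ℕ.m∸n+n≡m (ℕ.<⇒≤ lt))) per)))
        (iter⇒Reach s eq')

    isCycleSet⁺ : IsCycle f (inSet C) → isCycleSet φ C ≡ true
    isCycleSet⁺ h with IsCycle.base h
    -- The orbit of any member stays in the finite set `C` and hence repeats. The repeated point `u`
    -- becomes the base point of the search, and the gap between the two equal iterates its length.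
    ... | u₀ , c₀ with iter-repeats u₀ (λ {t} _ → let x , eq , cx = orbit t in x , eq , inSet-< C cx)
      where
      orbit : ∀ t → ∃ λ x → iter φ t u₀ ≡ just x × inSet C x ≡ true
      orbit zero = u₀ , refl , c₀
      orbit (suc t) with orbit t
      ... | x , eq , cx with IsCycle.closed h x cx
      ...   | y , e , cy = y , iter-step t eq e , cy
    ... | s , t , s<t , t≤p , u , es , et = any-true⁺ _ (upTo p) (∈-upTo⁺ (inSet-< C cu))
        (any-true⁺ _ (map suc (upTo p)) e∈
          (∧-true⁺ (≡⇒eqM per) (all-true⁺ _ (upTo p) λ {k} _ → subst (λ b → (inSet C k ⇔ᵇ b) ≡ true) (orb k) (⇔ᵇ-refl (inSet C k)))))
      where
      cu : inSet C u ≡ true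
      cu = closed-Reach (inSet C) (IsCycle.closed h) c₀ (iter⇒Reach s es)
      -- The length `t - s` is presented as a successor, as membership in `map suc (upTo p)` and
      -- division by `e` require.
      d = t ∸ suc s
      e = suc d
      e+s : e N.+ s ≡ t
      e+s = trans (sym (ℕ.+-suc d s)) (ℕ.m∸n+n≡m s<t)
      e∈ : e ∈ map suc (upTo p)
      e∈ = ∈-map⁺ suc (∈-upTo⁺ (ℕ.≤-trans (ℕ.m≤m+n e s) (subst (_≤ p) (sym e+s) t≤p)))
      per : iter φ e u ≡ just u
      per = trans (sym (iter-+ e s es)) (trans (cong (λ t → iter φ t u₀) e+s) et)
      orb : ∀ k → inSet C k ≡ inOrbit φ u e k
      orb k = bool-ext to from
        where
        to : inSet C k ≡ true → inOrbit φ u e k ≡ true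
        to ck with Reach⇒iter (IsCycle.conn h u k cu ck)
        -- The exponent that leads from `u` to `k` is reduced modulo the period `e`.
        ... | n , eq = inOrbit⁺ (m%n<n n e)
          (trans (sym (iter-cycle e per (n / e) (n % e))) (trans (cong (λ t → iter φ t u) (sym (m≡m%n+[m/n]*n n e))) eq))
        from : inOrbit φ u e k ≡ true → inSet C k ≡ true
        from o with inOrbit⁻ {e = e} o
        ... | n , _ , eq = closed-Reach (inSet C) (IsCycle.closed h) cu (iter⇒Reach n eq)

isCycleSet-cong : ∀ {p q p' q'} (φ : PMap p q) (C : Vec Bool p) (ψ : PMap p' q') (D : Vec Bool p') →
  (IsCycle (appℕ φ) (inSet C) → IsCycle (appℕ ψ) (inSet D)) → (IsCycle (appℕ ψ) (inSet D) → IsCycle (appℕ φ) (inSet C)) →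
  isCycleSet φ C ≡ isCycleSet ψ D
isCycleSet-cong φ C ψ D f g = bool-ext (isCycleSet⁺ ψ D ∘ f ∘ isCycleSet⁻ φ C) (isCycleSet⁺ φ C ∘ g ∘ isCycleSet⁻ ψ D)

-- Counting cycle sets under a contraction

b2n : Bool → ℕ
b2n true  = 1
b2n false = 0

count : {A : Set} → (A → Bool) → List A → ℕ
count P xs = length (filterᵇ P xs)

count-∷ : ∀ {A : Set} (P : A → Bool) x xs → count P (x ∷ xs) ≡ b2n (P x) N.+ count P xs
count-∷ P x xs with P x
... | true  = refl
... | false = refl

count-cong : ∀ {A : Set} {P R : A → Bool} → (∀ x → P x ≡ R x) → ∀ xs → count P xs ≡ count R xs
count-cong h []       = refl
count-cong {P = P} {R} h (x ∷ xs) = trans (count-∷ P x xs) (trans (cong₂ N._+_ (cong b2n (h x)) (count-cong h xs)) (sym (count-∷ R x xs)))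

count-partition : ∀ {A : Set} (P R : A → Bool) xs →
  count (λ x → P x ∧ R x) xs N.+ count (λ x → P x ∧ not (R x)) xs ≡ count P xs
count-partition P R [] = refl
count-partition P R (x ∷ xs)
  rewrite count-∷ (λ x → P x ∧ R x) x xs | count-∷ (λ x → P x ∧ not (R x)) x xs | count-∷ P x xs | sym (count-partition P R xs)
  with P x | R x
... | false | _     = refl
... | true  | true  = refl
... | true  | false = ℕ.+-suc _ _

count-head : ∀ {p} (P : Vec Bool (suc p) → Bool) xs →
  count P (concatMap (λ v → (true ∷ v) ∷ (false ∷ v) ∷ []) xs) ≡ count (λ v → P (true ∷ v)) xs N.+ count (λ v → P (false ∷ v)) xs
count-head P [] = refl
count-head P (x ∷ xs) = begin
  count P ((true ∷ x) ∷ (false ∷ x) ∷ rest)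
    ≡⟨ count-∷ P (true ∷ x) _ ⟩
  b2n (P (true ∷ x)) N.+ count P ((false ∷ x) ∷ rest)
    ≡⟨ cong (b2n (P (true ∷ x)) N.+_) (count-∷ P (false ∷ x) rest) ⟩
  b2n (P (true ∷ x)) N.+ (b2n (P (false ∷ x)) N.+ count P rest)
    ≡⟨ sym (ℕ.+-assoc (b2n (P (true ∷ x))) _ _) ⟩
  (b2n (P (true ∷ x)) N.+ b2n (P (false ∷ x))) N.+ count P rest
    ≡⟨ cong ((b2n (P (true ∷ x)) N.+ b2n (P (false ∷ x))) N.+_) (count-head P xs) ⟩
  (b2n (P (true ∷ x)) N.+ b2n (P (false ∷ x))) N.+ (count (λ v → P (true ∷ v)) xs N.+ count (λ v → P (false ∷ v)) xs)
    ≡⟨ ℕ-interchange (b2n (P (true ∷ x))) _ _ _ ⟩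
  (b2n (P (true ∷ x)) N.+ count (λ v → P (true ∷ v)) xs) N.+ (b2n (P (false ∷ x)) N.+ count (λ v → P (false ∷ v)) xs)
    ≡⟨ cong₂ N._+_ (sym (count-∷ (λ v → P (true ∷ v)) x xs)) (sym (count-∷ (λ v → P (false ∷ v)) x xs)) ⟩
  count (λ v → P (true ∷ v)) (x ∷ xs) N.+ count (λ v → P (false ∷ v)) (x ∷ xs) ∎
  where
  open ≡-Reasoning
  rest = concatMap (λ v → (true ∷ v) ∷ (false ∷ v) ∷ []) xs

-- The contracted vertex can be any row, so subsets have to be sorted by membership of an arbitrary
-- `k` and not only of the head.
count-insertAt : ∀ {p} (k : Fin (suc p)) (P : Vec Bool (suc p) → Bool) →
  count P (allSubsets (suc p)) ≡ count (λ w → P (insertAt w k true)) (allSubsets p) N.+ count (λ w → P (insertAt w k false)) (allSubsets p)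
count-insertAt {p} zero P = count-head P (allSubsets p)
count-insertAt {suc p} (suc k) P = begin
  count P (allSubsets (suc (suc p)))
    ≡⟨ count-head P (allSubsets (suc p)) ⟩
  count (λ v → P (true ∷ v)) (allSubsets (suc p)) N.+ count (λ v → P (false ∷ v)) (allSubsets (suc p))
    ≡⟨ cong₂ N._+_ (count-insertAt k (λ v → P (true ∷ v))) (count-insertAt k (λ v → P (false ∷ v))) ⟩
  (count (λ w → P (true ∷ insertAt w k true)) U N.+ count (λ w → P (true ∷ insertAt w k false)) U)
    N.+ (count (λ w → P (false ∷ insertAt w k true)) U N.+ count (λ w → P (false ∷ insertAt w k false)) U)
    ≡⟨ ℕ-interchange (count (λ w → P (true ∷ insertAt w k true)) U) _ _ _ ⟩
  (count (λ w → P (true ∷ insertAt w k true)) U N.+ count (λ w → P (false ∷ insertAt w k true)) U)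
    N.+ (count (λ w → P (true ∷ insertAt w k false)) U N.+ count (λ w → P (false ∷ insertAt w k false)) U)
    ≡⟨ sym (cong₂ N._+_ (count-head (λ w → P (insertAt w (suc k) true)) U) (count-head (λ w → P (insertAt w (suc k) false)) U)) ⟩
  count (λ w → P (insertAt w (suc k) true)) (allSubsets (suc p)) N.+ count (λ w → P (insertAt w (suc k) false)) (allSubsets (suc p)) ∎
  where
  open ≡-Reasoning
  U = allSubsets p

-- Serves to count the cycle sets through a loop at `k`: the only one is the singleton of `k`, whose
-- remaining part is empty.
isEmpty : ∀ {p} → Vec Bool p → Bool
isEmpty []      = true
isEmpty (b ∷ v) = not b ∧ isEmpty v

isEmpty⁻ : ∀ {p} (v : Vec Bool p) → isEmpty v ≡ true → ∀ a → inSet v a ≡ false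
isEmpty⁻ []          e a       = refl
isEmpty⁻ (false ∷ v) e zero    = refl
isEmpty⁻ (false ∷ v) e (suc a) = isEmpty⁻ v e a

isEmpty⁺ : ∀ {p} (v : Vec Bool p) → (∀ a → inSet v a ≡ false) → isEmpty v ≡ true
isEmpty⁺ []      h = refl
isEmpty⁺ (b ∷ v) h rewrite h 0 = isEmpty⁺ v (h ∘ suc)

count-none : ∀ {A : Set} (xs : List A) → count (λ _ → false) xs ≡ 0
count-none []       = refl
count-none (x ∷ xs) = count-none xs

count-isEmpty : ∀ p → count isEmpty (allSubsets p) ≡ 1
count-isEmpty zero    = refl
count-isEmpty (suc p) = trans (count-head isEmpty (allSubsets p)) (cong₂ N._+_ (count-none (allSubsets p)) (count-isEmpty p))

inSet-insertAt : ∀ {p} (w : Vec Bool p) k b → inSet (insertAt w k b) (toℕ k) ≡ b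
inSet-insertAt w       zero    b = refl
inSet-insertAt (x ∷ w) (suc k) b = inSet-insertAt w k b

inSet-insertAt-pin : ∀ {p} (w : Vec Bool p) k b a → inSet (insertAt w k b) (pin (toℕ k) a) ≡ inSet w a
inSet-insertAt-pin w       zero    b a       = refl
inSet-insertAt-pin (x ∷ w) (suc k) b zero    = refl
inSet-insertAt-pin (x ∷ w) (suc k) b (suc a) = inSet-insertAt-pin w k b a

appℕ-insertAt : ∀ {p q} (φ : PMap p q) k x → appℕ (insertAt φ k x) (toℕ k) ≡ Maybe.map toℕ x
appℕ-insertAt φ       zero    x = refl
appℕ-insertAt (y ∷ φ) (suc k) x = appℕ-insertAt φ k x

appℕ-insertAt-pin : ∀ {p q} (φ : PMap p q) k x a → appℕ (insertAt φ k x) (pin (toℕ k) a) ≡ appℕ φ a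
appℕ-insertAt-pin φ       zero    x a       = refl
appℕ-insertAt-pin (y ∷ φ) (suc k) x zero    = refl
appℕ-insertAt-pin (y ∷ φ) (suc k) x (suc a) = appℕ-insertAt-pin φ k x a

appℕ-map : ∀ {p q q'} (g : Fin q → Fin q') (g' : ℕ → ℕ) → (∀ i → toℕ (g i) ≡ g' (toℕ i)) →
  ∀ (φ : PMap p q) a → appℕ (Vec.map (Maybe.map g) φ) a ≡ Maybe.map g' (appℕ φ a)
appℕ-map g g' h []            a       = refl
appℕ-map g g' h (nothing ∷ φ) zero    = refl
appℕ-map g g' h (just i ∷ φ)  zero    = cong just (h i)
appℕ-map g g' h (x ∷ φ)       (suc a) = appℕ-map g g' h φ a

toℕ-punchIn : ∀ {q} (k : Fin (suc q)) b → toℕ (punchIn k b) ≡ pin (toℕ k) (toℕ b)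
toℕ-punchIn zero    b       = refl
toℕ-punchIn (suc k) zero    = refl
toℕ-punchIn (suc k) (suc b) = cong suc (toℕ-punchIn k b)

redirectᶠ : ∀ {q} → Fin (suc q) → Fin (suc q) → Fin q → Fin (suc q)
redirectᶠ K J b = if punchIn K b ≟ᶠ J then K else punchIn K b

toℕ-redirectᶠ : ∀ {q} (K J : Fin (suc q)) b → toℕ (redirectᶠ K J b) ≡ redirect (toℕ K) (toℕ J) (toℕ b)
toℕ-redirectᶠ K J b rewrite toℕ-punchIn K b with pin (toℕ K) (toℕ b) ≡ᵇ toℕ J
... | true  = refl
... | false = toℕ-punchIn K b

redirect-injective : ∀ k J {a b} → redirect k J a ≡ redirect k J b → a ≡ b
redirect-injective k J {a} {b} e with pin k a ≡ᵇ J in ea | pin k b ≡ᵇ J in eb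
... | true  | true  = pin-injective k (trans (≡ᵇ⇒≡ ea) (sym (≡ᵇ⇒≡ eb)))
... | true  | false = ⊥-elim (pin≢ k b (sym e))
... | false | true  = ⊥-elim (pin≢ k a e)
... | false | false = pin-injective k e

redirect≢ : ∀ k J b → redirect k J b ≢ J
redirect≢ k J b e with pin k b ≡ᵇ J in eb
... | true  = pin≢ k b (trans (≡ᵇ⇒≡ eb) (sym e))
... | false rewrite e = true≢false (≡ᵇ-refl J) eb

-- The inverse of a contraction: `φ` is relabelled and the arc K → J is put back. `Kᶜ` is a separate
-- argument because rows and columns have different types: as the same number as `K` it gives the
-- operation on digraphs, and as `J` it gives the ordinary minor.
expand : ∀ {p q} → Fin (suc p) → Fin (suc q) → Fin (suc q) → PMap p q → PMap (suc p) (suc q)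
expand K Kᶜ J φ = insertAt (Vec.map (Maybe.map (redirectᶠ Kᶜ J)) φ) K (just J)

expand-contraction : ∀ {p q} (K : Fin (suc p)) (Kᶜ J : Fin (suc q)) → toℕ Kᶜ ≡ toℕ K → (φ : PMap p q) →
  Contraction (appℕ (expand K Kᶜ J φ)) (appℕ φ) (toℕ K) (toℕ J)
expand-contraction K Kᶜ J eq φ = contr (appℕ-insertAt _ K (just J)) λ a →
  trans (appℕ-insertAt-pin _ K (just J) a)
    (appℕ-map (redirectᶠ Kᶜ J) _ (λ i → trans (toℕ-redirectᶠ Kᶜ J i) (cong (λ k → redirect k (toℕ J) (toℕ i)) eq)) φ a)

IsCycle-resp : ∀ {f C D} → (∀ a → C a ≡ D a) → IsCycle f C → IsCycle f D
IsCycle-resp h (cyc (a , ca) cl cn) = cyc (a , trans (sym (h a)) ca)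
  (λ a da → let b , e , cb = cl a (trans (h a) da) in b , e , trans (sym (h b)) cb)
  λ a b da db → cn a b (trans (h a) da) (trans (h b) db)

-- Cycle sets are sorted by whether they contain `K`. For a loop, only the singleton contains `K`,
-- and the others are the cycles of `φ`. For a proper arc, a cycle contains `K` exactly when it
-- contains the target, so the two classes are the cycles of `φ` through `J'` and those avoiding it.
numCycles-expand : ∀ {p q} (K : Fin (suc p)) (Kᶜ J : Fin (suc q)) → toℕ Kᶜ ≡ toℕ K → (φ : PMap p q) →
  numCycles (expand K Kᶜ J φ) ≡ b2n (J ≟ᶠ Kᶜ) N.+ numCycles φ
numCycles-expand {p} {q} K Kᶜ J eq φ = trans (count-insertAt K (isCycleSet Φ)) (split (expand-contraction K Kᶜ J eq φ) (pinView (toℕ K) (toℕ J)))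
  where
  Φ = expand K Kᶜ J φ
  k = toℕ K
  U = allSubsets p
  split : ∀ {J'} → Contraction (appℕ Φ) (appℕ φ) k J' → PinView k J' →
    count (λ w → isCycleSet Φ (insertAt w K true)) U N.+ count (λ w → isCycleSet Φ (insertAt w K false)) U ≡ b2n (J' ≡ᵇ toℕ Kᶜ) N.+ numCycles φ
  split H is-k rewrite eq | ≡ᵇ-refl k = cong₂ N._+_ (trans (count-cong atK U) (count-isEmpty p)) (count-cong offK U)
    where
    open LoopContraction H
    atK : ∀ w → isCycleSet Φ (insertAt w K true) ≡ isEmpty w
    atK w = bool-ext
      (λ e → isEmpty⁺ w λ a → trans (sym (inSet-insertAt-pin w K true a)) (cycle-at⁻ C (inSet-insertAt w K true) (isCycleSet⁻ Φ D e) a))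
      (λ e → isCycleSet⁺ Φ D (cycle-at⁺ C (inSet-insertAt w K true) λ a → trans (inSet-insertAt-pin w K true a) (isEmpty⁻ w e a)))
      where D = insertAt w K true ; C = inSet D
    offK : ∀ w → isCycleSet Φ (insertAt w K false) ≡ isCycleSet φ w
    offK w = isCycleSet-cong Φ D φ w
      (λ h → IsCycle-resp (inSet-insertAt-pin w K false) (cycle-off⁻ C (inSet-insertAt w K false) h))
      (λ h → cycle-off⁺ C (inSet-insertAt w K false) (IsCycle-resp (λ a → sym (inSet-insertAt-pin w K false a)) h))
      where D = insertAt w K false ; C = inSet D
  split H (is-pin J') rewrite eq | ≢⇒≡ᵇ (pin≢ k J') =
    trans (cong₂ N._+_ (count-cong (λ w → side w true) U) (count-cong (λ w → side w false) U))
      (count-partition (isCycleSet φ) (λ w → inSet w J') U)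
    where
    open ArcContraction H hiding (J)
    side : ∀ w b → isCycleSet Φ (insertAt w K b) ≡ isCycleSet φ w ∧ (b ⇔ᵇ inSet w J')
    side w b = bool-ext to from
      where
      D = insertAt w K b
      C = inSet D
      to : isCycleSet Φ D ≡ true → isCycleSet φ w ∧ (b ⇔ᵇ inSet w J') ≡ true
      to e = let h = isCycleSet⁻ Φ D e in ∧-true⁺
        (isCycleSet⁺ φ w (IsCycle-resp (inSet-insertAt-pin w K b) (cycle⁻ C h)))
        (subst (λ x → (b ⇔ᵇ x) ≡ true) (trans (trans (sym (inSet-insertAt w K b)) (cycle-agrees C h)) (inSet-insertAt-pin w K b J')) (⇔ᵇ-refl b))
      from : isCycleSet φ w ∧ (b ⇔ᵇ inSet w J') ≡ true → isCycleSet Φ D ≡ true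
      from e with ∧-true⁻ {isCycleSet φ w} e
      ... | e₁ , e₂ = isCycleSet⁺ Φ D (cycle⁺ C
        (trans (inSet-insertAt w K b) (trans (⇔ᵇ⇒≡ e₂) (sym (inSet-insertAt-pin w K b J'))))
        (IsCycle-resp (λ a → sym (inSet-insertAt-pin w K b a)) (isCycleSet⁻ φ w e₁)))

-- Injectivity of partial maps under insertion and relabelling

InjectiveF : ∀ {p q} → PMap p q → Set
InjectiveF φ = ∀ i i' a → lookup φ i ≡ just a → lookup φ i' ≡ just a → i ≡ i'

∨-false : ∀ {a b} → a ∨ b ≡ true → b ≡ false → a ≡ true
∨-false {true} _ _ = refl
∨-false {false} e f = contradiction f (true≢false e)

isInj⁻ : ∀ {p q} (φ : PMap p q) → isInj φ ≡ true → InjectiveF φ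
isInj⁻ {p} φ e i i' a li li' with all-true⁻ _ (allFin p) (all-true⁻ _ (allFin p) e (∈-allFin i)) (∈-allFin i')
... | h rewrite li | li' | ≡ᵇ-refl (toℕ a) = FinP.toℕ-injective (≡ᵇ⇒≡ (∨-false h refl))

all-false⁻ : ∀ {A : Set} (P : A → Bool) xs → all P xs ≡ false → ∃ λ x → P x ≡ false
all-false⁻ P (x ∷ xs) e with P x in eq
... | false = x , eq
... | true  = all-false⁻ P xs e

isInj⁺ : ∀ {p q} (φ : PMap p q) → InjectiveF φ → isInj φ ≡ true
isInj⁺ {p} φ h with isInj φ in e
... | true = refl
... | false with i , e₁ ← all-false⁻ _ (allFin p) e with i' , e₂ ← all-false⁻ _ (allFin p) e₁
  with toℕ i ≡ᵇ toℕ i' in ne | lookup φ i in li | lookup φ i' in li'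
... | false | just a | just b with toℕ a ≡ᵇ toℕ b in ab
...   | true = contradiction ne (true≢false (trans (cong (λ x → toℕ i ≡ᵇ toℕ x)
    (sym (h i i' b (trans li (cong just (FinP.toℕ-injective (≡ᵇ⇒≡ ab)))) li'))) (≡ᵇ-refl (toℕ i))))

fresh : ∀ {p q} → Fin q → PMap p q → Bool
fresh J []            = true
fresh J (nothing ∷ v) = fresh J v
fresh J (just a ∷ v)  = not (a ≟ᶠ J) ∧ fresh J v

fresh⁻ : ∀ {p q} {J : Fin q} (v : PMap p q) → fresh J v ≡ true → ∀ i → lookup v i ≢ just J
fresh⁻ {J = J} (just a ∷ v) e zero    refl rewrite ≡ᵇ-refl (toℕ J) = contradiction e λ ()
fresh⁻ (nothing ∷ v)        e (suc i) l    = fresh⁻ v e i l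
fresh⁻ {J = J} (just a ∷ v) e (suc i) l    = fresh⁻ v (proj₂ (∧-true⁻ {not (a ≟ᶠ J)} e)) i l

fresh⁺ : ∀ {p q} {J : Fin q} (v : PMap p q) → (∀ i → lookup v i ≢ just J) → fresh J v ≡ true
fresh⁺ []            h = refl
fresh⁺ (nothing ∷ v) h = fresh⁺ v (h ∘ suc)
fresh⁺ {J = J} (just a ∷ v) h rewrite ≢⇒≡ᵇ {toℕ a} {toℕ J} (h zero ∘ cong just ∘ FinP.toℕ-injective) = fresh⁺ v (h ∘ suc)

data PunchView {p} (K : Fin (suc p)) : Fin (suc p) → Set where
  is-K     : PunchView K K
  is-punch : ∀ i → PunchView K (punchIn K i)

punchView : ∀ {p} (K i : Fin (suc p)) → PunchView K i
punchView K i with K Fin.≟ i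
... | yes refl = is-K
... | no  ne   = subst (PunchView K) (FinP.punchIn-punchOut ne) (is-punch (Fin.punchOut ne))

module _ {p q} (v : PMap p q) (K : Fin (suc p)) where
  isInj-insertAt-nothing : isInj (insertAt v K nothing) ≡ isInj v
  isInj-insertAt-nothing = bool-ext (λ e → isInj⁺ v (to (isInj⁻ w e))) (λ e → isInj⁺ w (from (isInj⁻ v e)))
    where
    w = insertAt v K nothing
    to : InjectiveF w → InjectiveF v
    to h i i' a li li' = FinP.punchIn-injective K i i'
      (h _ _ a (trans (VecP.insertAt-punchIn v K nothing i) li) (trans (VecP.insertAt-punchIn v K nothing i') li'))
    from : InjectiveF v → InjectiveF w
    from h i i' a li li' with punchView K i | punchView K i'
    ... | is-K | _ = contradiction li (nothing≢just (VecP.insertAt-lookup v K nothing))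
    ... | _ | is-K = contradiction li' (nothing≢just (VecP.insertAt-lookup v K nothing))
    ... | is-punch j | is-punch j' = cong (punchIn K)
      (h j j' a (trans (sym (VecP.insertAt-punchIn v K nothing j)) li) (trans (sym (VecP.insertAt-punchIn v K nothing j')) li'))

  isInj-insertAt-just : ∀ J → isInj (insertAt v K (just J)) ≡ fresh J v ∧ isInj v
  isInj-insertAt-just J = bool-ext
    (λ e → ∧-true⁺ (fresh⁺ v λ i li → FinP.punchInᵢ≢i K i (isInj⁻ w e _ _ J (trans (pu i) li) at)) (isInj⁺ v (to (isInj⁻ w e))))
    (λ e → let e₁ , e₂ = ∧-true⁻ {fresh J v} e in isInj⁺ w (from (fresh⁻ v e₁) (isInj⁻ v e₂)))
    where
    w = insertAt v K (just J)
    at : lookup w K ≡ just J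
    at = VecP.insertAt-lookup v K (just J)
    pu : ∀ i → lookup w (punchIn K i) ≡ lookup v i
    pu = VecP.insertAt-punchIn v K (just J)
    to : InjectiveF w → InjectiveF v
    to h i i' a li li' = FinP.punchIn-injective K i i' (h _ _ a (trans (pu i) li) (trans (pu i') li'))
    from : (∀ i → lookup v i ≢ just J) → InjectiveF v → InjectiveF w
    from fr h i i' a li li' with punchView K i | punchView K i'
    ... | is-K       | is-K        = refl
    ... | is-K       | is-punch j' = ⊥-elim (fr j' (trans (sym (pu j')) (trans li' (trans (sym li) at))))
    ... | is-punch j | is-K        = ⊥-elim (fr j (trans (sym (pu j)) (trans li (trans (sym li') at))))
    ... | is-punch j | is-punch j' = cong (punchIn K) (h j j' a (trans (sym (pu j)) li) (trans (sym (pu j')) li'))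

isInj-map : ∀ {p q q'} (g : Fin q → Fin q') → (∀ {i j} → g i ≡ g j → i ≡ j) → (v : PMap p q) →
  isInj (Vec.map (Maybe.map g) v) ≡ isInj v
isInj-map g gi v = bool-ext (λ e → isInj⁺ v (to (isInj⁻ w e))) (λ e → isInj⁺ w (from (isInj⁻ v e)))
  where
  w = Vec.map (Maybe.map g) v
  lk : ∀ i → lookup w i ≡ Maybe.map g (lookup v i)
  lk i = VecP.lookup-map i (Maybe.map g) v
  to : InjectiveF w → InjectiveF v
  to h i i' a li li' = h i i' (g a) (trans (lk i) (cong (Maybe.map g) li)) (trans (lk i') (cong (Maybe.map g) li'))
  from : InjectiveF v → InjectiveF w
  from h i i' a li li' with map-just⁻ (trans (sym (lk i)) li) | map-just⁻ (trans (sym (lk i')) li')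
  ... | b , e , eb | b' , e' , eb' = h i i' b e (trans e' (cong just (gi (trans eb' (sym eb)))))

redirectᶠ-injective : ∀ {q} (K J : Fin (suc q)) {i j} → redirectᶠ K J i ≡ redirectᶠ K J j → i ≡ j
redirectᶠ-injective K J {i} {j} e = FinP.toℕ-injective (redirect-injective (toℕ K) (toℕ J)
  (trans (sym (toℕ-redirectᶠ K J i)) (trans (cong toℕ e) (toℕ-redirectᶠ K J j))))

appℕ-lookup : ∀ {p q} (φ : PMap p q) i → appℕ φ (toℕ i) ≡ Maybe.map toℕ (lookup φ i)
appℕ-lookup (x ∷ φ) zero    = refl
appℕ-lookup (x ∷ φ) (suc i) = appℕ-lookup φ i

appℕ⁻ : ∀ {p q} (φ : PMap p q) {a b} → appℕ φ a ≡ just b → ∃₂ λ i c → toℕ i ≡ a × lookup φ i ≡ just c × toℕ c ≡ b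
appℕ⁻ φ {a} e with appℕ-lookup φ (fromℕ< (appℕ-< φ e))
... | h rewrite FinP.toℕ-fromℕ< (appℕ-< φ e) with map-just⁻ (trans (sym h) e)
...   | c , e₁ , e₂ = _ , c , FinP.toℕ-fromℕ< (appℕ-< φ e) , e₁ , e₂

appℕ⁺ : ∀ {p q} (φ : PMap p q) i {c} → lookup φ i ≡ just c → appℕ φ (toℕ i) ≡ just (toℕ c)
appℕ⁺ φ i e = trans (appℕ-lookup φ i) (cong (Maybe.map toℕ) e)

appℕ-injective : ∀ {p q} (φ : PMap p q) → isInj φ ≡ true → Injective (appℕ φ)
appℕ-injective φ h a b c ea eb with appℕ⁻ φ ea | appℕ⁻ φ eb
... | i , x , refl , ei , refl | j , y , refl , ej , ey with refl ← FinP.toℕ-injective ey = cong toℕ (isInj⁻ φ h i j x ei ej)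

-- Domains and their complements

dom : ∀ {p q} → PMap p q → Vec Bool p
dom = Vec.map is-just

dom-insertAt : ∀ {p q} (φ : PMap p q) K x → dom (insertAt φ K x) ≡ insertAt (dom φ) K (is-just x)
dom-insertAt φ K x = VecP.map-insertAt is-just x φ K

dom-map : ∀ {p q q'} (g : Fin q → Fin q') (φ : PMap p q) → dom (Vec.map (Maybe.map g) φ) ≡ dom φ
dom-map g []            = refl
dom-map g (nothing ∷ φ) = cong (false ∷_) (dom-map g φ)
dom-map g (just x ∷ φ)  = cong (true ∷_) (dom-map g φ)

dom-expand : ∀ {p q} K (Kᶜ J : Fin (suc q)) (φ : PMap p q) → dom (expand K Kᶜ J φ) ≡ insertAt (dom φ) K true
dom-expand K Kᶜ J φ = trans (dom-insertAt _ K (just J)) (cong (λ d → insertAt d K true) (dom-map (redirectᶠ Kᶜ J) φ))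

inSet-dom : ∀ {p q} (φ : PMap p q) a → inSet (dom φ) a ≡ false → appℕ φ a ≡ nothing
inSet-dom []            a       e = refl
inSet-dom (nothing ∷ φ) zero    e = refl
inSet-dom (x ∷ φ)       (suc a) e = inSet-dom φ a e

filterᵇ-cong : ∀ {A : Set} {P R : A → Bool} → (∀ x → P x ≡ R x) → ∀ xs → filterᵇ P xs ≡ filterᵇ R xs
filterᵇ-cong h [] = refl
filterᵇ-cong {P = P} {R} h (x ∷ xs) with P x | R x | h x
... | true  | true  | refl = cong (x ∷_) (filterᵇ-cong h xs)
... | false | false | refl = filterᵇ-cong h xs

filterᵇ-map : ∀ {A B : Set} (P : B → Bool) (f : A → B) xs → filterᵇ P (map f xs) ≡ map f (filterᵇ (P ∘ f) xs)
filterᵇ-map P f [] = refl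
filterᵇ-map P f (x ∷ xs) with P (f x)
... | true  = cong (f x ∷_) (filterᵇ-map P f xs)
... | false = filterᵇ-map P f xs

filterᵇ-tabulate-punchIn : ∀ {A : Set} {q} (P : A → Bool) (k : Fin (suc q)) (g : Fin (suc q) → A) → P (g k) ≡ false →
  filterᵇ P (tabulate g) ≡ filterᵇ P (tabulate (g ∘ punchIn k))
filterᵇ-tabulate-punchIn P zero g e rewrite e = refl
filterᵇ-tabulate-punchIn {q = suc q} P (suc k) g e with P (g zero)
... | true  = cong (g zero ∷_) (filterᵇ-tabulate-punchIn P k (g ∘ suc) e)
... | false = filterᵇ-tabulate-punchIn P k (g ∘ suc) e

filterᵇ-punchIn : ∀ {q} (P : Fin (suc q) → Bool) (k : Fin (suc q)) → P k ≡ false →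
  filterᵇ P (allFin (suc q)) ≡ map (punchIn k) (filterᵇ (P ∘ punchIn k) (allFin q))
filterᵇ-punchIn {q} P k e = trans (filterᵇ-tabulate-punchIn P k (λ i → i) e)
  (trans (cong (filterᵇ P) (sym (List.map-tabulate (λ i → i) (punchIn k)))) (filterᵇ-map P (punchIn k) (allFin q)))

∈-filterᵇ⁻ : ∀ {A : Set} (P : A → Bool) xs {x} → x ∈ filterᵇ P xs → x ∈ xs × P x ≡ true
∈-filterᵇ⁻ P xs i with ∈-filter⁻ (T? ∘ P) {xs = xs} i
... | i' , t = i' , Equivalence.to T-≡ t

∈-filterᵇ⁺ : ∀ {A : Set} (P : A → Bool) {x xs} → x ∈ xs → P x ≡ true → x ∈ filterᵇ P xs
∈-filterᵇ⁺ P i e = ∈-filter⁺ (T? ∘ P) i (Equivalence.from T-≡ e)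

inSet-lookup : ∀ {p} (S : Vec Bool p) i → inSet S (toℕ i) ≡ lookup S i
inSet-lookup (b ∷ S) zero    = refl
inSet-lookup (b ∷ S) (suc i) = inSet-lookup S i

memℕ-elems : ∀ {p} (S : Vec Bool p) k → memℕ k (elems S) ≡ inSet S k
memℕ-elems {p} S k = bool-ext to from
  where
  to : memℕ k (elems S) ≡ true → inSet S k ≡ true
  to e with any-true⁻ _ (elems S) e
  ... | i , i∈ , h with refl ← ≡ᵇ⇒≡ {toℕ i} {k} h = trans (inSet-lookup S i) (proj₂ (∈-filterᵇ⁻ (lookup S) (allFin p) i∈))
  from : inSet S k ≡ true → memℕ k (elems S) ≡ true
  from e = any-true⁺ _ (elems S) (∈-filterᵇ⁺ (lookup S) (∈-allFin (fromℕ< lt)) (trans (sym (inSet-lookup S _)) (trans (cong (inSet S) (FinP.toℕ-fromℕ< lt)) e)))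
    (trans (cong (_≡ᵇ k) (FinP.toℕ-fromℕ< lt)) (≡ᵇ-refl k))
    where lt = inSet-< S e

memᶠ-elems : ∀ {p} (S : Vec Bool p) i → memᶠ i (elems S) ≡ inSet S (toℕ i)
memᶠ-elems {p} S i = bool-ext to from
  where
  to : memᶠ i (elems S) ≡ true → inSet S (toℕ i) ≡ true
  to e with any-true⁻ _ (elems S) e
  ... | j , j∈ , h rewrite ≡ᵇ⇒≡ {toℕ i} {toℕ j} h = trans (inSet-lookup S j) (proj₂ (∈-filterᵇ⁻ (lookup S) (allFin p) j∈))
  from : inSet S (toℕ i) ≡ true → memᶠ i (elems S) ≡ true
  from e = any-true⁺ _ (elems S) (∈-filterᵇ⁺ (lookup S) (∈-allFin i) (trans (sym (inSet-lookup S i)) e)) (≡ᵇ-refl (toℕ i))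

-- The range `q` is free so that one lemma covers the remaining rows, where it is `m`, and the index
-- set of φ̄, where it is `n`.
outside : ∀ {p} → Vec Bool p → ∀ q → List (Fin q)
outside S q = filterᵇ (λ j → not (inSet S (toℕ j))) (allFin q)

compl-elems : ∀ {p} (S : Vec Bool p) → compl (elems S) ≡ outside S p
compl-elems {p} S = filterᵇ-cong (λ i → cong not (memᶠ-elems S i)) (allFin p)

outside-insertAt : ∀ {p q} (S : Vec Bool p) (K : Fin (suc p)) (Kᶜ : Fin (suc q)) → toℕ Kᶜ ≡ toℕ K →
  outside (insertAt S K true) (suc q) ≡ map (punchIn Kᶜ) (outside S q)
outside-insertAt {p} {q} S K Kᶜ eq = trans (filterᵇ-punchIn (λ j → not (inSet (insertAt S K true) (toℕ j))) Kᶜ (cong not (trans (cong (inSet (insertAt S K true)) eq) (inSet-insertAt S K true))))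
  (cong (map (punchIn Kᶜ)) (filterᵇ-cong (λ j → cong not (trans (cong (inSet (insertAt S K true)) (trans (toℕ-punchIn Kᶜ j) (cong (λ k → pin k (toℕ j)) eq))) (inSet-insertAt-pin S K true (toℕ j)))) (allFin q)))

-- The map φ*

-- The specification that replaces the recursion in `star`: tracing predecessors back from `j` ends
-- in `s`. An equality between values of φ* then follows once both sides are sources of one vertex.
record IsSource (f : PF) (j s : ℕ) : Set where
  constructor source
  field
    no-pred : ∀ a → f a ≢ just s
    reaches : Reach f s j
open IsSource

-- By injectivity both paths use the same arcs when read backwards from `j`; if one stopped earlier,
-- its source would have a predecessor.
source-unique : ∀ {f j s t} → Injective f → IsSource f j s → IsSource f j t → s ≡ t
source-unique {f} inj (source ns rs) (source nt rt) = go rs rt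
  where
  go : ∀ {j} → Reach f _ j → Reach f _ j → _
  go stop    stop    = refl
  go stop    (r ▸ e) = ⊥-elim (ns _ e)
  go (r ▸ e) stop    = ⊥-elim (nt _ e)
  go (r ▸ e) (r' ▸ e') with refl ← inj _ _ _ e e' = go r r'

module _ {f f' : PF} {k J} (H : Contraction f f' k J) where
  open Contraction H

  contraction-injective : Injective f' → Injective f
  contraction-injective inj a b c ea eb with pinView k a | pinView k b
  ... | is-k | is-k = refl
  ... | is-k | is-pin b' with map-just⁻ {x = f' b'} (trans (sym (at-pin b')) eb)
  ...   | y , _ , e = ⊥-elim (redirect≢ k J y (trans e (just-injective (trans (sym ea) at-k))))
  contraction-injective inj a b c ea eb | is-pin a' | is-k with map-just⁻ {x = f' a'} (trans (sym (at-pin a')) ea)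
  ...   | y , _ , e = ⊥-elim (redirect≢ k J y (trans e (just-injective (trans (sym eb) at-k))))
  contraction-injective inj a b c ea eb | is-pin a' | is-pin b' with map-just⁻ {x = f' a'} (trans (sym (at-pin a')) ea) | map-just⁻ {x = f' b'} (trans (sym (at-pin b')) eb)
  ...   | x , ex , e | y , ey , e' with refl ← redirect-injective k J {x} {y} (trans e (sym e')) = cong (pin k) (inj _ _ _ ex ey)

  redirect-no-pred : ∀ {s} → (∀ a → f' a ≢ just s) → ∀ a → f a ≢ just (redirect k J s)
  redirect-no-pred {s} h a ea with pinView k a
  ... | is-k = redirect≢ k J s (just-injective (trans (sym ea) at-k))
  ... | is-pin a' with map-just⁻ {x = f' a'} (trans (sym (at-pin a')) ea)
  ...   | x , ex , e with refl ← redirect-injective k J {x} {s} e = h a' ex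

-- If `s` is the head of the contracted arc, then in `f` it has the predecessor `k`, which takes
-- over as source; any other source is merely renamed. These are the two branches of `redirect`.
contraction-source : ∀ {f f' k J j s} → Contraction f f' k J → IsSource f' j s → IsSource f (pin k j) (redirect k J s)
contraction-source {f} {f'} {k} {J} {j} {s} H S = source (redirect-no-pred H (no-pred S)) (path (pinView k J) H)
  where
  path : ∀ {J} → PinView k J → Contraction f f' k J → Reach f (redirect k J s) (pin k j)
  path is-k H' rewrite redirect-≢ k {b = s} (pin≢ k s) = LoopContraction.reach⁺ H' (reaches S)
  path (is-pin J') H' with s ℕ.≟ J'
  ... | yes refl rewrite redirect-≡ k s = Reach-trans (stop ▸ Contraction.at-k H') (ArcContraction.reach⁺ H' (reaches S))
  ... | no ne rewrite redirect-≢ k {pin k J'} {s} (ne ∘ pin-injective k) = ArcContraction.reach⁺ H' (reaches S)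

module _ {m n} (m≤n : m ≤ n) (φ : PMap m n) where
  private
    f = appℕ φ

    hits : Fin n → Fin m → Bool
    hits j i = maybe (_≟ᶠ j) false (lookup φ i)

    hits⁻ : ∀ j i → hits j i ≡ true → f (toℕ i) ≡ just (toℕ j)
    hits⁻ j i e with lookup φ i in l
    ... | just c = trans (appℕ⁺ φ i l) (cong just (≡ᵇ⇒≡ e))

    hits⁺ : ∀ j i → f (toℕ i) ≡ just (toℕ j) → hits j i ≡ true
    hits⁺ j i e with lookup φ i in l
    ... | just c rewrite just-injective (trans (sym (appℕ⁺ φ i l)) e) = ≡ᵇ-refl (toℕ j)
    ... | nothing = contradiction (trans (sym (trans (appℕ-lookup φ i) (cong (Maybe.map toℕ) l))) e) λ ()

    no-hits : ∀ j → (∀ i → hits j i ≡ true → ∀ {A : Set} → A) → ∀ a → f a ≢ just (toℕ j)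
    no-hits j h a e with appℕ⁻ φ e
    ... | i , c , refl , l , ec = h i (hits⁺ j i e)

  inImg-false : ∀ j → inImg φ j ≡ false → ∀ a → f a ≢ just (toℕ j)
  inImg-false j e = no-hits j λ i h → contradiction e (true≢false (any-true⁺ (hits j) (allFin m) (∈-allFin i) h))

  inImg-true : ∀ j → inImg φ j ≡ true → ∃ λ a → f a ≡ just (toℕ j)
  inImg-true j e with any-true⁻ (hits j) (allFin m) e
  ... | i , _ , h = toℕ i , hits⁻ j i h

  preimage-just : ∀ j i → preimage φ j ≡ just i → f (toℕ i) ≡ just (toℕ j)
  preimage-just j i e with filterᵇ (hits j) (allFin m) in eq
  preimage-just j i refl | i ∷ _ = hits⁻ j i (proj₂ (∈-filterᵇ⁻ (hits j) (allFin m) (subst (i ∈_) (sym eq) (here refl))))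

  preimage-nothing : ∀ j → preimage φ j ≡ nothing → ∀ a → f a ≢ just (toℕ j)
  preimage-nothing j e with filterᵇ (hits j) (allFin m) in eq
  ... | [] = no-hits j λ i h → contradiction (subst (i ∈_) eq (∈-filterᵇ⁺ (hits j) (∈-allFin i) h)) λ ()

  -- The hypothesis bounds the length of every chain ending in `j` by the fuel. Each step back
  -- lowers both by one, and fuel 0 contradicts the predecessor that `j` has.
  star-source : ∀ fuel j → inImg φ j ≡ true → (∀ s t → iter φ t s ≡ just (toℕ j) → t ≤ fuel) →
    IsSource f (toℕ j) (toℕ (star m≤n fuel φ j))
  star-source zero j im bound with inImg-true j im
  ... | a , e with () ← bound a 1 e
  star-source (suc fuel) j im bound with preimage φ j in eq
  ... | nothing with a , e ← inImg-true j im = ⊥-elim (preimage-nothing j eq a e)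
  ... | just i with inImg φ (inject≤ i m≤n) in im'
  ...   | false = source (inImg-false _ im') (stop ▸ arc)
    where
    arc : f (toℕ (inject≤ i m≤n)) ≡ just (toℕ j)
    arc = trans (cong f (FinP.toℕ-inject≤ i m≤n)) (preimage-just j i eq)
  ...   | true = source (no-pred S) (reaches S ▸ arc)
    where
    arc : f (toℕ (inject≤ i m≤n)) ≡ just (toℕ j)
    arc = trans (cong f (FinP.toℕ-inject≤ i m≤n)) (preimage-just j i eq)
    S = star-source fuel (inject≤ i m≤n) im' λ s t e → ℕ.≤-pred (bound s (suc t) (iter-step φ t e arc))

  -- A chain into a vertex without image cannot repeat a vertex: skipping the repeated stretch would
  -- reach `J` at an earlier time, at which the chain still continues. All its vertices except the
  -- last are below `m`, so more than `m` arcs would force a repetition.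
  chain-bound : ∀ {J} → f J ≡ nothing → ∀ s t → iter φ t s ≡ just J → t ≤ m
  chain-bound {J} fJ s t e = ℕ.≮⇒≥ λ m<t → absurd m<t (iter-repeats φ s λ {t'} le → point m<t t' le)
    where
    extend : ∀ t' → t' < t → ∃ λ y → iter φ (suc t') s ≡ just y
    extend t' lt = iter-prefix φ (t ∸ suc t') (suc t') (trans (cong (λ t → iter φ t s) (ℕ.m∸n+n≡m lt)) e)
    point : m < t → ∀ t' → t' ≤ m → ∃ λ x → iter φ t' s ≡ just x × x < m
    point m<t t' le with extend t' (ℕ.≤-<-trans le m<t)
    ... | y , e' with >>=-just⁻ (iter φ t' s) e'
    ...   | x , e₁ , e₂ = x , e₁ , appℕ-< φ e₂
    absurd : m < t → ¬ _
    absurd m<t (a , b , a<b , b≤m , x , ea , eb) with extend (t ∸ b N.+ a) (subst (t ∸ b N.+ a <_) (ℕ.m∸n+n≡m b≤t) (ℕ.+-monoʳ-< (t ∸ b) a<b))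
      where b≤t = ℕ.≤-trans b≤m (ℕ.<⇒≤ m<t)
    ... | y , e' = nothing≢just fJ (trans (sym (cong (_>>= f) (trans (iter-+ φ (t ∸ b) a ea)
      (trans (sym (iter-+ φ (t ∸ b) b eb)) (trans (cong (λ t → iter φ t s) (ℕ.m∸n+n≡m (ℕ.≤-trans b≤m (ℕ.<⇒≤ m<t)))) e))))) e')

  phi* : Fin n → Fin n
  phi* j = if inImg φ j then star m≤n (suc m) φ j else j

  phi*-source : ∀ j → f (toℕ j) ≡ nothing → IsSource f (toℕ j) (toℕ (phi* j))
  phi*-source j e with inImg φ j in im
  ... | false = source (inImg-false j im) stop
  ... | true  = star-source (suc m) j im λ s t h → ℕ.m≤n⇒m≤1+n (chain-bound e s t h)

  phiBar-dom : phiBar m≤n (elems (dom φ)) φ ≡ map phi* (outside (dom φ) n)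
  phiBar-dom = cong (map phi*) (filterᵇ-cong (λ j → cong not (memℕ-elems (dom φ) (toℕ j))) (allFin n))

map-cong-∈ : ∀ {A B : Set} {f g : A → B} xs → (∀ {x} → x ∈ xs → f x ≡ g x) → map f xs ≡ map g xs
map-cong-∈ []       h = refl
map-cong-∈ (x ∷ xs) h = cong₂ _∷_ (h (here refl)) (map-cong-∈ xs (h ∘ there))

not-true : ∀ {b} → not b ≡ true → b ≡ false
not-true {false} _ = refl

module _ {m n} (m≤n : m ≤ n) (sm≤sn : suc m ≤ suc n) (K : Fin (suc m)) (Kᶜ J : Fin (suc n)) (eq : toℕ Kᶜ ≡ toℕ K) (φ : PMap m n) where
  private Φ = expand K Kᶜ J φ

  compl-expand : compl (elems (dom Φ)) ≡ map (punchIn K) (compl (elems (dom φ)))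
  compl-expand = begin
    compl (elems (dom Φ))                       ≡⟨ compl-elems (dom Φ) ⟩
    outside (dom Φ) (suc m)                     ≡⟨ cong (λ d → outside d (suc m)) (dom-expand K Kᶜ J φ) ⟩
    outside (insertAt (dom φ) K true) (suc m)   ≡⟨ outside-insertAt (dom φ) K K refl ⟩
    map (punchIn K) (outside (dom φ) m)         ≡⟨ cong (map (punchIn K)) (sym (compl-elems (dom φ))) ⟩
    map (punchIn K) (compl (elems (dom φ)))     ∎
    where open ≡-Reasoning

  -- Both sides are sources of the same vertex of the expanded map, and that map is injective.
  phi*-expand : isInj φ ≡ true → ∀ j → inSet (dom φ) (toℕ j) ≡ false →
    phi* sm≤sn Φ (punchIn Kᶜ j) ≡ redirectᶠ Kᶜ J (phi* m≤n φ j)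
  phi*-expand inj j out = FinP.toℕ-injective (trans
    (source-unique (contraction-injective H (appℕ-injective φ inj))
      (subst (λ x → IsSource (appℕ Φ) x (toℕ (phi* sm≤sn Φ (punchIn Kᶜ j)))) pun (phi*-source sm≤sn Φ (punchIn Kᶜ j) off))
      (contraction-source H (phi*-source m≤n φ j off')))
    (sym (trans (toℕ-redirectᶠ Kᶜ J _) (cong (λ k → redirect k (toℕ J) (toℕ (phi* m≤n φ j))) eq))))
    where
    H = expand-contraction K Kᶜ J eq φ
    off' : appℕ φ (toℕ j) ≡ nothing
    off' = inSet-dom φ (toℕ j) out
    pun : toℕ (punchIn Kᶜ j) ≡ pin (toℕ K) (toℕ j)
    pun = trans (toℕ-punchIn Kᶜ j) (cong (λ k → pin k (toℕ j)) eq)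
    off : appℕ Φ (toℕ (punchIn Kᶜ j)) ≡ nothing
    off = trans (cong (appℕ Φ) pun) (trans (Contraction.at-pin H (toℕ j)) (cong (Maybe.map _) off'))

  phiBar-expand : isInj φ ≡ true →
    phiBar sm≤sn (elems (dom Φ)) Φ ≡ map (redirectᶠ Kᶜ J) (phiBar m≤n (elems (dom φ)) φ)
  phiBar-expand inj = begin
    phiBar sm≤sn (elems (dom Φ)) Φ
      ≡⟨ phiBar-dom sm≤sn Φ ⟩
    map (phi* sm≤sn Φ) (outside (dom Φ) (suc n))
      ≡⟨ cong (λ d → map (phi* sm≤sn Φ) (outside d (suc n))) (dom-expand K Kᶜ J φ) ⟩
    map (phi* sm≤sn Φ) (outside (insertAt (dom φ) K true) (suc n))
      ≡⟨ cong (map (phi* sm≤sn Φ)) (outside-insertAt (dom φ) K Kᶜ eq) ⟩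
    map (phi* sm≤sn Φ) (map (punchIn Kᶜ) (outside (dom φ) n))
      ≡⟨ sym (List.map-∘ (outside (dom φ) n)) ⟩
    map (phi* sm≤sn Φ ∘ punchIn Kᶜ) (outside (dom φ) n)
      ≡⟨ map-cong-∈ (outside (dom φ) n) (λ {j} i → phi*-expand inj j (not-true (proj₂ (∈-filterᵇ⁻ _ (allFin n) i)))) ⟩
    map (redirectᶠ Kᶜ J ∘ phi* m≤n φ) (outside (dom φ) n)
      ≡⟨ List.map-∘ (outside (dom φ) n) ⟩
    map (redirectᶠ Kᶜ J) (map (phi* m≤n φ) (outside (dom φ) n))
      ≡⟨ cong (map (redirectᶠ Kᶜ J)) (sym (phiBar-dom m≤n φ)) ⟩
    map (redirectᶠ Kᶜ J) (phiBar m≤n (elems (dom φ)) φ) ∎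
    where open ≡-Reasoning

-- Sums over lists and over partial maps

module Sums {c ℓ : Level} (CR : CommutativeRing c ℓ) where
  open CommutativeRing CR hiding (refl; sym; trans; zero)
  module R = CommutativeRing CR
  open CommSemigroup +-commutativeSemigroup using () renaming (interchange to +-interchange)
  open CommSemigroup *-commutativeSemigroup using () renaming (x∙yz≈y∙xz to *-exchange) public
  open Rook CR
  open import Relation.Binary.Reasoning.Setoid setoid

  -- Opaque, so that summands can be inferred by unification.
  opaque
    ∑ : ∀ {a} {A : Set a} → List A → (A → Carrier) → Carrier
    ∑ xs f = Σ (map f xs)

  syntax ∑ xs (λ x → e) = ∑[ x ∈ xs ] e

  infix 9 ∑

  infixr 8 _⊙_
  -- Conditions are moved from the index list into the summand, so that every sum runs over a fixed
  -- list and sums can be exchanged freely.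
  _⊙_ : Bool → Carrier → Carrier
  true  ⊙ a = a
  false ⊙ a = 0#

  ⊙-cong : ∀ b {a a'} → (b ≡ true → a ≈ a') → b ⊙ a ≈ b ⊙ a'
  ⊙-cong true  h = h refl
  ⊙-cong false h = R.refl

  ⊙-≡ : ∀ {b b' a} → b ≡ b' → b ⊙ a ≈ b' ⊙ a
  ⊙-≡ refl = R.refl

  ⊙-∧ : ∀ a b {x} → a ⊙ b ⊙ x ≈ (a ∧ b) ⊙ x
  ⊙-∧ true  b = R.refl
  ⊙-∧ false b = R.refl

  ⊙-*ˡ : ∀ b x y → b ⊙ (x * y) ≈ x * b ⊙ y
  ⊙-*ˡ true  x y = R.refl
  ⊙-*ˡ false x y = R.sym (zeroʳ x)

  ⊙-*ʳ : ∀ b x y → b ⊙ (x * y) ≈ b ⊙ x * y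
  ⊙-*ʳ true  x y = R.refl
  ⊙-*ʳ false x y = R.sym (zeroˡ y)

  ⊙-0 : ∀ b → b ⊙ 0# ≈ 0#
  ⊙-0 true  = R.refl
  ⊙-0 false = R.refl

  module _ {a} {A : Set a} where
    opaque
      unfolding ∑

      ∑-cong : ∀ (xs : List A) {f g : A → Carrier} → (∀ x → f x ≈ g x) → ∑ xs f ≈ ∑ xs g
      ∑-cong []       h = R.refl
      ∑-cong (x ∷ xs) h = +-cong (h x) (∑-cong xs h)

      ∑-zero : ∀ (xs : List A) → ∑ xs (λ _ → 0#) ≈ 0#
      ∑-zero []       = R.refl
      ∑-zero (x ∷ xs) = R.trans (+-identityˡ _) (∑-zero xs)

      ∑-+ : ∀ (xs : List A) (f g : A → Carrier) → ∑[ x ∈ xs ] (f x + g x) ≈ ∑ xs f + ∑ xs g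
      ∑-+ []       f g = R.sym (+-identityˡ 0#)
      ∑-+ (x ∷ xs) f g = R.trans (+-congˡ (∑-+ xs f g)) (+-interchange _ _ _ _)

      ∑-*ˡ : ∀ (xs : List A) c (f : A → Carrier) → c * ∑ xs f ≈ ∑[ x ∈ xs ] (c * f x)
      ∑-*ˡ []       c f = zeroʳ c
      ∑-*ˡ (x ∷ xs) c f = R.trans (distribˡ c _ _) (+-congˡ (∑-*ˡ xs c f))

      ∑-*ʳ : ∀ (xs : List A) c (f : A → Carrier) → ∑ xs f * c ≈ ∑[ x ∈ xs ] (f x * c)
      ∑-*ʳ []       c f = zeroˡ c
      ∑-*ʳ (x ∷ xs) c f = R.trans (distribʳ c _ _) (+-congˡ (∑-*ʳ xs c f))

      ∑-⊙ : ∀ (xs : List A) b (f : A → Carrier) → b ⊙ ∑ xs f ≈ ∑[ x ∈ xs ] (b ⊙ f x)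
      ∑-⊙ xs true  f = R.refl
      ∑-⊙ xs false f = R.sym (∑-zero xs)

      Σ-++ : ∀ (xs ys : List Carrier) → Σ (xs ++ ys) ≈ Σ xs + Σ ys
      Σ-++ []       ys = R.sym (+-identityˡ _)
      Σ-++ (x ∷ xs) ys = R.trans (+-congˡ (Σ-++ xs ys)) (R.sym (+-assoc _ _ _))

      ∑-filter : ∀ P (xs : List A) (f : A → Carrier) → ∑ (filterᵇ P xs) f ≈ ∑[ x ∈ xs ] (P x ⊙ f x)
      ∑-filter P []       f = R.refl
      ∑-filter P (x ∷ xs) f with P x
      ... | true  = +-congˡ (∑-filter P xs f)
      ... | false = R.trans (∑-filter P xs f) (R.sym (+-identityˡ _))

      Σ-concatMap : ∀ (g : A → List Carrier) xs → Σ (concatMap g xs) ≈ ∑[ x ∈ xs ] Σ (g x)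
      Σ-concatMap g []       = R.refl
      Σ-concatMap g (x ∷ xs) = R.trans (Σ-++ (g x) (concatMap g xs)) (+-congˡ (Σ-concatMap g xs))

  module _ {a b} {A : Set a} {B : Set b} where
    opaque
      unfolding ∑

      ∑-map : ∀ (g : A → B) xs (f : B → Carrier) → ∑ (map g xs) f ≈ ∑[ x ∈ xs ] f (g x)
      ∑-map g xs f = R.reflexive (cong Σ (sym (List.map-∘ xs)))

      ∑-swap : ∀ (xs : List A) (ys : List B) (f : A → B → Carrier) →
        ∑[ x ∈ xs ] (∑[ y ∈ ys ] f x y) ≈ ∑[ y ∈ ys ] (∑[ x ∈ xs ] f x y)
      ∑-swap []       ys f = R.sym (∑-zero ys)
      ∑-swap (x ∷ xs) ys f = R.trans (+-congˡ (∑-swap xs ys f)) (R.sym (∑-+ ys (f x) (λ y → ∑ xs (λ x → f x y))))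

      ∑-concatMap : ∀ (g : A → List B) xs (f : B → Carrier) → ∑ (concatMap g xs) f ≈ ∑[ x ∈ xs ] (∑[ y ∈ g x ] f y)
      ∑-concatMap g []       f = R.refl
      ∑-concatMap g (x ∷ xs) f = begin
        Σ (map f (g x ++ concatMap g xs))            ≈⟨ R.reflexive (cong Σ (List.map-++ f (g x) (concatMap g xs))) ⟩
        Σ (map f (g x) ++ map f (concatMap g xs))    ≈⟨ Σ-++ {A = A} (map f (g x)) _ ⟩
        ∑ (g x) f + ∑ (concatMap g xs) f             ≈⟨ +-congˡ (∑-concatMap g xs f) ⟩
        ∑ (g x) f + ∑ xs (λ x → ∑ (g x) f)           ∎

  opaque
    unfolding ∑

    ∑-allFin-suc : ∀ n (f : Fin (suc n) → Carrier) → ∑ (allFin (suc n)) f ≈ f zero + ∑[ i ∈ allFin n ] f (suc i)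
    ∑-allFin-suc n f = +-congˡ (R.trans (R.reflexive (cong (λ xs → ∑ xs f) (sym (List.map-tabulate (λ i → i) suc)))) (∑-map suc (allFin n) f))

    ∑-upTo-suc : ∀ n (f : ℕ → Carrier) → ∑ (upTo (suc n)) f ≈ f zero + ∑[ i ∈ upTo n ] f (suc i)
    ∑-upTo-suc n f = +-congˡ (R.trans (R.reflexive (cong (λ xs → ∑ xs f) (sym (List.map-upTo suc n)))) (∑-map suc (upTo n) f))

    ∑-upTo-δ : ∀ n d (g : ℕ → Carrier) → ∑[ s ∈ upTo n ] ((d ≡ᵇ s) ⊙ g s) ≈ (d <ᵇ n) ⊙ g d
    ∑-upTo-δ zero    d g = R.refl
    ∑-upTo-δ (suc n) zero    g = R.trans (∑-upTo-suc n (λ s → (0 ≡ᵇ s) ⊙ g s)) (R.trans (+-congˡ (∑-zero (upTo n))) (+-identityʳ _))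
    ∑-upTo-δ (suc n) (suc d) g = R.trans (∑-upTo-suc n (λ s → (suc d ≡ᵇ s) ⊙ g s)) (R.trans (+-identityˡ _) (∑-upTo-δ n d (λ s → g (suc s))))

    ∑-entries : ∀ q (f : Maybe (Fin q) → Carrier) →
      ∑ (nothing ∷ map just (allFin q)) f ≈ f nothing + ∑[ j ∈ allFin q ] f (just j)
    ∑-entries q f = +-congˡ (∑-map just (allFin q) f)

    ∑-[] : ∀ {a} {A : Set a} (f : A → Carrier) → ∑ [] f ≈ 0#
    ∑-[] f = R.refl

    ∑-∷ : ∀ {a} {A : Set a} x (xs : List A) (f : A → Carrier) → ∑ (x ∷ xs) f ≈ f x + ∑ xs f
    ∑-∷ x xs f = R.refl

    ∑-singleton : ∀ {a} {A : Set a} (x : A) (f : A → Carrier) → ∑ (x ∷ []) f ≈ f x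
    ∑-singleton x f = +-identityʳ (f x)

    Σ-map : ∀ {a} {A : Set a} (xs : List A) (f : A → Carrier) → Σ (map f xs) ≈ ∑ xs f
    Σ-map xs f = R.refl

  ∑-punchIn : ∀ {n} (k : Fin (suc n)) (f : Fin (suc n) → Carrier) →
    ∑ (allFin (suc n)) f ≈ f k + ∑[ i ∈ allFin n ] f (punchIn k i)
  ∑-punchIn {n} zero f = ∑-allFin-suc n f
  ∑-punchIn {suc n} (suc k) f = begin
    ∑ (allFin (suc (suc n))) f
      ≈⟨ ∑-allFin-suc (suc n) f ⟩
    f zero + ∑ (allFin (suc n)) (λ i → f (suc i))
      ≈⟨ +-congˡ (∑-punchIn k (λ i → f (suc i))) ⟩
    f zero + (f (suc k) + ∑ (allFin n) (λ i → f (suc (punchIn k i))))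
      ≈⟨ R.trans (R.sym (+-assoc _ _ _)) (R.trans (+-congʳ (+-comm _ _)) (+-assoc _ _ _)) ⟩
    f (suc k) + (f zero + ∑ (allFin n) (λ i → f (suc (punchIn k i))))
      ≈⟨ +-congˡ (∑-allFin-suc n (λ i → f (punchIn (suc k) i))) ⟨
    f (suc k) + ∑ (allFin (suc n)) (λ i → f (punchIn (suc k) i)) ∎

  Π-cong : ∀ {A : Set} (xs : List A) {f g : A → Carrier} → (∀ x → f x ≈ g x) → Π (map f xs) ≈ Π (map g xs)
  Π-cong []       h = R.refl
  Π-cong (x ∷ xs) h = *-cong (h x) (Π-cong xs h)

  Π-allFin-suc : ∀ n (f : Fin (suc n) → Carrier) →
    Π (map f (allFin (suc n))) ≈ f zero * Π (map (λ i → f (suc i)) (allFin n))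
  Π-allFin-suc n f = *-congˡ (R.reflexive (cong Π (trans (cong (map f) (sym (List.map-tabulate (λ i → i) suc))) (sym (List.map-∘ (allFin n))))))

  Π-punchIn : ∀ {n} (k : Fin (suc n)) (f : Fin (suc n) → Carrier) →
    Π (map f (allFin (suc n))) ≈ f k * Π (map (λ i → f (punchIn k i)) (allFin n))
  Π-punchIn {n} zero f = Π-allFin-suc n f
  Π-punchIn {suc n} (suc k) f = begin
    Π (map f (allFin (suc (suc n))))
      ≈⟨ Π-allFin-suc (suc n) f ⟩
    f zero * Π (map (λ i → f (suc i)) (allFin (suc n)))
      ≈⟨ *-congˡ (Π-punchIn k (λ i → f (suc i))) ⟩
    f zero * (f (suc k) * Π (map (λ i → f (suc (punchIn k i))) (allFin n)))
      ≈⟨ *-exchange _ _ _ ⟩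
    f (suc k) * (f zero * Π (map (λ i → f (suc (punchIn k i))) (allFin n)))
      ≈⟨ *-congˡ (Π-allFin-suc n (λ i → f (punchIn (suc k) i))) ⟨
    f (suc k) * Π (map (λ i → f (punchIn (suc k) i)) (allFin (suc n))) ∎

  punchIn≟ : ∀ {n} (k : Fin (suc n)) i → (punchIn k i ≟ᶠ k) ≡ false
  punchIn≟ k i = ≢⇒≡ᵇ (FinP.punchInᵢ≢i k i ∘ FinP.toℕ-injective)

  ∑-δ : ∀ {n} (J : Fin n) a → ∑[ i ∈ allFin n ] ((i ≟ᶠ J) ⊙ a) ≈ a
  ∑-δ {suc n} J a = begin
    ∑ (allFin (suc n)) (λ i → (i ≟ᶠ J) ⊙ a)
      ≈⟨ ∑-punchIn J (λ i → (i ≟ᶠ J) ⊙ a) ⟩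
    (J ≟ᶠ J) ⊙ a + ∑ (allFin n) (λ i → (punchIn J i ≟ᶠ J) ⊙ a)
      ≈⟨ +-cong (R.reflexive (cong (_⊙ a) (≡ᵇ-refl (toℕ J)))) (∑-cong (allFin n) λ i → R.reflexive (cong (_⊙ a) (punchIn≟ J i))) ⟩
    a + ∑ (allFin n) (λ _ → 0#)
      ≈⟨ R.trans (+-congˡ (∑-zero (allFin n))) (+-identityʳ a) ⟩
    a ∎

  -- `punchIn K` runs over the columns other than `K`; trading its value `J` for `K` yields the
  -- columns other than `J`. For `K = J` nothing is traded.
  ∑-redirect : ∀ {q} (K J : Fin (suc q)) (f : Fin (suc q) → Carrier) →
    ∑[ i ∈ allFin (suc q) ] (not (i ≟ᶠ J) ⊙ f i) ≈ ∑[ b ∈ allFin q ] f (redirectᶠ K J b)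
  ∑-redirect {q} K J f = begin
    ∑ (allFin (suc q)) (λ i → not (i ≟ᶠ J) ⊙ f i)
      ≈⟨ ∑-punchIn K _ ⟩
    not (K ≟ᶠ J) ⊙ f K + ∑ (allFin q) (λ b → not (punchIn K b ≟ᶠ J) ⊙ f (punchIn K b))
      ≈⟨ +-congʳ rest ⟩
    ∑ (allFin q) (λ b → (punchIn K b ≟ᶠ J) ⊙ f K) + ∑ (allFin q) (λ b → not (punchIn K b ≟ᶠ J) ⊙ f (punchIn K b))
      ≈⟨ ∑-+ (allFin q) _ _ ⟨
    ∑ (allFin q) (λ b → (punchIn K b ≟ᶠ J) ⊙ f K + not (punchIn K b ≟ᶠ J) ⊙ f (punchIn K b))
      ≈⟨ ∑-cong (allFin q) choose ⟩
    ∑ (allFin q) (λ b → f (redirectᶠ K J b)) ∎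
    where
    choose : ∀ b → (punchIn K b ≟ᶠ J) ⊙ f K + not (punchIn K b ≟ᶠ J) ⊙ f (punchIn K b) ≈ f (redirectᶠ K J b)
    choose b with punchIn K b ≟ᶠ J
    ... | true  = +-identityʳ _
    ... | false = +-identityˡ _
    -- For `K ≠ J` exactly one `b` satisfies `punchIn K b = J`, and this `b` carries the term of
    -- column `K`. For `K = J` there is no such `b`, and the term of column `K` is excluded as well.
    rest : not (K ≟ᶠ J) ⊙ f K ≈ ∑ (allFin q) (λ b → (punchIn K b ≟ᶠ J) ⊙ f K)
    rest with K ≟ᶠ J in e
    ... | true with refl ← FinP.toℕ-injective {i = K} {J} (≡ᵇ⇒≡ e) =
      R.sym (R.trans (∑-cong (allFin q) λ b → R.reflexive (cong (_⊙ f K) (punchIn≟ K b))) (∑-zero (allFin q)))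
    ... | false = begin
      f K ≈⟨ ∑-δ J (f K) ⟨
      ∑ (allFin (suc q)) (λ i → (i ≟ᶠ J) ⊙ f K) ≈⟨ ∑-punchIn K _ ⟩
      (K ≟ᶠ J) ⊙ f K + ∑ (allFin q) (λ b → (punchIn K b ≟ᶠ J) ⊙ f K) ≈⟨ +-congʳ (R.reflexive (cong (_⊙ f K) e)) ⟩
      0# + ∑ (allFin q) (λ b → (punchIn K b ≟ᶠ J) ⊙ f K) ≈⟨ +-identityˡ _ ⟩
      ∑ (allFin q) (λ b → (punchIn K b ≟ᶠ J) ⊙ f K) ∎

  ∑-PMaps-∷ : ∀ p q (f : PMap (suc p) q → Carrier) →
    ∑ (allPMaps (suc p) q) f ≈ ∑[ v ∈ allPMaps p q ] (∑[ x ∈ (nothing ∷ map just (allFin q)) ] f (x ∷ v))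
  ∑-PMaps-∷ p q f = R.trans (∑-concatMap (λ v → map (_∷ v) (nothing ∷ map just (allFin q))) (allPMaps p q) f)
    (∑-cong (allPMaps p q) λ v → ∑-map (_∷ v) (nothing ∷ map just (allFin q)) f)

  ∑-PMaps-insertAt : ∀ {p} q (K : Fin (suc p)) (f : PMap (suc p) q → Carrier) →
    ∑ (allPMaps (suc p) q) f ≈ ∑[ v ∈ allPMaps p q ] (∑[ x ∈ (nothing ∷ map just (allFin q)) ] f (insertAt v K x))
  ∑-PMaps-insertAt {p} q zero f = ∑-PMaps-∷ p q f
  ∑-PMaps-insertAt {suc p} q (suc K) f = begin
    ∑ (allPMaps (suc (suc p)) q) f
      ≈⟨ ∑-PMaps-∷ (suc p) q f ⟩
    ∑ (allPMaps (suc p) q) (λ v → ∑ X (λ y → f (y ∷ v)))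
      ≈⟨ ∑-PMaps-insertAt q K _ ⟩
    ∑ (allPMaps p q) (λ w → ∑ X (λ x → ∑ X (λ y → f (y ∷ insertAt w K x))))
      ≈⟨ ∑-cong (allPMaps p q) (λ w → ∑-swap X X _) ⟩
    ∑ (allPMaps p q) (λ w → ∑ X (λ y → ∑ X (λ x → f (y ∷ insertAt w K x))))
      ≈⟨ ∑-PMaps-∷ p q _ ⟨
    ∑ (allPMaps (suc p) q) (λ v → ∑ X (λ x → f (insertAt v (suc K) x))) ∎
    where X = nothing ∷ map just (allFin q)

  -- Maps that avoid column `J` are maps into the other `q` columns; `redirectᶠ K J` enumerates
  -- these, and `∑-redirect` is applied entry by entry.
  ∑-fresh : ∀ p {q} (K J : Fin (suc q)) (f : PMap p (suc q) → Carrier) →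
    ∑[ v ∈ allPMaps p (suc q) ] (fresh J v ⊙ f v) ≈ ∑[ v ∈ allPMaps p q ] f (Vec.map (Maybe.map (redirectᶠ K J)) v)
  ∑-fresh zero    K J f = R.trans (∑-singleton [] _) (R.sym (∑-singleton [] _))
  ∑-fresh (suc p) {q} K J f = begin
    ∑ (allPMaps (suc p) (suc q)) (λ v → fresh J v ⊙ f v)
      ≈⟨ ∑-PMaps-∷ p (suc q) _ ⟩
    ∑ (allPMaps p (suc q)) (λ v → ∑ X' (λ x → fresh J (x ∷ v) ⊙ f (x ∷ v)))
      ≈⟨ ∑-cong (allPMaps p (suc q)) entry ⟩
    ∑ (allPMaps p (suc q)) (λ v → fresh J v ⊙ (∑ X (λ x → f (Maybe.map (redirectᶠ K J) x ∷ v))))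
      ≈⟨ ∑-fresh p K J _ ⟩
    ∑ (allPMaps p q) (λ v → ∑ X (λ x → f (Maybe.map (redirectᶠ K J) x ∷ Vec.map (Maybe.map (redirectᶠ K J)) v)))
      ≈⟨ ∑-PMaps-∷ p q _ ⟨
    ∑ (allPMaps (suc p) q) (λ v → f (Vec.map (Maybe.map (redirectᶠ K J)) v)) ∎
    where
    X = nothing ∷ map just (allFin q)
    X' = nothing ∷ map just (allFin (suc q))
    entry : ∀ v → ∑ X' (λ x → fresh J (x ∷ v) ⊙ f (x ∷ v)) ≈ fresh J v ⊙ (∑ X (λ x → f (Maybe.map (redirectᶠ K J) x ∷ v)))
    entry v = begin
      ∑ X' (λ x → fresh J (x ∷ v) ⊙ f (x ∷ v))
        ≈⟨ ∑-entries (suc q) _ ⟩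
      fresh J v ⊙ f (nothing ∷ v) + ∑ (allFin (suc q)) (λ j → (not (j ≟ᶠ J) ∧ fresh J v) ⊙ f (just j ∷ v))
        ≈⟨ +-congˡ (∑-cong (allFin (suc q)) λ j → R.sym (⊙-∧ (not (j ≟ᶠ J)) (fresh J v))) ⟩
      fresh J v ⊙ f (nothing ∷ v) + ∑ (allFin (suc q)) (λ j → not (j ≟ᶠ J) ⊙ fresh J v ⊙ f (just j ∷ v))
        ≈⟨ +-congˡ (∑-redirect K J _) ⟩
      fresh J v ⊙ f (nothing ∷ v) + ∑ (allFin q) (λ b → fresh J v ⊙ f (just (redirectᶠ K J b) ∷ v))
        ≈⟨ ∑-entries q (λ x → fresh J v ⊙ f (Maybe.map (redirectᶠ K J) x ∷ v)) ⟨
      ∑ X (λ x → fresh J v ⊙ f (Maybe.map (redirectᶠ K J) x ∷ v))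
        ≈⟨ ∑-⊙ X (fresh J v) _ ⟨
      fresh J v ⊙ (∑ X (λ x → f (Maybe.map (redirectᶠ K J) x ∷ v))) ∎

-- Subsets as element lists, and the empty map

size≤ : ∀ {p} (S : Vec Bool p) → size S ≤ p
size≤ []          = z≤n
size≤ (true ∷ S)  = s≤s (size≤ S)
size≤ (false ∷ S) = ℕ.m≤n⇒m≤1+n (size≤ S)

size-insertAt-true : ∀ {p} (S : Vec Bool p) k → size (insertAt S k true) ≡ suc (size S)
size-insertAt-true S           zero    = refl
size-insertAt-true (true ∷ S)  (suc k) = cong suc (size-insertAt-true S k)
size-insertAt-true (false ∷ S) (suc k) = size-insertAt-true S k

size-not : ∀ {p} (S : Vec Bool p) → size (Vec.map not S) ≡ p ∸ size S
size-not []          = refl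
size-not (true ∷ S)  = size-not S
size-not (false ∷ S) = trans (cong suc (size-not S)) (sym (ℕ.+-∸-assoc 1 (size≤ S)))

allFin-suc : ∀ n → allFin (suc n) ≡ zero ∷ map suc (allFin n)
allFin-suc n = cong (zero ∷_) (sym (List.map-tabulate (λ i → i) suc))

elems-true : ∀ {p} (S : Vec Bool p) → elems (true ∷ S) ≡ zero ∷ map suc (elems S)
elems-true {p} S = trans (cong (filterᵇ (lookup (true ∷ S))) (allFin-suc p)) (cong (zero ∷_) (filterᵇ-map _ suc (allFin p)))

elems-false : ∀ {p} (S : Vec Bool p) → elems (false ∷ S) ≡ map suc (elems S)
elems-false {p} S = trans (cong (filterᵇ (lookup (false ∷ S))) (allFin-suc p)) (filterᵇ-map _ suc (allFin p))

length-elems : ∀ {p} (S : Vec Bool p) → length (elems S) ≡ size S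
length-elems []          = refl
length-elems (true ∷ S)  = trans (cong length (elems-true S)) (cong suc (trans (List.length-map suc (elems S)) (length-elems S)))
length-elems (false ∷ S) = trans (cong length (elems-false S)) (trans (List.length-map suc (elems S)) (length-elems S))

compl-elems-not : ∀ {p} (S : Vec Bool p) → compl (elems S) ≡ elems (Vec.map not S)
compl-elems-not {p} S = trans (compl-elems S)
  (filterᵇ-cong (λ i → trans (cong not (inSet-lookup S i)) (sym (VecP.lookup-map i not S))) (allFin p))

length-compl-elems : ∀ {p} (S : Vec Bool p) → length (compl (elems S)) ≡ p ∸ size S
length-compl-elems S = trans (cong length (compl-elems-not S)) (trans (length-elems (Vec.map not S)) (size-not S))

sameSet : ∀ {p} → Vec Bool p → Vec Bool p → Bool
sameSet []      []      = true
sameSet (a ∷ S) (b ∷ T) = (a ⇔ᵇ b) ∧ sameSet S T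

all-allFin-suc : ∀ {n} (P : Fin (suc n) → Bool) → all P (allFin (suc n)) ≡ P zero ∧ all (P ∘ suc) (allFin n)
all-allFin-suc {n} P = trans (cong (all P) (allFin-suc n)) (cong (λ bs → P zero ∧ Data.Bool.ListAction.and bs) (sym (List.map-∘ (allFin n))))

domIs-sameSet : ∀ {p q} (P : Fin p → Bool) (S : Vec Bool p) (φ : PMap p q) → (∀ i → P i ≡ lookup S i) →
  domIs P φ ≡ sameSet (dom φ) S
domIs-sameSet P []      []      h = refl
domIs-sameSet P (b ∷ S) (x ∷ φ) h = trans (all-allFin-suc (λ i → is-just (lookup (x ∷ φ) i) ⇔ᵇ P i))
  (cong₂ _∧_ (cong (is-just x ⇔ᵇ_) (h zero)) (domIs-sameSet (P ∘ suc) S φ (h ∘ suc)))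

numCycles-empty : ∀ {p q} (φ : PMap p q) → (∀ a → appℕ φ a ≡ nothing) → numCycles φ ≡ 0
numCycles-empty {p} φ h = trans (count-cong {R = λ _ → false} none (allSubsets p)) (count-none (allSubsets p))
  where
  none : ∀ C → isCycleSet φ C ≡ false
  none C with isCycleSet φ C in e
  ... | false = refl
  ... | true with record { base = a , ca ; closed = cl } ← isCycleSet⁻ φ C e with cl a ca
  ...   | b , eq , _ = contradiction eq (nothing≢just (h a))

emptyMap : ∀ p q → PMap p q
emptyMap p q = Vec.replicate p nothing

appℕ-emptyMap : ∀ p q a → appℕ (emptyMap p q) a ≡ nothing
appℕ-emptyMap zero    q a       = refl
appℕ-emptyMap (suc p) q zero    = refl
appℕ-emptyMap (suc p) q (suc a) = appℕ-emptyMap p q a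

isInj-emptyMap : ∀ p q → isInj (emptyMap p q) ≡ true
isInj-emptyMap p q = isInj⁺ (emptyMap p q) λ i i' a l l' → contradiction (appℕ⁺ (emptyMap p q) i l) (nothing≢just (appℕ-emptyMap p q (toℕ i)))

size-dom-emptyMap : ∀ p q → size (dom (emptyMap p q)) ≡ 0
size-dom-emptyMap zero    q = refl
size-dom-emptyMap (suc p) q = size-dom-emptyMap p q

inSet-dom-emptyMap : ∀ p q a → inSet (dom (emptyMap p q)) a ≡ false
inSet-dom-emptyMap zero    q a       = refl
inSet-dom-emptyMap (suc p) q zero    = refl
inSet-dom-emptyMap (suc p) q (suc a) = inSet-dom-emptyMap p q a

filterᵇ-all : ∀ {A : Set} {P : A → Bool} → (∀ x → P x ≡ true) → ∀ xs → filterᵇ P xs ≡ xs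
filterᵇ-all h [] = refl
filterᵇ-all {P = P} h (x ∷ xs) with P x | h x
... | true | _ = cong (x ∷_) (filterᵇ-all h xs)

outside-emptyMap : ∀ p q n → outside (dom (emptyMap p q)) n ≡ allFin n
outside-emptyMap p q n = filterᵇ-all (λ j → cong not (inSet-dom-emptyMap p q (toℕ j))) (allFin n)

-- Without arcs every index is its own source.
phiBar-emptyMap : ∀ {m n} (m≤n : m ≤ n) → phiBar m≤n (elems (dom (emptyMap m n))) (emptyMap m n) ≡ allFin n
phiBar-emptyMap {m} {n} m≤n = begin
  phiBar m≤n (elems (dom φ)) φ            ≡⟨ phiBar-dom m≤n φ ⟩
  map (phi* m≤n φ) (outside (dom φ) n)    ≡⟨ cong (map (phi* m≤n φ)) (outside-emptyMap m n n) ⟩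
  map (phi* m≤n φ) (allFin n)             ≡⟨ List.map-cong fix (allFin n) ⟩
  map (λ j → j) (allFin n)                ≡⟨ List.map-id (allFin n) ⟩
  allFin n                                ∎
  where
  open ≡-Reasoning
  φ = emptyMap m n
  fix : ∀ j → phi* m≤n φ j ≡ j
  fix j = FinP.toℕ-injective (source-unique (appℕ-injective φ (isInj-emptyMap m n)) (phi*-source m≤n φ j (appℕ-emptyMap m n (toℕ j)))
    (source (λ a → nothing≢just (appℕ-emptyMap m n a)) stop))

compl-emptyMap : ∀ m q → compl (elems (dom (emptyMap m q))) ≡ allFin m
compl-emptyMap m q = trans (compl-elems (dom (emptyMap m q))) (outside-emptyMap m q m)

lookup-map : ∀ {A B : Set} (f : A → B) xs i →
  L.lookup (map f xs) i ≡ f (L.lookup xs (Fin.cast (List.length-map f xs) i))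
lookup-map f (x ∷ xs) zero    = refl
lookup-map f (x ∷ xs) (suc i) = lookup-map f xs i

lookup-tabulate : ∀ {A : Set} {n} (f : Fin n → A) i →
  L.lookup (tabulate f) i ≡ f (Fin.cast (List.length-tabulate f) i)
lookup-tabulate {n = suc n} f zero    = refl
lookup-tabulate {n = suc n} f (suc i) = lookup-tabulate (f ∘ suc) i

-- Sums over injective partial maps weighted by a matrix

module Weights {c ℓ : Level} (CR : CommutativeRing c ℓ) where
  open CommutativeRing CR hiding (refl; sym; trans; zero)
  open Rook CR
  open Sums CR
  open import Relation.Binary.Reasoning.Setoid setoid

  infix 4 _≋_
  -- The dimensions of a submatrix are lengths of index lists, which often agree only
  -- propositionally; entries are therefore compared after a cast.
  record _≋_ {p q p' q'} (C : Mat p q) (D : Mat p' q') : Set ℓ where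
    constructor same
    field
      rows≡   : p ≡ p'
      cols≡   : q ≡ q'
      entries : ∀ i j → C i j ≈ D (Fin.cast rows≡ i) (Fin.cast cols≡ j)

  ≋-entries : ∀ {p q} {C D : Mat p q} → C ≋ D → ∀ i j → C i j ≈ D i j
  ≋-entries {D = D} (same refl refl h) i j = R.trans (h i j) (R.reflexive (cong₂ D (FinP.cast-is-id refl i) (FinP.cast-is-id refl j)))

  sub-map : ∀ {p q p' q'} (C : Mat p q) (f : Fin p' → Fin p) (g : Fin q' → Fin q) rs cs →
    sub C (map f rs) (map g cs) ≋ sub (λ i j → C (f i) (g j)) rs cs
  sub-map C f g rs cs = same (List.length-map f rs) (List.length-map g cs) λ i j → R.reflexive (cong₂ C (lookup-map f rs i) (lookup-map g cs j))

  sub-allFin : ∀ {p q} (C : Mat p q) → sub C (allFin p) (allFin q) ≋ C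
  sub-allFin C = same (List.length-tabulate (λ i → i)) (List.length-tabulate (λ j → j))
    λ i j → R.reflexive (cong₂ C (lookup-tabulate (λ i → i) i) (lookup-tabulate (λ j → j) j))

  weight-cong : ∀ {p q} {C D : Mat p q} → (∀ i j → C i j ≈ D i j) → ∀ φ → weight C φ ≈ weight D φ
  weight-cong {p} {C = C} {D} h φ = Π-cong (allFin p) λ i → entry i (lookup φ i)
    where
    entry : ∀ i x → maybe (C i) 1# x ≈ maybe (D i) 1# x
    entry i nothing  = R.refl
    entry i (just j) = h i j

  weight-insertAt : ∀ {p q} (C : Mat (suc p) q) (v : PMap p q) K x →
    weight C (insertAt v K x) ≈ maybe (C K) 1# x * weight (λ i → C (punchIn K i)) v
  weight-insertAt {p} C v K x = begin
    weight C (insertAt v K x)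
      ≈⟨ Π-punchIn K _ ⟩
    maybe (C K) 1# (lookup (insertAt v K x) K) * Π (map (λ i → maybe (C (punchIn K i)) 1# (lookup (insertAt v K x) (punchIn K i))) (allFin p))
      ≈⟨ *-cong (R.reflexive (cong (maybe (C K) 1#) (VecP.insertAt-lookup v K x)))
                (Π-cong (allFin p) λ i → R.reflexive (cong (maybe (C (punchIn K i)) 1#) (VecP.insertAt-punchIn v K x i))) ⟩
    maybe (C K) 1# x * weight (λ i → C (punchIn K i)) v ∎

  weight-map : ∀ {p q q'} (C : Mat p q') (g : Fin q → Fin q') (v : PMap p q) →
    weight C (Vec.map (Maybe.map g) v) ≈ weight (λ i j → C i (g j)) v
  weight-map {p} C g v = Π-cong (allFin p) λ i → R.trans
    (R.reflexive (cong (maybe (C i) 1#) (VecP.lookup-map i (Maybe.map g) v))) (entry i (lookup v i))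
    where
    entry : ∀ i x → maybe (C i) 1# (Maybe.map g x) ≈ maybe (λ j → C i (g j)) 1# x
    entry i nothing  = R.refl
    entry i (just j) = R.refl

  -- `Θ` is an arbitrary statistic of the map: powers of `z` times a weight for the cyclic sums, the
  -- indicator of total maps for `per`.
  injSum : ∀ {p q} → (PMap p q → Carrier) → Mat p q → Carrier
  injSum {p} {q} Θ C = ∑[ φ ∈ allPMaps p q ] (isInj φ ⊙ (Θ φ * weight C φ))

  injSum-cong : ∀ {p q} {Θ Θ' : PMap p q → Carrier} {C D : Mat p q} → (∀ φ → isInj φ ≡ true → Θ φ ≈ Θ' φ) →
    (∀ i j → C i j ≈ D i j) →
    injSum Θ C ≈ injSum Θ' D
  injSum-cong {p} {q} h e = ∑-cong (allPMaps p q) λ φ → ⊙-cong (isInj φ) λ inj → *-cong (h φ inj) (weight-cong e φ)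

  injSum-*ˡ : ∀ {p q} a (Θ : PMap p q → Carrier) C → a * injSum Θ C ≈ injSum (λ φ → a * Θ φ) C
  injSum-*ˡ {p} {q} a Θ C = R.trans (∑-*ˡ (allPMaps p q) a _) (∑-cong (allPMaps p q) λ φ →
    R.trans (R.sym (⊙-*ˡ (isInj φ) a _)) (⊙-cong (isInj φ) λ _ → R.sym (*-assoc _ _ _)))

  injSum-0 : ∀ {p q} (Θ : PMap p q → Carrier) C → (∀ φ → Θ φ ≈ 0#) → injSum Θ C ≈ 0#
  injSum-0 {p} {q} Θ C h = R.trans (∑-cong (allPMaps p q) λ φ → R.trans (⊙-cong (isInj φ) λ _ → R.trans (*-congʳ (h φ)) (zeroˡ _)) (⊙-0 (isInj φ))) (∑-zero (allPMaps p q))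

  omit : ∀ {p q} → Fin (suc p) → Mat (suc p) q → Mat p q
  omit K C i = C (punchIn K i)

  contract : ∀ {p q} → Fin (suc p) → Fin (suc q) → Fin (suc q) → Mat (suc p) (suc q) → Mat p q
  contract K Kᶜ J C i b = C (punchIn K i) (redirectᶠ Kᶜ J b)

  injSum-row : ∀ {p q} (K : Fin (suc p)) (Kᶜ : Fin (suc q) → Fin (suc q)) (Θ : PMap (suc p) (suc q) → Carrier) C →
    injSum Θ C ≈ injSum (λ v → Θ (insertAt v K nothing)) (omit K C)
      + ∑[ j ∈ allFin (suc q) ] (C K j * injSum (λ φ → Θ (expand K (Kᶜ j) j φ)) (contract K (Kᶜ j) j C))
  injSum-row {p} {q} K Kᶜ Θ C = begin
    injSum Θ C
      ≈⟨ ∑-PMaps-insertAt (suc q) K g ⟩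
    ∑ V (λ v → ∑ (nothing ∷ map just (allFin (suc q))) (λ x → g (insertAt v K x)))
      ≈⟨ ∑-cong V (λ v → ∑-entries (suc q) (λ x → g (insertAt v K x))) ⟩
    ∑ V (λ v → g (insertAt v K nothing) + ∑ (allFin (suc q)) (λ j → g (insertAt v K (just j))))
      ≈⟨ ∑-+ V _ _ ⟩
    ∑ V (λ v → g (insertAt v K nothing)) + ∑ V (λ v → ∑ (allFin (suc q)) (λ j → g (insertAt v K (just j))))
      ≈⟨ +-cong (∑-cong V off) (R.trans (∑-swap V (allFin (suc q)) _) (∑-cong (allFin (suc q)) on)) ⟩
    injSum (λ v → Θ (insertAt v K nothing)) (omit K C)
      + ∑ (allFin (suc q)) (λ j → C K j * injSum (λ φ → Θ (expand K (Kᶜ j) j φ)) (contract K (Kᶜ j) j C)) ∎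
    where
    V = allPMaps p (suc q)
    g : PMap (suc p) (suc q) → Carrier
    g φ = isInj φ ⊙ (Θ φ * weight C φ)
    off : ∀ v → g (insertAt v K nothing) ≈ isInj v ⊙ (Θ (insertAt v K nothing) * weight (omit K C) v)
    off v = R.trans (⊙-≡ (isInj-insertAt-nothing v K))
      (⊙-cong (isInj v) λ _ → *-congˡ (R.trans (weight-insertAt C v K nothing) (*-identityˡ _)))
    on : ∀ j → ∑ V (λ v → g (insertAt v K (just j))) ≈ C K j * injSum (λ φ → Θ (expand K (Kᶜ j) j φ)) (contract K (Kᶜ j) j C)
    on j = begin
      ∑ V (λ v → g (insertAt v K (just j)))
        ≈⟨ ∑-cong V (λ v → R.trans (⊙-≡ (isInj-insertAt-just v K j)) (R.sym (⊙-∧ (fresh j v) (isInj v)))) ⟩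
      ∑ V (λ v → fresh j v ⊙ isInj v ⊙ (Θ (insertAt v K (just j)) * weight C (insertAt v K (just j))))
        ≈⟨ ∑-fresh p (Kᶜ j) j _ ⟩
      ∑ (allPMaps p q) (λ φ → isInj (ρ φ) ⊙ (Θ (expand K (Kᶜ j) j φ) * weight C (expand K (Kᶜ j) j φ)))
        ≈⟨ ∑-cong (allPMaps p q) (λ φ → R.trans (⊙-≡ (isInj-map (redirectᶠ (Kᶜ j) j) (redirectᶠ-injective (Kᶜ j) j) φ))
             (R.trans (⊙-cong (isInj φ) λ _ → R.trans (*-congˡ (R.trans (weight-insertAt C (ρ φ) K (just j)) (*-congˡ (weight-map (omit K C) (redirectᶠ (Kᶜ j) j) φ)))) (*-exchange _ _ _))
               (⊙-*ˡ (isInj φ) _ _))) ⟩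
      ∑ (allPMaps p q) (λ φ → C K j * isInj φ ⊙ (Θ (expand K (Kᶜ j) j φ) * weight (contract K (Kᶜ j) j C) φ))
        ≈⟨ ∑-*ˡ (allPMaps p q) (C K j) _ ⟨
      C K j * injSum (λ φ → Θ (expand K (Kᶜ j) j φ)) (contract K (Kᶜ j) j C) ∎
      where
      ρ : PMap p q → PMap p (suc q)
      ρ = Vec.map (Maybe.map (redirectᶠ (Kᶜ j) j))

  -- The sum is affine in row `K`, and a contraction along `K` no longer contains that row, so it is
  -- the same for `C` and `D`. The excess `e` thus contributes linearly.
  injSum-split : ∀ {p q} (K : Fin (suc p)) (Kᶜ : Fin (suc q)) (Θ : PMap (suc p) (suc q) → Carrier) (C D : Mat (suc p) (suc q)) (e : Fin (suc q) → Carrier) →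
    (∀ i j → C (punchIn K i) j ≈ D (punchIn K i) j) → (∀ j → C K j ≈ D K j + e j) →
    injSum Θ C ≈ injSum Θ D + ∑[ j ∈ allFin (suc q) ] (e j * injSum (λ φ → Θ (expand K Kᶜ j φ)) (contract K Kᶜ j C))
  injSum-split {p} {q} K Kᶜ Θ C D e h hK = begin
    injSum Θ C
      ≈⟨ injSum-row K (λ _ → Kᶜ) Θ C ⟩
    X C + ∑ F (λ j → C K j * Y C j)
      ≈⟨ +-cong (injSum-cong {Θ = λ v → Θ (insertAt v K nothing)} (λ _ _ → R.refl) h) (∑-cong F λ j → R.trans (*-congʳ (hK j)) (distribʳ _ _ _)) ⟩
    X D + ∑ F (λ j → D K j * Y C j + e j * Y C j)
      ≈⟨ +-congˡ (∑-+ F _ _) ⟩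
    X D + (∑ F (λ j → D K j * Y C j) + ∑ F (λ j → e j * Y C j))
      ≈⟨ +-assoc _ _ _ ⟨
    (X D + ∑ F (λ j → D K j * Y C j)) + ∑ F (λ j → e j * Y C j)
      ≈⟨ +-congʳ (+-congˡ (∑-cong F λ j → *-congˡ (injSum-cong {Θ = λ φ → Θ (expand K Kᶜ j φ)} (λ _ _ → R.refl) λ i b → h i _))) ⟩
    (X D + ∑ F (λ j → D K j * Y D j)) + ∑ F (λ j → e j * Y C j)
      ≈⟨ +-congʳ (injSum-row K (λ _ → Kᶜ) Θ D) ⟨
    injSum Θ D + ∑ F (λ j → e j * Y C j) ∎
    where
    F = allFin (suc q)
    X : Mat (suc p) (suc q) → Carrier
    X C = injSum (λ v → Θ (insertAt v K nothing)) (omit K C)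
    Y : Mat (suc p) (suc q) → Fin (suc q) → Carrier
    Y C j = injSum (λ φ → Θ (expand K Kᶜ j φ)) (contract K Kᶜ j C)

  ∑-PMaps-empty : ∀ p q (f : PMap p q → Carrier) → (∀ φ i j → lookup φ i ≡ just j → f φ ≈ 0#) →
    ∑ (allPMaps p q) f ≈ f (emptyMap p q)
  ∑-PMaps-empty zero    q f h = ∑-singleton [] f
  ∑-PMaps-empty (suc p) q f h = begin
    ∑ (allPMaps (suc p) q) f
      ≈⟨ ∑-PMaps-∷ p q f ⟩
    ∑ (allPMaps p q) (λ v → ∑ (nothing ∷ map just (allFin q)) (λ x → f (x ∷ v)))
      ≈⟨ ∑-cong (allPMaps p q) (λ v → R.trans (∑-entries q _) (R.trans (+-congˡ (R.trans (∑-cong (allFin q) λ j → h (just j ∷ v) zero j refl) (∑-zero (allFin q)))) (+-identityʳ _))) ⟩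
    ∑ (allPMaps p q) (λ v → f (nothing ∷ v))
      ≈⟨ ∑-PMaps-empty p q _ (λ φ i j → h (nothing ∷ φ) (suc i) j) ⟩
    f (emptyMap (suc p) q) ∎

  weight-0 : ∀ {p q} (C : Mat p q) → (∀ i j → C i j ≈ 0#) → ∀ φ i j → lookup φ i ≡ just j → weight C φ ≈ 0#
  weight-0 {suc p} C h φ i j l = R.trans (Π-punchIn i _) (R.trans (*-congʳ (R.trans (R.reflexive (cong (maybe (C i) 1#) l)) (h i j))) (zeroˡ _))

  weight-emptyMap : ∀ p q (C : Mat p q) → weight C (emptyMap p q) ≈ 1#
  weight-emptyMap zero    q C = R.refl
  weight-emptyMap (suc p) q C = R.trans (Π-allFin-suc p _) (R.trans (*-identityˡ _) (weight-emptyMap p q (C ∘ suc)))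

  injSum-zero-matrix : ∀ {p q} (Θ : PMap p q → Carrier) C → (∀ i j → C i j ≈ 0#) → injSum Θ C ≈ Θ (emptyMap p q)
  injSum-zero-matrix {p} {q} Θ C h = R.trans
    (∑-PMaps-empty p q _ λ φ i j l → R.trans (⊙-cong (isInj φ) λ _ → R.trans (*-congˡ (weight-0 C h φ i j l)) (zeroʳ _)) (⊙-0 (isInj φ)))
    (R.trans (⊙-≡ (isInj-emptyMap p q)) (R.trans (*-congˡ (weight-emptyMap p q C)) (*-identityʳ _)))

  pow-+ : ∀ z a b → pow z (a N.+ b) ≈ pow z a * pow z b
  pow-+ z zero    b = R.sym (*-identityˡ _)
  pow-+ z (suc a) b = R.trans (*-congˡ (pow-+ z a b)) (R.sym (*-assoc _ _ _))

pin-≥ : ∀ {k a} → k ≤ a → suc k ≤ pin k a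
pin-≥ z≤n       = s≤s z≤n
pin-≥ (s≤s k≤a) = s≤s (pin-≥ k≤a)

-- The cyclic identities

module Cyclic {c ℓ : Level} (CR : CommutativeRing c ℓ) where
  open CommutativeRing CR hiding (refl; sym; trans; zero)
  open Rook CR
  open Sums CR
  open Weights CR
  open import Relation.Binary.Reasoning.Setoid setoid

  -- With h the indicator of l this is r_l(z;C), and with h t = x^t it is R(x;z;C).
  cycSum : (ℕ → Carrier) → Carrier → ∀ {p q} → Mat p q → Carrier
  cycSum h z C = injSum (λ φ → h (size (dom φ)) * pow z (numCycles φ)) C

  cycSum-cong : ∀ {h h'} z {p q p' q'} {C : Mat p q} {D : Mat p' q'} → (∀ t → h t ≈ h' t) → C ≋ D →
    cycSum h z C ≈ cycSum h' z D
  cycSum-cong {h} z e s@(same refl refl _) = injSum-cong (λ φ _ → *-congʳ (e (size (dom φ)))) (≋-entries s)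

  cycSum-0 : ∀ z {p q} (C : Mat p q) → cycSum (λ _ → 0#) z C ≈ 0#
  cycSum-0 z C = injSum-0 _ C λ φ → zeroˡ _

  residual : ∀ {m n} (m≤n : m ≤ n) → Mat m n → (φ : PMap m n) →
    Mat (length (compl (elems (dom φ)))) (length (phiBar m≤n (elems (dom φ)) φ))
  residual m≤n B φ = sub B (compl (elems (dom φ))) (phiBar m≤n (elems (dom φ)) φ)

  -- The right-hand side of the cyclic identities as one sum over all injective partial maps, the
  -- domain playing the role of α. `h` is shifted by the number of entries already taken from `A`.
  expansion : (ℕ → Carrier) → Carrier → ∀ {m n} → m ≤ n → Mat m n → Mat m n → Carrier
  expansion h z m≤n A B = injSum (λ φ → pow z (numCycles φ) * cycSum (λ t → h (size (dom φ) N.+ t)) z (residual m≤n B φ)) A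

  ⊕-≋ˡ : ∀ {p q} {A B : Mat p q} → (∀ i j → A i j ≈ 0#) → A ⊕ B ≋ B
  ⊕-≋ˡ {B = B} h = same refl refl λ i j → R.trans (R.trans (+-congʳ (h i j)) (+-identityˡ _))
    (R.reflexive (sym (cong₂ B (FinP.cast-is-id refl i) (FinP.cast-is-id refl j))))

  residual-emptyMap : ∀ {m n} (m≤n : m ≤ n) (B : Mat m n) → residual m≤n B (emptyMap m n) ≋ B
  residual-emptyMap {m} {n} m≤n B =
    subst₂ (λ rs cs → sub B rs cs ≋ B) (sym (compl-emptyMap m n)) (sym (phiBar-emptyMap m≤n)) (sub-allFin B)

  -- Only the empty map has nonzero weight in `A`, it has no cycles, and its residual is `B`.
  cycSum-⊕-zero : ∀ h z {m n} (m≤n : m ≤ n) (A B : Mat m n) → (∀ i j → A i j ≈ 0#) →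
    cycSum h z (A ⊕ B) ≈ expansion h z m≤n A B
  cycSum-⊕-zero h z {m} {n} m≤n A B A≈0 = begin
    cycSum h z (A ⊕ B)
      ≈⟨ cycSum-cong {h} {h} z (λ _ → R.refl) (⊕-≋ˡ A≈0) ⟩
    cycSum h z B
      ≈⟨ cycSum-cong z (λ t → R.reflexive (cong (λ d → h (d N.+ t)) (size-dom-emptyMap m n))) (residual-emptyMap m≤n B) ⟨
    cycSum (λ t → h (size (dom ε) N.+ t)) z (residual m≤n B ε)
      ≈⟨ R.trans (*-congʳ (R.reflexive (cong (pow z) (numCycles-empty ε (appℕ-emptyMap m n))))) (*-identityˡ _) ⟨
    pow z (numCycles ε) * cycSum (λ t → h (size (dom ε) N.+ t)) z (residual m≤n B ε)
      ≈⟨ injSum-zero-matrix _ A A≈0 ⟨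
    expansion h z m≤n A B ∎
    where ε = emptyMap m n

  module _ (h : ℕ → Carrier) (z : Carrier) {m n} (m≤n : m ≤ n) (sm≤sn : suc m ≤ suc n) (K : Fin (suc m)) (Kᶜ J : Fin (suc n)) (eq : toℕ Kᶜ ≡ toℕ K) where
    private
      loop : Carrier
      loop = pow z (b2n (J ≟ᶠ Kᶜ))

      size-expand : ∀ φ → size (dom (expand K Kᶜ J φ)) ≡ suc (size (dom φ))
      size-expand φ = trans (cong size (dom-expand K Kᶜ J φ)) (size-insertAt-true (dom φ) K)

      pow-expand : ∀ φ → pow z (numCycles (expand K Kᶜ J φ)) ≈ loop * pow z (numCycles φ)
      pow-expand φ = R.trans (R.reflexive (cong (pow z) (numCycles-expand K Kᶜ J eq φ))) (pow-+ z (b2n (J ≟ᶠ Kᶜ)) (numCycles φ))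

    -- The restored arc is one more entry, hence `h ∘ suc`, and one more cycle exactly when it is a
    -- loop, hence the factor `loop`.
    cycSum-contract : ∀ C →
      injSum (λ φ → h (size (dom (expand K Kᶜ J φ))) * pow z (numCycles (expand K Kᶜ J φ))) C ≈ loop * cycSum (h ∘ suc) z C
    cycSum-contract C = R.trans
      (injSum-cong (λ φ _ → R.trans (*-cong (R.reflexive (cong h (size-expand φ))) (pow-expand φ)) (*-exchange _ _ _)) (λ _ _ → R.refl))
      (R.sym (injSum-*ˡ loop _ C))

    -- The rows and columns left by the expanded map are those left by `φ`, relabelled by
    -- `punchIn K` and `redirectᶠ Kᶜ J`. Reading `B` through these relabellings is its contraction.
    residual-expand : ∀ (B : Mat (suc m) (suc n)) φ → isInj φ ≡ true →
      residual sm≤sn B (expand K Kᶜ J φ) ≋ residual m≤n (contract K Kᶜ J B) φ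
    residual-expand B φ inj = subst₂ (λ rs cs → sub B rs cs ≋ residual m≤n (contract K Kᶜ J B) φ)
      (sym (compl-expand m≤n sm≤sn K Kᶜ J eq φ)) (sym (phiBar-expand m≤n sm≤sn K Kᶜ J eq φ inj)) 
      (sub-map B (punchIn K) (redirectᶠ Kᶜ J) (compl (elems (dom φ))) (phiBar m≤n (elems (dom φ)) φ))

    expansion-contract : ∀ (A B : Mat (suc m) (suc n)) →
      injSum (λ φ → let Φ = expand K Kᶜ J φ in pow z (numCycles Φ) * cycSum (λ t → h (size (dom Φ) N.+ t)) z (residual sm≤sn B Φ)) (contract K Kᶜ J A)
        ≈ loop * expansion (h ∘ suc) z m≤n (contract K Kᶜ J A) (contract K Kᶜ J B)
    expansion-contract A B = R.trans
      (injSum-cong (λ φ inj → R.trans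
        (*-cong (pow-expand φ) (cycSum-cong z (λ t → R.reflexive (cong (λ d → h (d N.+ t)) (size-expand φ))) (residual-expand B φ inj)))
        (*-assoc _ _ _)) (λ _ _ → R.refl))
      (R.sym (injSum-*ˡ loop _ (contract K Kᶜ J A)))

  clearRow : ∀ {p q} → Fin p → Mat p q → Mat p q
  clearRow K A i j = not (i ≟ᶠ K) ⊙ A i j

  clearRow-at : ∀ {p q} (K : Fin p) (A : Mat p q) j → clearRow K A K j ≈ 0#
  clearRow-at K A j = ⊙-≡ {b' = false} (cong not (≡ᵇ-refl (toℕ K)))

  clearRow-off : ∀ {p q} (K : Fin (suc p)) (A : Mat (suc p) q) i j → clearRow K A (punchIn K i) j ≈ A (punchIn K i) j
  clearRow-off K A i j = ⊙-≡ {b' = true} (cong not (punchIn≟ K i))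

  -- The rows of A are removed one at a time, the last nonzero one first.
  cycSum-⊕ : ∀ k h z {m n} (m≤n : m ≤ n) (A B : Mat m n) → (∀ i j → k ≤ toℕ i → A i j ≈ 0#) →
    cycSum h z (A ⊕ B) ≈ expansion h z m≤n A B
  cycSum-⊕ zero    h z m≤n A B A≈0 = cycSum-⊕-zero h z m≤n A B λ i j → A≈0 i j z≤n
  cycSum-⊕ (suc k) h z {zero} m≤n A B A≈0 = cycSum-⊕-zero h z m≤n A B λ ()
  cycSum-⊕ (suc k) h z {suc m} {suc n} sm≤sn@(s≤s m≤n) A B A≈0 with k ℕ.<? suc m
  ... | no k≮m = cycSum-⊕ k h z sm≤sn A B λ i j k≤i → ⊥-elim (k≮m (ℕ.≤-<-trans k≤i (FinP.toℕ<n i)))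
  ... | yes k<m = begin
    cycSum h z (A ⊕ B)
      -- Clearing row `K` of `A` costs contractions of `A ⊕ B` here and contractions of `A` in the
      -- expansion below, with the same coefficients `A K j`; `term` matches them one by one.
      ≈⟨ injSum-split K Kᶜ _ (A ⊕ B) (A° ⊕ B) (A K)
           (λ i j → +-congʳ (R.sym (clearRow-off K A i j)))
           (λ j → R.trans (+-comm _ _) (+-congʳ (R.sym (R.trans (+-congʳ (clearRow-at K A j)) (+-identityˡ _))))) ⟩
    cycSum h z (A° ⊕ B) + ∑ F (λ j → A K j * injSum _ (contract K Kᶜ j (A ⊕ B)))
      ≈⟨ +-cong (cycSum-⊕ k h z sm≤sn A° B A°≈0) (∑-cong F λ j → *-congˡ (term j)) ⟩
    expansion h z sm≤sn A° B + ∑ F (λ j → A K j * injSum _ (contract K Kᶜ j A))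
      ≈⟨ injSum-split K Kᶜ _ A A° (A K) (λ i j → R.sym (clearRow-off K A i j))
           (λ j → R.sym (R.trans (+-congʳ (clearRow-at K A j)) (+-identityˡ _))) ⟨
    expansion h z sm≤sn A B ∎
    where
    F = allFin (suc n)
    K = fromℕ< k<m
    toℕK : toℕ K ≡ k
    toℕK = FinP.toℕ-fromℕ< k<m
    Kᶜ = inject≤ K sm≤sn
    eq : toℕ Kᶜ ≡ toℕ K
    eq = FinP.toℕ-inject≤ K sm≤sn
    A° = clearRow K A
    A°≈0 : ∀ i j → k ≤ toℕ i → A° i j ≈ 0#
    A°≈0 i j k≤i with toℕ i ≡ᵇ toℕ K in e
    ... | true  = R.refl
    ... | false = A≈0 i j (ℕ.≤∧≢⇒< k≤i λ k≡i → contradiction e (true≢false (trans (cong (_≡ᵇ toℕ K) (trans (sym k≡i) (sym toℕK))) (≡ᵇ-refl (toℕ K)))))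
    below : ∀ i → k ≤ toℕ i → suc k ≤ toℕ (punchIn K i)
    below i k≤i = subst₂ _≤_ (cong suc toℕK) (sym (toℕ-punchIn K i)) (pin-≥ (subst (_≤ toℕ i) (sym toℕK) k≤i))
    -- `contract` commutes with `⊕` by definition, so the induction hypothesis applies to the
    -- contracted matrices, with `h ∘ suc` for the entry already chosen. Their rows from `k` on come
    -- from rows after `K`, where `A` vanishes.
    term : ∀ j → injSum _ (contract K Kᶜ j (A ⊕ B)) ≈ injSum _ (contract K Kᶜ j A)
    term j = R.trans (cycSum-contract h z m≤n sm≤sn K Kᶜ j eq _)
      (R.trans (*-congˡ (cycSum-⊕ k (h ∘ suc) z m≤n (contract K Kᶜ j A) (contract K Kᶜ j B) λ i b k≤i → A≈0 _ _ (below i k≤i)))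
        (R.sym (expansion-contract h z m≤n sm≤sn K Kᶜ j eq A B)))

-- From weighted sums to the cyclic rook polynomial, rook numbers and permanent

<ᵇ-true : ∀ {a b} → a < b → (a <ᵇ b) ≡ true
<ᵇ-true lt = Equivalence.to T-≡ (ℕ.<⇒<ᵇ lt)

module CyclicExpansion {c ℓ : Level} (CR : CommutativeRing c ℓ) where
  open CommutativeRing CR hiding (refl; sym; trans; zero)
  open Rook CR
  open Sums CR
  open Weights CR
  open Cyclic CR
  open import Relation.Binary.Reasoning.Setoid setoid

  ∑-subsets-∷ : ∀ p (f : Vec Bool (suc p) → Carrier) →
    ∑ (allSubsets (suc p)) f ≈ ∑[ S ∈ allSubsets p ] (f (true ∷ S) + f (false ∷ S))
  ∑-subsets-∷ p f = R.trans (∑-concatMap (λ v → (true ∷ v) ∷ (false ∷ v) ∷ []) (allSubsets p) f)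
    (∑-cong (allSubsets p) λ S → R.trans (∑-∷ (true ∷ S) _ f) (+-congˡ (∑-singleton (false ∷ S) f)))

  ∑-sameSet : ∀ {p} (D : Vec Bool p) (g : Vec Bool p → Carrier) → ∑[ S ∈ allSubsets p ] (sameSet D S ⊙ g S) ≈ g D
  ∑-sameSet []      g = ∑-singleton [] _
  ∑-sameSet {suc p} (b ∷ D) g = R.trans (∑-subsets-∷ p _) (R.trans (∑-cong (allSubsets p) (pick b)) (∑-sameSet D (λ S → g (b ∷ S))))
    where
    pick : ∀ b S → sameSet (b ∷ D) (true ∷ S) ⊙ g (true ∷ S) + sameSet (b ∷ D) (false ∷ S) ⊙ g (false ∷ S) ≈ sameSet D S ⊙ g (b ∷ S)
    pick true  S = +-identityʳ _
    pick false S = +-identityˡ _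

  ∑-Q : ∀ s p (f : List (Fin p) → Carrier) → ∑ (Q s p) f ≈ ∑[ S ∈ allSubsets p ] ((size S ≡ᵇ s) ⊙ f (elems S))
  ∑-Q s p f = R.trans (∑-map elems _ f) (∑-filter (λ S → size S ≡ᵇ s) (allSubsets p) _)

  ∑-upTo-Q : ∀ N p (f : ℕ → List (Fin p) → Carrier) →
    ∑[ s ∈ upTo N ] (∑[ α ∈ Q s p ] f s α) ≈ ∑[ S ∈ allSubsets p ] ((size S <ᵇ N) ⊙ f (size S) (elems S))
  ∑-upTo-Q N p f = R.trans (∑-cong (upTo N) λ s → ∑-Q s p (f s))
    (R.trans (∑-swap (upTo N) (allSubsets p) _) (∑-cong (allSubsets p) λ S → ∑-upTo-δ N (size S) (λ s → f s (elems S))))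

  -- Every injective partial map has exactly one domain, so it is visited once. `P` is abstract
  -- because domains are tested by `lookup S` in one place and by membership in `elems S` in
  -- another.
  ∑-injOn-dom : ∀ {p q} (P : Vec Bool p → Fin p → Bool) → (∀ S i → P S i ≡ lookup S i) →
    (f : Vec Bool p → PMap p q → Carrier) →
    ∑[ S ∈ allSubsets p ] (∑[ φ ∈ injOn q (P S) ] f S φ) ≈ ∑[ φ ∈ allPMaps p q ] (isInj φ ⊙ f (dom φ) φ)
  ∑-injOn-dom {p} {q} P hP f = begin
    ∑ (allSubsets p) (λ S → ∑ (injOn q (P S)) (f S))
      ≈⟨ ∑-cong (allSubsets p) (λ S → ∑-filter (λ φ → isInj φ ∧ domIs (P S) φ) (allPMaps p q) (f S)) ⟩
    ∑ (allSubsets p) (λ S → ∑ (allPMaps p q) (λ φ → (isInj φ ∧ domIs (P S) φ) ⊙ f S φ))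
      ≈⟨ ∑-swap (allSubsets p) (allPMaps p q) _ ⟩
    ∑ (allPMaps p q) (λ φ → ∑ (allSubsets p) (λ S → (isInj φ ∧ domIs (P S) φ) ⊙ f S φ))
      ≈⟨ ∑-cong (allPMaps p q) collapse ⟩
    ∑ (allPMaps p q) (λ φ → isInj φ ⊙ f (dom φ) φ) ∎
    where
    collapse : ∀ φ → ∑ (allSubsets p) (λ S → (isInj φ ∧ domIs (P S) φ) ⊙ f S φ) ≈ isInj φ ⊙ f (dom φ) φ
    collapse φ = begin
      ∑ (allSubsets p) (λ S → (isInj φ ∧ domIs (P S) φ) ⊙ f S φ)
        ≈⟨ ∑-cong (allSubsets p) (λ S → R.trans (⊙-≡ (cong (isInj φ ∧_) (domIs-sameSet (P S) S φ (hP S)))) (R.sym (⊙-∧ (isInj φ) _))) ⟩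
      ∑ (allSubsets p) (λ S → isInj φ ⊙ sameSet (dom φ) S ⊙ f S φ)
        ≈⟨ ∑-⊙ (allSubsets p) (isInj φ) _ ⟨
      isInj φ ⊙ ∑ (allSubsets p) (λ S → sameSet (dom φ) S ⊙ f S φ)
        ≈⟨ ⊙-cong (isInj φ) (λ _ → ∑-sameSet (dom φ) (λ S → f S φ)) ⟩
      isInj φ ⊙ f (dom φ) φ ∎

  δ : ℕ → ℕ → Carrier
  δ l d = (d ≡ᵇ l) ⊙ 1#

  cycRook-cycSum : ∀ z l {p q} (C : Mat p q) → cycRook z l C ≈ cycSum (δ l) z C
  cycRook-cycSum z l {p} {q} C = begin
    cycRook z l C
      ≈⟨ Σ-concatMap _ (filterᵇ (λ S → size S ≡ᵇ l) (allSubsets p)) ⟩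
    ∑ (filterᵇ (λ S → size S ≡ᵇ l) (allSubsets p)) (λ S → Σ (map w (injOn q (lookup S))))
      ≈⟨ ∑-filter (λ S → size S ≡ᵇ l) (allSubsets p) _ ⟩
    ∑ (allSubsets p) (λ S → (size S ≡ᵇ l) ⊙ Σ (map w (injOn q (lookup S))))
      ≈⟨ ∑-cong (allSubsets p) (λ S → R.trans (⊙-cong (size S ≡ᵇ l) λ _ → Σ-map (injOn q (lookup S)) w) (∑-⊙ (injOn q (lookup S)) (size S ≡ᵇ l) w)) ⟩
    ∑ (allSubsets p) (λ S → ∑ (injOn q (lookup S)) (λ φ → (size S ≡ᵇ l) ⊙ w φ))
      ≈⟨ ∑-injOn-dom lookup (λ S i → refl) _ ⟩
    ∑ (allPMaps p q) (λ φ → isInj φ ⊙ (size (dom φ) ≡ᵇ l) ⊙ w φ)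
      ≈⟨ ∑-cong (allPMaps p q) (λ φ → ⊙-cong (isInj φ) λ _ → R.trans (⊙-cong (size (dom φ) ≡ᵇ l) λ _ → *-congʳ (R.sym (*-identityˡ _)))
           (R.trans (⊙-*ʳ (size (dom φ) ≡ᵇ l) _ _) (*-congʳ (⊙-*ʳ (size (dom φ) ≡ᵇ l) _ _)))) ⟩
    cycSum (δ l) z C ∎
    where
    w : PMap p q → Carrier
    w φ = pow z (numCycles φ) * weight C φ

  δ-sum : ∀ x {d p} → d ≤ p → ∑[ l ∈ upTo (suc p) ] (δ l d * pow x l) ≈ pow x d
  δ-sum x {d} {p} d≤p = R.trans (∑-cong (upTo (suc p)) λ l → R.trans (R.sym (⊙-*ʳ (d ≡ᵇ l) 1# (pow x l))) (⊙-cong (d ≡ᵇ l) λ _ → *-identityˡ _))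
    (R.trans (∑-upTo-δ (suc p) d (pow x)) (⊙-≡ {b' = true} (<ᵇ-true (s≤s d≤p))))

  cycR-cycSum : ∀ x z {p q} (C : Mat p q) → cycR x z C ≈ cycSum (pow x) z C
  cycR-cycSum x z {p} {q} C = begin
    cycR x z C
      ≈⟨ Σ-map (upTo (suc p)) _ ⟩
    ∑ (upTo (suc p)) (λ l → cycRook z l C * pow x l)
      ≈⟨ ∑-cong (upTo (suc p)) (λ l → R.trans (*-congʳ (cycRook-cycSum z l C)) (∑-*ʳ (allPMaps p q) (pow x l) _)) ⟩
    ∑ (upTo (suc p)) (λ l → ∑ (allPMaps p q) (λ φ → isInj φ ⊙ (δ l (size (dom φ)) * pow z (numCycles φ) * weight C φ) * pow x l))
      ≈⟨ ∑-swap (upTo (suc p)) (allPMaps p q) _ ⟩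
    ∑ (allPMaps p q) (λ φ → ∑ (upTo (suc p)) (λ l → isInj φ ⊙ (δ l (size (dom φ)) * pow z (numCycles φ) * weight C φ) * pow x l))
      ≈⟨ ∑-cong (allPMaps p q) collapse ⟩
    cycSum (pow x) z C ∎
    where
    collapse : ∀ φ → ∑ (upTo (suc p)) (λ l → isInj φ ⊙ (δ l (size (dom φ)) * pow z (numCycles φ) * weight C φ) * pow x l)
      ≈ isInj φ ⊙ (pow x (size (dom φ)) * pow z (numCycles φ) * weight C φ)
    collapse φ = begin
      ∑ (upTo (suc p)) (λ l → isInj φ ⊙ (δ l d * a * b) * pow x l)
        ≈⟨ ∑-cong (upTo (suc p)) (λ l → R.trans (R.sym (⊙-*ʳ (isInj φ) _ _)) (⊙-cong (isInj φ) λ _ →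
             R.trans (*-comm _ _) (R.trans (R.sym (*-assoc _ _ _)) (*-congʳ (R.trans (R.sym (*-assoc _ _ _)) (*-congʳ (*-comm _ _))))))) ⟩
      ∑ (upTo (suc p)) (λ l → isInj φ ⊙ (δ l d * pow x l * a * b))
        ≈⟨ ∑-⊙ (upTo (suc p)) (isInj φ) _ ⟨
      isInj φ ⊙ ∑ (upTo (suc p)) (λ l → δ l d * pow x l * a * b)
        ≈⟨ ⊙-cong (isInj φ) (λ _ → R.trans (R.sym (∑-*ʳ (upTo (suc p)) b _)) (*-congʳ (R.trans (R.sym (∑-*ʳ (upTo (suc p)) a _)) (*-congʳ (δ-sum x (size≤ (dom φ))))))) ⟩
      isInj φ ⊙ (pow x d * a * b) ∎
      where
      d = size (dom φ)
      a = pow z (numCycles φ)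
      b = weight C φ

  ∑-injOn-memᶠ : ∀ N m n (G : ℕ → List (Fin m) → PMap m n → Carrier) →
    Σ (concatMap (λ s → concatMap (λ α → map (λ φ → G s α φ) (injOn n (λ i → memᶠ i α))) (Q s m)) (upTo N))
      ≈ ∑[ φ ∈ allPMaps m n ] (isInj φ ⊙ (size (dom φ) <ᵇ N) ⊙ G (size (dom φ)) (elems (dom φ)) φ)
  ∑-injOn-memᶠ N m n G = begin
    Σ (concatMap (λ s → concatMap (λ α → map (G s α) (I α)) (Q s m)) (upTo N))
      ≈⟨ Σ-concatMap _ (upTo N) ⟩
    ∑ (upTo N) (λ s → Σ (concatMap (λ α → map (G s α) (I α)) (Q s m)))
      ≈⟨ ∑-cong (upTo N) (λ s → R.trans (Σ-concatMap _ (Q s m)) (∑-cong (Q s m) λ α → Σ-map (I α) (G s α))) ⟩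
    ∑ (upTo N) (λ s → ∑ (Q s m) (λ α → ∑ (I α) (G s α)))
      ≈⟨ ∑-upTo-Q N m _ ⟩
    ∑ (allSubsets m) (λ S → (size S <ᵇ N) ⊙ ∑ (I (elems S)) (G (size S) (elems S)))
      ≈⟨ ∑-cong (allSubsets m) (λ S → ∑-⊙ (I (elems S)) (size S <ᵇ N) _) ⟩
    ∑ (allSubsets m) (λ S → ∑ (I (elems S)) (λ φ → (size S <ᵇ N) ⊙ G (size S) (elems S) φ))
      ≈⟨ ∑-injOn-dom (λ S i → memᶠ i (elems S)) (λ S i → trans (memᶠ-elems S i) (inSet-lookup S i)) _ ⟩
    ∑ (allPMaps m n) (λ φ → isInj φ ⊙ (size (dom φ) <ᵇ N) ⊙ G (size (dom φ)) (elems (dom φ)) φ) ∎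
    where
    I : List (Fin m) → List (PMap m n)
    I α = injOn n (λ i → memᶠ i α)

  -- The Boolean guards the truncated subtraction: for `d > l` no number of further entries adds up
  -- to `l`. The same Boolean is the range `s ≤ l` of the outer sum. Removing a successor from both
  -- `d` and `l` changes nothing up to computation.
  cycSum-shift : ∀ z d l {p q} (C : Mat p q) → cycSum (λ t → δ l (d N.+ t)) z C ≈ (d <ᵇ suc l) ⊙ cycRook z (l ∸ d) C
  cycSum-shift z zero    l       C = R.sym (cycRook-cycSum z l C)
  cycSum-shift z (suc d) zero    C = cycSum-0 z C
  cycSum-shift z (suc d) (suc l) C = cycSum-shift z d l C

  expansion-term : ∀ N {m n} (m≤n : m ≤ n) z h (A B : Mat m n) (G : ℕ → List (Fin m) → PMap m n → Carrier) →
    (∀ φ → pow z (numCycles φ) * cycSum (λ t → h (size (dom φ) N.+ t)) z (residual m≤n B φ) * weight A φ ≈ (size (dom φ) <ᵇ N) ⊙ G (size (dom φ)) (elems (dom φ)) φ) →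
    cycSum h z (A ⊕ B) ≈ Σ (concatMap (λ s → concatMap (λ α → map (λ φ → G s α φ) (injOn n (λ i → memᶠ i α))) (Q s m)) (upTo N))
  expansion-term N {m} {n} m≤n z h A B G e = begin
    cycSum h z (A ⊕ B)
      ≈⟨ cycSum-⊕ m h z m≤n A B (λ i j m≤i → ⊥-elim (ℕ.<⇒≱ (FinP.toℕ<n i) m≤i)) ⟩
    expansion h z m≤n A B
      ≈⟨ ∑-cong (allPMaps m n) (λ φ → ⊙-cong (isInj φ) λ _ → e φ) ⟩
    ∑ (allPMaps m n) (λ φ → isInj φ ⊙ (size (dom φ) <ᵇ N) ⊙ G (size (dom φ)) (elems (dom φ)) φ)
      ≈⟨ ∑-injOn-memᶠ N m n G ⟨
    Σ (concatMap (λ s → concatMap (λ α → map (λ φ → G s α φ) (injOn n (λ i → memᶠ i α))) (Q s m)) (upTo N)) ∎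

  module _ {m n} (m≤n : m ≤ n) (A B : Mat m n) (x z : Carrier) where
    cycRook-⊕ : ∀ l → cycRook z l (A ⊕ B) ≈
      Σ (concatMap (λ s → concatMap (λ α → map (λ φ →
        pow z (numCycles φ) * weight A φ * cycRook z (l ∸ s) (sub B (compl α) (phiBar m≤n α φ)))
        (injOn n (λ i → memᶠ i α))) (Q s m)) (upTo (suc l)))
    cycRook-⊕ l = R.trans (cycRook-cycSum z l (A ⊕ B)) (expansion-term (suc l) m≤n z (δ l) A B
      (λ s α φ → pow z (numCycles φ) * weight A φ * cycRook z (l ∸ s) (sub B (compl α) (phiBar m≤n α φ)))
      λ φ → let d = size (dom φ) ; b = d <ᵇ suc l in begin
        pow z (numCycles φ) * cycSum (λ t → δ l (d N.+ t)) z (residual m≤n B φ) * weight A φ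
          ≈⟨ *-congʳ (*-congˡ (cycSum-shift z d l (residual m≤n B φ))) ⟩
        pow z (numCycles φ) * b ⊙ cycRook z (l ∸ d) (residual m≤n B φ) * weight A φ
          ≈⟨ R.trans (*-assoc _ _ _) (R.trans (*-congˡ (*-comm _ _)) (R.sym (*-assoc _ _ _))) ⟩
        pow z (numCycles φ) * weight A φ * b ⊙ cycRook z (l ∸ d) (residual m≤n B φ)
          ≈⟨ ⊙-*ˡ b _ _ ⟨
        b ⊙ (pow z (numCycles φ) * weight A φ * cycRook z (l ∸ d) (residual m≤n B φ)) ∎)

    -- This is the case `l = m`: the residual has `m - s` rows, so its rook number of order `m - s`
    -- is its cyclic permanent.
    cycPer-⊕ : cycPer z (A ⊕ B) ≈
      Σ (concatMap (λ s → concatMap (λ α → map (λ φ →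
        pow z (numCycles φ) * weight A φ * cycPer z (sub B (compl α) (phiBar m≤n α φ)))
        (injOn n (λ i → memᶠ i α))) (Q s m)) (upTo (suc m)))
    cycPer-⊕ = R.trans (cycRook-⊕ m) (R.trans (∑-injOn-memᶠ (suc m) m n _)
      (R.trans (∑-cong (allPMaps m n) λ φ → ⊙-cong (isInj φ) λ _ → ⊙-cong (size (dom φ) <ᵇ suc m) λ _ → *-congˡ
          (R.reflexive (cong (λ l → cycRook z l (residual m≤n B φ)) (sym (length-compl-elems (dom φ))))))
        (R.sym (∑-injOn-memᶠ (suc m) m n _))))

    cycR-⊕ : cycR x z (A ⊕ B) ≈
      Σ (concatMap (λ s → concatMap (λ α → map (λ φ →
        pow z (numCycles φ) * weight A φ * pow x s * cycR x z (sub B (compl α) (phiBar m≤n α φ)))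
        (injOn n (λ i → memᶠ i α))) (Q s m)) (upTo (suc m)))
    cycR-⊕ = R.trans (cycR-cycSum x z (A ⊕ B)) (expansion-term (suc m) m≤n z (pow x) A B
      (λ s α φ → pow z (numCycles φ) * weight A φ * pow x s * cycR x z (sub B (compl α) (phiBar m≤n α φ)))
      λ φ → let d = size (dom φ) in begin
        pow z (numCycles φ) * cycSum (λ t → pow x (d N.+ t)) z (residual m≤n B φ) * weight A φ
          ≈⟨ *-congʳ (*-congˡ (R.trans (injSum-cong (λ ψ _ → R.trans (*-congʳ (pow-+ x d (size (dom ψ)))) (*-assoc _ _ _)) (λ _ _ → R.refl)) (R.sym (injSum-*ˡ (pow x d) _ (residual m≤n B φ))))) ⟩
        pow z (numCycles φ) * (pow x d * cycSum (pow x) z (residual m≤n B φ)) * weight A φ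
          ≈⟨ R.trans (*-congʳ (R.sym (*-assoc _ _ _))) (R.trans (*-assoc _ _ _) (R.trans (*-congˡ (*-comm _ _))
               (R.trans (R.sym (*-assoc _ _ _)) (*-congʳ (R.trans (*-assoc _ _ _) (R.trans (*-congˡ (*-comm _ _)) (R.sym (*-assoc _ _ _)))))))) ⟩
        pow z (numCycles φ) * weight A φ * pow x d * cycSum (pow x) z (residual m≤n B φ)
          ≈⟨ *-congˡ (cycR-cycSum x z (residual m≤n B φ)) ⟨
        pow z (numCycles φ) * weight A φ * pow x d * cycR x z (residual m≤n B φ)
          ≈⟨ ⊙-≡ {b' = true} (<ᵇ-true (s≤s (size≤ (dom φ)))) ⟨
        (d <ᵇ suc m) ⊙ (pow z (numCycles φ) * weight A φ * pow x d * cycR x z (residual m≤n B φ)) ∎)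

-- The ordinary identities

-- Sublists with their complements stand in for index sets, which turns Laplace expansions into
-- inductions on lists without arithmetic on `Fin`.
picks : {A : Set} → List A → List (A × List A)
picks []       = []
picks (x ∷ xs) = (x , xs) ∷ map (λ (y , ys) → y , x ∷ ys) (picks xs)

splits : {A : Set} → List A → List (List A × List A)
splits []       = ([] , []) ∷ []
splits (x ∷ xs) = concatMap (λ (ys , zs) → (x ∷ ys , zs) ∷ (ys , x ∷ zs) ∷ []) (splits xs)

length-removeAt-∷ : ∀ {A : Set} x (xs : List A) j → length xs ≡ length (L.removeAt (x ∷ xs) j)
length-removeAt-∷ x xs j = sym (List.length-removeAt (x ∷ xs) j)

lookup-removeAt : ∀ {A : Set} x (xs : List A) j b →
  L.lookup (x ∷ xs) (punchIn j b) ≡ L.lookup (L.removeAt (x ∷ xs) j) (Fin.cast (length-removeAt-∷ x xs j) b)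
lookup-removeAt x xs       zero    b       = cong (L.lookup xs) (sym (FinP.cast-is-id refl b))
lookup-removeAt x (y ∷ xs) (suc j) zero    = refl
lookup-removeAt x (y ∷ xs) (suc j) (suc b) = lookup-removeAt y xs j b

module Ordinary {c ℓ : Level} (CR : CommutativeRing c ℓ) where
  open CommutativeRing CR hiding (refl; sym; trans; zero)
  open Rook CR
  open Sums CR
  open Weights CR
  open CyclicExpansion CR
  open import Relation.Binary.Reasoning.Setoid setoid

  ∑ᵖ : {A : Set} → List A → (A → List A → Carrier) → Carrier
  ∑ᵖ xs f = ∑[ p ∈ picks xs ] f (proj₁ p) (proj₂ p)

  ∑ˢ : {A : Set} → List A → (List A → List A → Carrier) → Carrier
  ∑ˢ xs f = ∑[ p ∈ splits xs ] f (proj₁ p) (proj₂ p)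

  module _ {A : Set} where
    ∑ᵖ-∷ : ∀ x (xs : List A) f → ∑ᵖ (x ∷ xs) f ≈ f x xs + ∑ᵖ xs (λ y ys → f y (x ∷ ys))
    ∑ᵖ-∷ x xs f = R.trans (∑-∷ _ _ _) (+-congˡ (∑-map _ (picks xs) _))

    ∑ˢ-∷ : ∀ x (xs : List A) f → ∑ˢ (x ∷ xs) f ≈ ∑ˢ xs (λ ys zs → f (x ∷ ys) zs + f ys (x ∷ zs))
    ∑ˢ-∷ x xs f = R.trans (∑-concatMap (λ (ys , zs) → (x ∷ ys , zs) ∷ (ys , x ∷ zs) ∷ []) (splits xs) _)
      (∑-cong (splits xs) λ _ → R.trans (∑-∷ _ _ _) (+-congˡ (∑-singleton _ _)))

    ∑ˢ-[] : ∀ (f : List A → List A → Carrier) → ∑ˢ [] f ≈ f [] []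
    ∑ˢ-[] f = ∑-singleton _ _

    ∑ᵖ-cong-length : ∀ (xs : List A) {f g : A → List A → Carrier} →
      (∀ y ys → length xs ≡ suc (length ys) → f y ys ≈ g y ys) → ∑ᵖ xs f ≈ ∑ᵖ xs g
    ∑ᵖ-cong-length []       h = R.trans (∑-[] _) (R.sym (∑-[] _))
    ∑ᵖ-cong-length (x ∷ xs) h = R.trans (∑ᵖ-∷ x xs _) (R.trans
      (+-cong (h x xs refl) (∑ᵖ-cong-length xs λ y ys e → h y (x ∷ ys) (cong suc e))) (R.sym (∑ᵖ-∷ x xs _)))

    ∑ˢ-cong-length : ∀ (xs : List A) {f g : List A → List A → Carrier} →
      (∀ ys zs → length xs ≡ length ys N.+ length zs → f ys zs ≈ g ys zs) → ∑ˢ xs f ≈ ∑ˢ xs g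
    ∑ˢ-cong-length []       h = R.trans (∑ˢ-[] _) (R.trans (h [] [] refl) (R.sym (∑ˢ-[] _)))
    ∑ˢ-cong-length (x ∷ xs) h = R.trans (∑ˢ-∷ x xs _) (R.trans
      (∑ˢ-cong-length xs λ ys zs e → +-cong (h (x ∷ ys) zs (cong suc e)) (h ys (x ∷ zs) (trans (cong suc e) (sym (ℕ.+-suc (length ys) (length zs))))))
      (R.sym (∑ˢ-∷ x xs _)))

    ∑ᵖ-cong : ∀ (xs : List A) {f g : A → List A → Carrier} → (∀ y ys → f y ys ≈ g y ys) → ∑ᵖ xs f ≈ ∑ᵖ xs g
    ∑ᵖ-cong xs h = ∑-cong (picks xs) λ _ → h _ _

    ∑ˢ-cong : ∀ (xs : List A) {f g : List A → List A → Carrier} → (∀ ys zs → f ys zs ≈ g ys zs) → ∑ˢ xs f ≈ ∑ˢ xs g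
    ∑ˢ-cong xs h = ∑-cong (splits xs) λ _ → h _ _

    ∑ˢ-comm : ∀ (xs : List A) f → ∑ˢ xs f ≈ ∑ˢ xs (λ ys zs → f zs ys)
    ∑ˢ-comm []       f = R.trans (∑ˢ-[] f) (R.sym (∑ˢ-[] (λ ys zs → f zs ys)))
    ∑ˢ-comm (x ∷ xs) f = R.trans (∑ˢ-∷ x xs f) (R.trans
      (R.trans (∑ˢ-comm xs _) (∑ˢ-cong xs λ _ _ → +-comm _ _)) (R.sym (∑ˢ-∷ x xs (λ ys zs → f zs ys))))

    -- The head is either the picked element or joins one of the two parts of the split; the last
    -- two cases are absorbed into `f`.
    ∑ˢ-∑ᵖˡ : ∀ (xs : List A) (f : A → List A → List A → Carrier) →
      ∑ˢ xs (λ ys zs → ∑ᵖ ys (λ y ys' → f y ys' zs)) ≈ ∑ᵖ xs (λ y xs' → ∑ˢ xs' (λ ys zs → f y ys zs))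
    ∑ˢ-∑ᵖˡ []       f = R.trans (∑ˢ-[] _) (R.trans (∑-[] _) (R.sym (∑-[] _)))
    ∑ˢ-∑ᵖˡ (x ∷ xs) f = begin
      ∑ˢ (x ∷ xs) (λ ys zs → ∑ᵖ ys (λ y ys' → f y ys' zs))
        ≈⟨ ∑ˢ-∷ x xs _ ⟩
      ∑ˢ xs (λ ys zs → ∑ᵖ (x ∷ ys) (λ y ys' → f y ys' zs) + ∑ᵖ ys (λ y ys' → f y ys' (x ∷ zs)))
        ≈⟨ ∑ˢ-cong xs (λ ys zs → R.trans (+-congʳ (∑ᵖ-∷ x ys _)) (R.trans (+-assoc _ _ _) (+-congˡ (R.sym (∑-+ (picks ys) _ _))))) ⟩
      ∑ˢ xs (λ ys zs → f x ys zs + ∑ᵖ ys (λ y ys' → f y (x ∷ ys') zs + f y ys' (x ∷ zs)))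
        ≈⟨ ∑-+ (splits xs) _ _ ⟩
      ∑ˢ xs (f x) + ∑ˢ xs (λ ys zs → ∑ᵖ ys (λ y ys' → f y (x ∷ ys') zs + f y ys' (x ∷ zs)))
        ≈⟨ +-congˡ (∑ˢ-∑ᵖˡ xs (λ y ys zs → f y (x ∷ ys) zs + f y ys (x ∷ zs))) ⟩
      ∑ˢ xs (f x) + ∑ᵖ xs (λ y xs' → ∑ˢ xs' (λ ys zs → f y (x ∷ ys) zs + f y ys (x ∷ zs)))
        ≈⟨ +-congˡ (∑ᵖ-cong xs λ y xs' → ∑ˢ-∷ x xs' (f y)) ⟨
      ∑ˢ xs (f x) + ∑ᵖ xs (λ y xs' → ∑ˢ (x ∷ xs') (f y))
        ≈⟨ ∑ᵖ-∷ x xs _ ⟨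
      ∑ᵖ (x ∷ xs) (λ y xs' → ∑ˢ xs' (f y)) ∎

    ∑ˢ-∑ᵖʳ : ∀ (xs : List A) (f : A → List A → List A → Carrier) →
      ∑ˢ xs (λ ys zs → ∑ᵖ zs (λ z zs' → f z ys zs')) ≈ ∑ᵖ xs (λ z xs' → ∑ˢ xs' (λ ys zs → f z ys zs))
    ∑ˢ-∑ᵖʳ xs f = R.trans (∑ˢ-comm xs _) (R.trans (∑ˢ-∑ᵖˡ xs (λ y ys zs → f y zs ys)) (∑ᵖ-cong xs λ y xs' → ∑ˢ-comm xs' _))

    -- Both sides distribute the elements over three lists. The head has three places to go, and
    -- their sum becomes the new `f`.
    ∑ˢ-assoc : ∀ (xs : List A) (f : List A → List A → List A → Carrier) →
      ∑ˢ xs (λ us ws → ∑ˢ us (λ ys zs → f ys zs ws)) ≈ ∑ˢ xs (λ ys vs → ∑ˢ vs (λ zs ws → f ys zs ws))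
    ∑ˢ-assoc []       f = R.trans (R.trans (∑ˢ-[] _) (∑ˢ-[] _)) (R.sym (R.trans (∑ˢ-[] _) (∑ˢ-[] _)))
    ∑ˢ-assoc (x ∷ xs) f = begin
      ∑ˢ (x ∷ xs) (λ us ws → ∑ˢ us (λ ys zs → f ys zs ws))
        ≈⟨ ∑ˢ-∷ x xs _ ⟩
      ∑ˢ xs (λ us ws → ∑ˢ (x ∷ us) (λ ys zs → f ys zs ws) + ∑ˢ us (λ ys zs → f ys zs (x ∷ ws)))
        ≈⟨ ∑ˢ-cong xs (λ us ws → R.trans (+-congʳ (∑ˢ-∷ x us _)) (R.trans (R.sym (∑-+ (splits us) _ _)) (∑ˢ-cong us λ _ _ → +-assoc _ _ _))) ⟩
      ∑ˢ xs (λ us ws → ∑ˢ us (λ ys zs → f (x ∷ ys) zs ws + (f ys (x ∷ zs) ws + f ys zs (x ∷ ws))))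
        ≈⟨ ∑ˢ-assoc xs (λ ys zs ws → f (x ∷ ys) zs ws + (f ys (x ∷ zs) ws + f ys zs (x ∷ ws))) ⟩
      ∑ˢ xs (λ ys vs → ∑ˢ vs (λ zs ws → f (x ∷ ys) zs ws + (f ys (x ∷ zs) ws + f ys zs (x ∷ ws))))
        ≈⟨ ∑ˢ-cong xs (λ ys vs → R.trans (∑-+ (splits vs) _ _) (+-congˡ (R.sym (∑ˢ-∷ x vs _)))) ⟩
      ∑ˢ xs (λ ys vs → ∑ˢ vs (f (x ∷ ys)) + ∑ˢ (x ∷ vs) (f ys))
        ≈⟨ ∑ˢ-∷ x xs _ ⟨
      ∑ˢ (x ∷ xs) (λ ys vs → ∑ˢ vs (f ys)) ∎

    -- Translates the column index of a Laplace expansion into `picks`.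
    ∑-removeAt : ∀ (xs : List A) (f : A → List A → Carrier) →
      ∑[ j ∈ allFin (length xs) ] f (L.lookup xs j) (L.removeAt xs j) ≈ ∑ᵖ xs f
    ∑-removeAt []       f = R.trans (∑-[] _) (R.sym (∑-[] _))
    ∑-removeAt (x ∷ xs) f = R.trans (∑-allFin-suc (length xs) _) (R.trans (+-congˡ (∑-removeAt xs (λ y ys → f y (x ∷ ys)))) (R.sym (∑ᵖ-∷ x xs f)))

  ∑ᵖ-map : ∀ {A B : Set} (g : A → B) xs f → ∑ᵖ (map g xs) f ≈ ∑ᵖ xs (λ y ys → f (g y) (map g ys))
  ∑ᵖ-map g []       f = R.trans (∑-[] _) (R.sym (∑-[] _))
  ∑ᵖ-map g (x ∷ xs) f = R.trans (∑ᵖ-∷ (g x) (map g xs) f) (R.trans (+-congˡ (∑ᵖ-map g xs _)) (R.sym (∑ᵖ-∷ x xs _)))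

  -- `g` is general because the induction replaces it by `g ∘ suc`; later it is the identity or the
  -- lookup into a list of rows or columns.
  ∑-subsets-splits : ∀ {A : Set} p (g : Fin p → A) (f : List A → List A → Carrier) →
    ∑[ S ∈ allSubsets p ] f (map g (elems S)) (map g (elems (Vec.map not S))) ≈ ∑ˢ (map g (allFin p)) f
  ∑-subsets-splits zero    g f = R.trans (∑-singleton [] _) (R.sym (∑ˢ-[] f))
  ∑-subsets-splits (suc p) g f = begin
    ∑ (allSubsets (suc p)) (λ S → f (map g (elems S)) (map g (elems (Vec.map not S))))
      ≈⟨ ∑-subsets-∷ p _ ⟩
    ∑ (allSubsets p) (λ S → f (map g (elems (true ∷ S))) (map g (elems (false ∷ Vec.map not S))) + f (map g (elems (false ∷ S))) (map g (elems (true ∷ Vec.map not S))))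
      ≈⟨ ∑-cong (allSubsets p) (λ S → +-cong (R.reflexive (cong₂ f (on S) (off (Vec.map not S)))) (R.reflexive (cong₂ f (off S) (on (Vec.map not S))))) ⟩
    ∑ (allSubsets p) (λ S → F (map (g ∘ suc) (elems S)) (map (g ∘ suc) (elems (Vec.map not S))))
      ≈⟨ ∑-subsets-splits p (g ∘ suc) F ⟩
    ∑ˢ (map (g ∘ suc) (allFin p)) F
      ≈⟨ ∑ˢ-∷ (g zero) (map (g ∘ suc) (allFin p)) f ⟨
    ∑ˢ (g zero ∷ map (g ∘ suc) (allFin p)) f
      ≈⟨ R.reflexive (cong (λ xs → ∑ˢ xs f) (trans (cong (map g) (allFin-suc p)) (cong (g zero ∷_) (sym (List.map-∘ (allFin p)))))) ⟨
    ∑ˢ (map g (allFin (suc p))) f ∎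
    where
    F : _ → _ → Carrier
    F ys zs = f (g zero ∷ ys) zs + f ys (g zero ∷ zs)
    on : ∀ S → map g (elems (true ∷ S)) ≡ g zero ∷ map (g ∘ suc) (elems S)
    on S = trans (cong (map g) (elems-true S)) (cong (g zero ∷_) (sym (List.map-∘ (elems S))))
    off : ∀ S → map g (elems (false ∷ S)) ≡ map (g ∘ suc) (elems S)
    off S = trans (cong (map g) (elems-false S)) (sym (List.map-∘ (elems S)))

  -- `lax` sums over the injections of the rows into the columns, `strict` only over the bijections.
  module _ {p q} (C : Mat p q) where
    lax : List (Fin p) → List (Fin q) → Carrier
    lax []       cs = 1#
    lax (r ∷ rs) cs = ∑ᵖ cs (λ c γ → C r c * lax rs γ)

    strict : List (Fin p) → List (Fin q) → Carrier
    strict []       []       = 1#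
    strict []       (_ ∷ _)  = 0#
    strict (r ∷ rs) cs       = ∑ᵖ cs (λ c γ → C r c * strict rs γ)

    -- Every step uses one row and one column, so the initial lengths decide whether rows and
    -- columns run out together.
    strict-lax : ∀ rs cs → strict rs cs ≈ (length cs ≡ᵇ length rs) ⊙ lax rs cs
    strict-lax []       []       = R.refl
    strict-lax []       (c ∷ cs) = R.refl
    strict-lax (r ∷ rs) cs = R.trans (∑ᵖ-cong-length cs λ c γ e → R.trans (*-congˡ (strict-lax rs γ))
        (R.trans (R.sym (⊙-*ˡ (length γ ≡ᵇ length rs) _ _)) (⊙-≡ (cong (_≡ᵇ suc (length rs)) (sym e)))))
      (R.sym (∑-⊙ (picks cs) (length cs ≡ᵇ suc (length rs)) _))

    -- The injections are sorted by their image `β`.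
    lax-strict : ∀ rs cs → lax rs cs ≈ ∑ˢ cs (λ β _ → strict rs β)
    lax-strict []       []       = R.sym (∑ˢ-[] _)
    lax-strict []       (c ∷ cs) = R.trans (lax-strict [] cs) (R.trans (∑ˢ-cong cs λ _ _ → R.sym (+-identityˡ _)) (R.sym (∑ˢ-∷ c cs _)))
    lax-strict (r ∷ rs) cs = R.trans
      (∑ᵖ-cong cs λ c γ → R.trans (*-congˡ (lax-strict rs γ)) (∑-*ˡ (splits γ) (C r c) _))
      (R.sym (∑ˢ-∑ᵖˡ cs (λ c γ _ → C r c * strict rs γ)))

  module _ {p q} (A B : Mat p q) where
    -- The first row takes its entry from `A` or from `B`: it joins `α` and its column `β`, or it
    -- joins `ρ` and its column `γ`. `left` and `right` are these two cases.
    strict-⊕ : ∀ rs cs → strict (A ⊕ B) rs cs ≈ ∑ˢ rs (λ α ρ → ∑ˢ cs (λ β γ → strict A α β * strict B ρ γ))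
    strict-⊕ [] [] = R.sym (R.trans (∑ˢ-[] _) (R.trans (∑ˢ-[] _) (*-identityˡ _)))
    strict-⊕ [] (c ∷ cs) = R.sym (R.trans (∑ˢ-[] _) (R.trans (∑ˢ-∷ c cs _)
      (R.trans (∑ˢ-cong cs λ β γ → R.trans (+-cong (zeroˡ _) (zeroʳ _)) (+-identityˡ _)) (∑-zero (splits cs)))))
    strict-⊕ (r ∷ rs) cs = begin
      ∑ᵖ cs (λ c δ → (A r c + B r c) * strict (A ⊕ B) rs δ)
        ≈⟨ ∑ᵖ-cong cs (λ c δ → R.trans (*-congˡ (strict-⊕ rs δ)) (R.trans (∑-*ˡ (splits rs) _ _) (∑ˢ-cong rs λ α ρ → distribʳ _ _ _))) ⟩
      ∑ᵖ cs (λ c δ → ∑ˢ rs (λ α ρ → A r c * X α ρ δ + B r c * X α ρ δ))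
        ≈⟨ ∑-swap (picks cs) (splits rs) _ ⟩
      ∑ˢ rs (λ α ρ → ∑ᵖ cs (λ c δ → A r c * X α ρ δ + B r c * X α ρ δ))
        ≈⟨ ∑ˢ-cong rs (λ α ρ → R.trans (∑-+ (picks cs) _ _) (+-cong (left α ρ) (right α ρ))) ⟩
      ∑ˢ rs (λ α ρ → X (r ∷ α) ρ cs + X α (r ∷ ρ) cs)
        ≈⟨ ∑ˢ-∷ r rs _ ⟨
      ∑ˢ (r ∷ rs) (λ α ρ → X α ρ cs) ∎
      where
      X : List (Fin p) → List (Fin p) → List (Fin q) → Carrier
      X α ρ δ = ∑ˢ δ (λ β γ → strict A α β * strict B ρ γ)
      left : ∀ α ρ → ∑ᵖ cs (λ c δ → A r c * X α ρ δ) ≈ X (r ∷ α) ρ cs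
      left α ρ = R.trans (∑ᵖ-cong cs λ c δ → R.trans (∑-*ˡ (splits δ) _ _) (∑ˢ-cong δ λ β γ → R.sym (*-assoc _ _ _)))
        (R.trans (R.sym (∑ˢ-∑ᵖˡ cs (λ c β γ → A r c * strict A α β * strict B ρ γ)))
          (∑ˢ-cong cs λ β γ → R.sym (∑-*ʳ (picks β) _ _)))
      right : ∀ α ρ → ∑ᵖ cs (λ c δ → B r c * X α ρ δ) ≈ X α (r ∷ ρ) cs
      right α ρ = R.trans (∑ᵖ-cong cs λ c δ → R.trans (∑-*ˡ (splits δ) _ _) (∑ˢ-cong δ λ β γ → *-exchange _ _ _))
        (R.trans (R.sym (∑ˢ-∑ᵖʳ cs (λ c β γ → strict A α β * (B r c * strict B ρ γ))))
          (∑ˢ-cong cs λ β γ → R.sym (∑-*ˡ (picks γ) _ _)))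

    lax-⊕ : ∀ rs cs → lax (A ⊕ B) rs cs ≈ ∑ˢ rs (λ α ρ → ∑ˢ cs (λ β γ → strict A α β * lax B ρ γ))
    lax-⊕ rs cs = begin
      lax (A ⊕ B) rs cs
        ≈⟨ lax-strict (A ⊕ B) rs cs ⟩
      ∑ˢ cs (λ β _ → strict (A ⊕ B) rs β)
        ≈⟨ ∑ˢ-cong cs (λ β _ → strict-⊕ rs β) ⟩
      ∑ˢ cs (λ β _ → ∑ˢ rs (λ α ρ → ∑ˢ β (λ β₁ β₂ → strict A α β₁ * strict B ρ β₂)))
        ≈⟨ ∑-swap (splits cs) (splits rs) _ ⟩
      ∑ˢ rs (λ α ρ → ∑ˢ cs (λ β _ → ∑ˢ β (λ β₁ β₂ → strict A α β₁ * strict B ρ β₂)))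
        ≈⟨ ∑ˢ-cong rs (λ α ρ → R.trans (∑ˢ-assoc cs (λ β₁ β₂ _ → strict A α β₁ * strict B ρ β₂))
             (∑ˢ-cong cs λ β γ → R.trans (R.sym (∑-*ˡ (splits γ) _ _)) (*-congˡ (R.sym (lax-strict B ρ γ))))) ⟩
      ∑ˢ rs (λ α ρ → ∑ˢ cs (λ β γ → strict A α β * lax B ρ γ)) ∎

  -- The counterpart of `cycSum` for the ordinary rook numbers of C[rs|cs].
  ordSum : (ℕ → Carrier) → ∀ {p q} → Mat p q → List (Fin p) → List (Fin q) → Carrier
  ordSum h C rs cs = ∑ˢ rs (λ α _ → h (length α) * lax C α cs)

  -- The chosen rows are split into rows for `A` and rows for `B`. After reassociation the rows for
  -- `A` are chosen first, and what remains is a sum of the same kind for `B` with `h` shifted.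
  ordSum-⊕ : ∀ h {p q} (A B : Mat p q) rs cs →
    ordSum h (A ⊕ B) rs cs ≈ ∑ˢ rs (λ α ρ → ∑ˢ cs (λ β γ → strict A α β * ordSum (λ t → h (length α N.+ t)) B ρ γ))
  ordSum-⊕ h A B rs cs = begin
    ∑ˢ rs (λ α _ → h (length α) * lax (A ⊕ B) α cs)
      ≈⟨ ∑ˢ-cong rs (λ α _ → R.trans (*-congˡ (lax-⊕ A B α cs)) (R.trans (∑-*ˡ (splits α) _ _)
           (∑ˢ-cong-length α λ α₁ α₂ e → *-congʳ (R.reflexive (cong h e))))) ⟩
    ∑ˢ rs (λ α _ → ∑ˢ α (λ α₁ α₂ → h (length α₁ N.+ length α₂) * ∑ˢ cs (λ β γ → strict A α₁ β * lax B α₂ γ)))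
      ≈⟨ ∑ˢ-assoc rs (λ α₁ α₂ _ → h (length α₁ N.+ length α₂) * ∑ˢ cs (λ β γ → strict A α₁ β * lax B α₂ γ)) ⟩
    ∑ˢ rs (λ α ρ → ∑ˢ ρ (λ α₂ _ → h (length α N.+ length α₂) * ∑ˢ cs (λ β γ → strict A α β * lax B α₂ γ)))
      ≈⟨ ∑ˢ-cong rs (λ α ρ → R.trans (∑ˢ-cong ρ λ α₂ _ → R.trans (∑-*ˡ (splits cs) _ _) (∑ˢ-cong cs λ β γ → *-exchange _ _ _))
           (R.trans (∑-swap (splits ρ) (splits cs) _) (∑ˢ-cong cs λ β γ → R.sym (∑-*ˡ (splits ρ) _ _)))) ⟩
    ∑ˢ rs (λ α ρ → ∑ˢ cs (λ β γ → strict A α β * ordSum (λ t → h (length α N.+ t)) B ρ γ)) ∎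

  -- Ordinary permanents and rook numbers as sums over sublists

  full : ∀ {p q} → PMap p q → Bool
  full = domIs (λ _ → true)

  per-injSum : ∀ {p q} (C : Mat p q) → per C ≈ injSum (λ φ → full φ ⊙ 1#) C
  per-injSum {p} {q} C = R.trans (Σ-map (totalInj p q) (weight C)) (R.trans (∑-filter (λ φ → isInj φ ∧ full φ) (allPMaps p q) (weight C))
    (∑-cong (allPMaps p q) λ φ → R.trans (R.sym (⊙-∧ (isInj φ) (full φ)))
      (⊙-cong (isInj φ) λ _ → R.trans (⊙-cong (full φ) λ _ → R.sym (*-identityˡ _)) (⊙-*ʳ (full φ) _ _))))

  per-cong : ∀ {p q p' q'} {C : Mat p q} {D : Mat p' q'} → C ≋ D → per C ≈ per D
  per-cong {C = C} {D} s@(same refl refl _) = R.trans (per-injSum C)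
    (R.trans (injSum-cong {Θ = λ φ → full φ ⊙ 1#} (λ _ _ → R.refl) (≋-entries s)) (R.sym (per-injSum D)))

  full-∷ : ∀ {p q} x (φ : PMap p q) → full (x ∷ φ) ≡ is-just x ∧ full φ
  full-∷ nothing  φ = all-allFin-suc (λ i → is-just (lookup (nothing ∷ φ) i) ⇔ᵇ true)
  full-∷ (just j) φ = all-allFin-suc (λ i → is-just (lookup (just j ∷ φ) i) ⇔ᵇ true)

  full-map : ∀ {p q q'} (g : Fin q → Fin q') (φ : PMap p q) → full (Vec.map (Maybe.map g) φ) ≡ full φ
  full-map g []            = refl
  full-map g (nothing ∷ φ) = trans (full-∷ nothing (Vec.map (Maybe.map g) φ)) (sym (full-∷ nothing φ))
  full-map g (just j ∷ φ)  = trans (full-∷ (just (g j)) (Vec.map (Maybe.map g) φ)) (trans (full-map g φ) (sym (full-∷ (just j) φ)))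

  per-no-rows : ∀ {q} (C : Mat 0 q) → per C ≈ 1#
  per-no-rows C = R.trans (per-injSum C) (R.trans (∑-singleton [] _) (*-identityˡ _))

  per-no-columns : ∀ {p} (C : Mat (suc p) 0) → per C ≈ 0#
  per-no-columns {p} C = R.trans (per-injSum C) (R.trans (∑-PMaps-∷ p 0 _)
    (R.trans (∑-cong (allPMaps p 0) λ v → R.trans (∑-singleton nothing _)
      (R.trans (⊙-cong (isInj (nothing ∷ v)) λ _ → zeroˡ _) (⊙-0 (isInj (nothing ∷ v)))))
      (∑-zero (allPMaps p 0))))

  per-row : ∀ {p q} (C : Mat (suc p) (suc q)) →
    per C ≈ ∑[ j ∈ allFin (suc q) ] (C zero j * per (λ i b → C (suc i) (punchIn j b)))
  per-row {p} {q} C = begin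
    per C
      ≈⟨ per-injSum C ⟩
    injSum (λ φ → full φ ⊙ 1#) C
      ≈⟨ injSum-row zero (λ j → j) (λ φ → full φ ⊙ 1#) C ⟩
    injSum (λ v → full (nothing ∷ v) ⊙ 1#) (omit zero C) + ∑ (allFin (suc q)) (λ j → C zero j * injSum (λ φ → full (expand zero j j φ) ⊙ 1#) (contract zero j j C))
      ≈⟨ +-cong (injSum-0 _ (omit zero C) λ _ → R.refl) (∑-cong (allFin (suc q)) λ j → *-congˡ (minor j)) ⟩
    0# + ∑ (allFin (suc q)) (λ j → C zero j * per (λ i b → C (suc i) (punchIn j b)))
      ≈⟨ +-identityˡ _ ⟩
    ∑ (allFin (suc q)) (λ j → C zero j * per (λ i b → C (suc i) (punchIn j b))) ∎
    where
    redirect-self : ∀ j b → redirectᶠ j j b ≡ punchIn j b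
    redirect-self j b rewrite punchIn≟ j b = refl
    minor : ∀ j → injSum (λ φ → full (expand zero j j φ) ⊙ 1#) (contract zero j j C) ≈ per (λ i b → C (suc i) (punchIn j b))
    minor j = R.trans
      (injSum-cong (λ φ _ → ⊙-≡ (trans (full-∷ (just j) (Vec.map (Maybe.map (redirectᶠ j j)) φ)) (full-map (redirectᶠ j j) φ))) (λ i b → R.reflexive (cong (C (suc i)) (redirect-self j b))))
      (R.sym (per-injSum _))

  per-sub : ∀ {p q} (C : Mat p q) rs cs → per (sub C rs cs) ≈ lax C rs cs
  per-sub C []       cs       = per-no-rows (sub C [] cs)
  per-sub C (r ∷ rs) []       = R.trans (per-no-columns (sub C (r ∷ rs) [])) (R.sym (∑-[] _))
  per-sub C (r ∷ rs) (c ∷ cs) = R.trans (per-row (sub C (r ∷ rs) (c ∷ cs)))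
    (R.trans (∑-cong (allFin (suc (length cs))) λ j → *-congˡ (R.trans (per-cong (minor j)) (per-sub C rs (L.removeAt (c ∷ cs) j))))
      (∑-removeAt (c ∷ cs) (λ c γ → C r c * lax C rs γ)))
    where
    minor : ∀ j → (λ i b → sub C (r ∷ rs) (c ∷ cs) (suc i) (punchIn j b)) ≋ sub C rs (L.removeAt (c ∷ cs) j)
    minor j = same refl (length-removeAt-∷ c cs j) λ i b → R.reflexive (cong₂ C (cong (L.lookup rs) (sym (FinP.cast-is-id refl i))) (lookup-removeAt c cs j b))

  lax-map : ∀ {p q p' q'} (C : Mat p q) (f : Fin p' → Fin p) (g : Fin q' → Fin q) rs cs →
    lax C (map f rs) (map g cs) ≈ lax (λ i j → C (f i) (g j)) rs cs
  lax-map C f g []       cs = R.refl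
  lax-map C f g (r ∷ rs) cs = R.trans (∑ᵖ-map g cs _) (∑ᵖ-cong cs λ c γ → *-congˡ (lax-map C f g rs γ))

  length-map-elems : ∀ {A : Set} {p} (g : Fin p → A) (S : Vec Bool p) → size S ≡ length (map g (elems S))
  length-map-elems g S = sym (trans (List.length-map g (elems S)) (length-elems S))

  module _ {p q p' q'} (C : Mat p q) (f : Fin p' → Fin p) (g : Fin q' → Fin q) where
    -- For fixed `α`, the permanents over all column sets of the same size add up to the injections
    -- sorted by image, which is `lax`. `f` and `g` let one statement serve a whole matrix and its
    -- submatrices.
    rook-ordSum : ∀ l → rook l (λ i j → C (f i) (g j)) ≈ ordSum (δ l) C (map f (allFin p')) (map g (allFin q'))
    rook-ordSum l = begin
      Σ (concatMap (λ α → map (λ β → per (sub D α β)) (Q l q')) (Q l p'))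
        ≈⟨ R.trans (Σ-concatMap _ (Q l p')) (∑-cong (Q l p') λ α → Σ-map (Q l q') _) ⟩
      ∑ (Q l p') (λ α → ∑ (Q l q') (λ β → per (sub D α β)))
        ≈⟨ ∑-Q l p' _ ⟩
      ∑ (allSubsets p') (λ S → (size S ≡ᵇ l) ⊙ ∑ (Q l q') (λ β → per (sub D (elems S) β)))
        ≈⟨ ∑-cong (allSubsets p') (λ S → R.trans (⊙-cong (size S ≡ᵇ l) λ _ → columns (elems S)) (⊙-≡ (cong (_≡ᵇ l) (length-map-elems f S)))) ⟩
      ∑ (allSubsets p') (λ S → X (map f (elems S)))
        ≈⟨ ∑-subsets-splits p' f (λ α _ → X α) ⟩
      ∑ˢ (map f (allFin p')) (λ α _ → X α)
        ≈⟨ ∑ˢ-cong (map f (allFin p')) (λ α _ → row α) ⟩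
      ordSum (δ l) C (map f (allFin p')) (map g (allFin q')) ∎
      where
      D : Mat p' q'
      D i j = C (f i) (g j)
      X : List (Fin p) → Carrier
      X α = (length α ≡ᵇ l) ⊙ ∑ˢ (map g (allFin q')) (λ β _ → (length β ≡ᵇ l) ⊙ lax C α β)
      columns : ∀ α → ∑ (Q l q') (λ β → per (sub D α β)) ≈ ∑ˢ (map g (allFin q')) (λ β _ → (length β ≡ᵇ l) ⊙ lax C (map f α) β)
      columns α = R.trans (∑-Q l q' _) (R.trans
        (∑-cong (allSubsets q') λ T → R.trans (⊙-≡ (cong (_≡ᵇ l) (length-map-elems g T)))
          (⊙-cong (length (map g (elems T)) ≡ᵇ l) λ _ → R.trans (per-sub D α (elems T)) (R.sym (lax-map C f g α (elems T)))))
        (∑-subsets-splits q' g (λ β _ → (length β ≡ᵇ l) ⊙ lax C (map f α) β)))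
      row : ∀ α → X α ≈ δ l (length α) * lax C α (map g (allFin q'))
      row α = R.trans (⊙-cong (length α ≡ᵇ l) λ e → R.trans
          (∑ˢ-cong (map g (allFin q')) λ β _ → R.trans (⊙-≡ (cong (length β ≡ᵇ_) (sym (≡ᵇ⇒≡ {length α} {l} e)))) (R.sym (strict-lax C α β)))
          (R.trans (R.sym (lax-strict C α (map g (allFin q')))) (R.sym (*-identityˡ _))))
        (⊙-*ʳ (length α ≡ᵇ l) _ _)

    rookR-ordSum : ∀ x → rookR x (λ i j → C (f i) (g j)) ≈ ordSum (pow x) C (map f (allFin p')) (map g (allFin q'))
    rookR-ordSum x = begin
      rookR x (λ i j → C (f i) (g j))
        ≈⟨ Σ-map (upTo (suc p')) _ ⟩
      ∑ (upTo (suc p')) (λ l → rook l (λ i j → C (f i) (g j)) * pow x l)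
        ≈⟨ ∑-cong (upTo (suc p')) (λ l → R.trans (*-congʳ (rook-ordSum l)) (R.trans (∑-*ʳ (splits rs) _ _)
             (∑ˢ-cong rs λ α _ → R.trans (*-assoc _ _ _) (R.trans (*-congˡ (*-comm _ _)) (R.sym (*-assoc _ _ _)))))) ⟩
      ∑ (upTo (suc p')) (λ l → ∑ˢ rs (λ α _ → δ l (length α) * pow x l * lax C α cs))
        ≈⟨ ∑-swap (upTo (suc p')) (splits rs) _ ⟩
      ∑ˢ rs (λ α _ → ∑ (upTo (suc p')) (λ l → δ l (length α) * pow x l * lax C α cs))
        ≈⟨ ∑ˢ-cong-length rs (λ α ρ e → R.trans (R.sym (∑-*ʳ (upTo (suc p')) _ _)) (*-congʳ (δ-sum x (bound α ρ e)))) ⟩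
      ordSum (pow x) C rs cs ∎
      where
      rs = map f (allFin p')
      cs = map g (allFin q')
      bound : ∀ α ρ → length rs ≡ length α N.+ length ρ → length α ≤ p'
      bound α ρ e = subst (length α ≤_) (trans (sym e) (trans (List.length-map f (allFin p')) (List.length-tabulate {n = p'} (λ i → i)))) (ℕ.m≤m+n (length α) (length ρ))

  map-lookup-allFin : ∀ {A : Set} (xs : List A) → map (L.lookup xs) (allFin (length xs)) ≡ xs
  map-lookup-allFin xs = trans (List.map-tabulate (λ i → i) (L.lookup xs)) (List.tabulate-lookup xs)

  rook-sub : ∀ l {p q} (C : Mat p q) rs cs → rook l (sub C rs cs) ≈ ordSum (δ l) C rs cs
  rook-sub l C rs cs = R.trans (rook-ordSum C (L.lookup rs) (L.lookup cs) l) (R.reflexive (cong₂ (ordSum (δ l) C) (map-lookup-allFin rs) (map-lookup-allFin cs)))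

  rookR-sub : ∀ x {p q} (C : Mat p q) rs cs → rookR x (sub C rs cs) ≈ ordSum (pow x) C rs cs
  rookR-sub x C rs cs = R.trans (rookR-ordSum C (L.lookup rs) (L.lookup cs) x) (R.reflexive (cong₂ (ordSum (pow x) C) (map-lookup-allFin rs) (map-lookup-allFin cs)))

  rook-allFin : ∀ l {p q} (C : Mat p q) → rook l C ≈ ordSum (δ l) C (allFin p) (allFin q)
  rook-allFin l {p} {q} C = R.trans (rook-ordSum C (λ i → i) (λ j → j) l) (R.reflexive (cong₂ (ordSum (δ l) C) (List.map-id (allFin p)) (List.map-id (allFin q))))

  rookR-allFin : ∀ x {p q} (C : Mat p q) → rookR x C ≈ ordSum (pow x) C (allFin p) (allFin q)
  rookR-allFin x {p} {q} C = R.trans (rookR-ordSum C (λ i → i) (λ j → j) x) (R.reflexive (cong₂ (ordSum (pow x) C) (List.map-id (allFin p)) (List.map-id (allFin q))))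

  ∑-subsets-splits-id : ∀ p (f : List (Fin p) → List (Fin p) → Carrier) →
    ∑[ S ∈ allSubsets p ] f (elems S) (compl (elems S)) ≈ ∑ˢ (allFin p) f
  ∑-subsets-splits-id p f = R.trans
    (∑-cong (allSubsets p) λ S → R.reflexive (cong₂ f (sym (List.map-id (elems S))) (trans (compl-elems-not S) (sym (List.map-id _)))))
    (R.trans (∑-subsets-splits p (λ i → i) f) (R.reflexive (cong (λ xs → ∑ˢ xs f) (List.map-id (allFin p)))))

  -- Asking `β` to have as many elements as `α` turns the permanent of the block into `strict`, so
  -- the columns may range over all splits. `Y` is the factor that comes from `B`, left open for the
  -- three identities.
  ∑-minors : ∀ N {m n} (A : Mat m n) (F : ℕ → List (Fin m) → List (Fin n) → Carrier) (Y : ℕ → List (Fin m) → List (Fin n) → Carrier) →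
    (∀ s α β → F s α β ≈ per (sub A α β) * Y s (compl α) (compl β)) →
    Σ (concatMap (λ s → concatMap (λ α → map (λ β → F s α β) (Q s n)) (Q s m)) (upTo N))
      ≈ ∑ˢ (allFin m) (λ α ρ → ∑ˢ (allFin n) (λ β γ → strict A α β * (length α <ᵇ N) ⊙ Y (length α) ρ γ))
  ∑-minors N {m} {n} A F Y e = begin
    Σ (concatMap (λ s → concatMap (λ α → map (F s α) (Q s n)) (Q s m)) (upTo N))
      ≈⟨ R.trans (Σ-concatMap _ (upTo N)) (∑-cong (upTo N) λ s → R.trans (Σ-concatMap _ (Q s m)) (∑-cong (Q s m) λ α → R.trans (Σ-map (Q s n) _) (∑-cong (Q s n) (e s α)))) ⟩
    ∑ (upTo N) (λ s → ∑ (Q s m) (λ α → ∑ (Q s n) (λ β → per (sub A α β) * Y s (compl α) (compl β))))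
      ≈⟨ ∑-upTo-Q N m _ ⟩
    ∑ (allSubsets m) (λ S → (size S <ᵇ N) ⊙ ∑ (Q (size S) n) (λ β → per (sub A (elems S) β) * Y (size S) (compl (elems S)) (compl β)))
      ≈⟨ ∑-cong (allSubsets m) (λ S → R.trans (⊙-cong (size S <ᵇ N) λ _ → columns S) (R.trans (⊙-≡ (cong (_<ᵇ N) (sym (length-elems S))))
           (R.trans (∑-⊙ (splits (allFin n)) (length (elems S) <ᵇ N) _) (∑ˢ-cong (allFin n) λ β γ → ⊙-*ˡ (length (elems S) <ᵇ N) _ _)))) ⟩
    ∑ (allSubsets m) (λ S → ∑ˢ (allFin n) (λ β γ → strict A (elems S) β * (length (elems S) <ᵇ N) ⊙ Y (length (elems S)) (compl (elems S)) γ))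
      ≈⟨ ∑-subsets-splits-id m _ ⟩
    ∑ˢ (allFin m) (λ α ρ → ∑ˢ (allFin n) (λ β γ → strict A α β * (length α <ᵇ N) ⊙ Y (length α) ρ γ)) ∎
    where
    columns : ∀ S → ∑ (Q (size S) n) (λ β → per (sub A (elems S) β) * Y (size S) (compl (elems S)) (compl β))
      ≈ ∑ˢ (allFin n) (λ β γ → strict A (elems S) β * Y (length (elems S)) (compl (elems S)) γ)
    columns S rewrite sym (length-elems S) = R.trans (∑-Q (length (elems S)) n _) (R.trans
      (∑-cong (allSubsets n) λ T → R.trans (⊙-*ʳ (size T ≡ᵇ length (elems S)) _ _) (*-congʳ (R.trans
        (⊙-cong (size T ≡ᵇ length (elems S)) λ _ → per-sub A (elems S) (elems T))
        (R.trans (⊙-≡ (cong (_≡ᵇ length (elems S)) (sym (length-elems T)))) (R.sym (strict-lax A (elems S) (elems T)))))))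
      (∑-subsets-splits-id n (λ β γ → strict A (elems S) β * Y (length (elems S)) (compl (elems S)) γ)))

  ordSum-shift : ∀ d l {p q} (C : Mat p q) rs cs →
    ordSum (λ t → δ l (d N.+ t)) C rs cs ≈ (d <ᵇ suc l) ⊙ ordSum (δ (l ∸ d)) C rs cs
  ordSum-shift zero    l       C rs cs = R.refl
  ordSum-shift (suc d) zero    C rs cs = R.trans (∑ˢ-cong rs λ _ _ → zeroˡ _) (∑-zero (splits rs))
  ordSum-shift (suc d) (suc l) C rs cs = ordSum-shift d l C rs cs

  ∑ˢ-length≤ : ∀ m {f g : List (Fin m) → List (Fin m) → Carrier} → (∀ α ρ → length α ≤ m → f α ρ ≈ g α ρ) →
    ∑ˢ (allFin m) f ≈ ∑ˢ (allFin m) g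
  ∑ˢ-length≤ m h = ∑ˢ-cong-length (allFin m) λ α ρ e → h α ρ
    (subst (length α ≤_) (trans (sym e) (List.length-tabulate {n = m} (λ i → i))) (ℕ.m≤m+n (length α) (length ρ)))

  module _ {m n} (A B : Mat m n) (x : Carrier) where
    rook-⊕ : ∀ l → rook l (A ⊕ B) ≈
      Σ (concatMap (λ s → concatMap (λ α → map (λ β →
        per (sub A α β) * rook (l ∸ s) (sub B (compl α) (compl β)))
        (Q s n)) (Q s m)) (upTo (suc l)))
    rook-⊕ l = begin
      rook l (A ⊕ B)
        ≈⟨ R.trans (rook-allFin l (A ⊕ B)) (ordSum-⊕ (δ l) A B (allFin m) (allFin n)) ⟩
      ∑ˢ (allFin m) (λ α ρ → ∑ˢ (allFin n) (λ β γ → strict A α β * ordSum (λ t → δ l (length α N.+ t)) B ρ γ))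
        ≈⟨ ∑ˢ-cong (allFin m) (λ α ρ → ∑ˢ-cong (allFin n) λ β γ → *-congˡ (ordSum-shift (length α) l B ρ γ)) ⟩
      ∑ˢ (allFin m) (λ α ρ → ∑ˢ (allFin n) (λ β γ → strict A α β * (length α <ᵇ suc l) ⊙ ordSum (δ (l ∸ length α)) B ρ γ))
        ≈⟨ ∑-minors (suc l) A _ (λ s → ordSum (δ (l ∸ s)) B) (λ s α β → *-congˡ (rook-sub (l ∸ s) B (compl α) (compl β))) ⟨
      _ ∎

    rookR-⊕ : rookR x (A ⊕ B) ≈
      Σ (concatMap (λ s → concatMap (λ α → map (λ β →
        per (sub A α β) * pow x s * rookR x (sub B (compl α) (compl β)))
        (Q s n)) (Q s m)) (upTo (suc m)))
    rookR-⊕ = begin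
      rookR x (A ⊕ B)
        ≈⟨ R.trans (rookR-allFin x (A ⊕ B)) (ordSum-⊕ (pow x) A B (allFin m) (allFin n)) ⟩
      ∑ˢ (allFin m) (λ α ρ → ∑ˢ (allFin n) (λ β γ → strict A α β * ordSum (λ t → pow x (length α N.+ t)) B ρ γ))
        ≈⟨ ∑ˢ-length≤ m (λ α ρ le → ∑ˢ-cong (allFin n) λ β γ → *-congˡ (R.trans
             (R.trans (∑ˢ-cong ρ λ α₂ _ → R.trans (*-congʳ (pow-+ x (length α) (length α₂))) (*-assoc _ _ _)) (R.sym (∑-*ˡ (splits ρ) _ _)))
             (R.sym (⊙-≡ {b' = true} (<ᵇ-true (s≤s le)))))) ⟩
      ∑ˢ (allFin m) (λ α ρ → ∑ˢ (allFin n) (λ β γ → strict A α β * (length α <ᵇ suc m) ⊙ (pow x (length α) * ordSum (pow x) B ρ γ)))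
        ≈⟨ ∑-minors (suc m) A _ (λ s ρ γ → pow x s * ordSum (pow x) B ρ γ) (λ s α β → R.trans (*-assoc _ _ _) (*-congˡ (*-congˡ (rookR-sub x B (compl α) (compl β))))) ⟨
      _ ∎

    per-⊕ : per (A ⊕ B) ≈
      Σ (concatMap (λ s → concatMap (λ α → map (λ β →
        per (sub A α β) * per (sub B (compl α) (compl β)))
        (Q s n)) (Q s m)) (upTo (suc m)))
    per-⊕ = begin
      per (A ⊕ B)
        ≈⟨ per-cong (sub-allFin (A ⊕ B)) ⟨
      per (sub (A ⊕ B) (allFin m) (allFin n))
        ≈⟨ R.trans (per-sub (A ⊕ B) (allFin m) (allFin n)) (lax-⊕ A B (allFin m) (allFin n)) ⟩
      ∑ˢ (allFin m) (λ α ρ → ∑ˢ (allFin n) (λ β γ → strict A α β * lax B ρ γ))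
        ≈⟨ ∑ˢ-length≤ m (λ α ρ le → ∑ˢ-cong (allFin n) λ β γ → *-congˡ (R.sym (⊙-≡ {b' = true} (<ᵇ-true (s≤s le))))) ⟩
      ∑ˢ (allFin m) (λ α ρ → ∑ˢ (allFin n) (λ β γ → strict A α β * (length α <ᵇ suc m) ⊙ lax B ρ γ))
        ≈⟨ ∑-minors (suc m) A _ (λ _ → lax B) (λ s α β → *-congˡ (per-sub B (compl α) (compl β))) ⟨
      _ ∎

theorem5 : ∀ {c ℓ : Level} (CR : CommutativeRing c ℓ) →
  let open CommutativeRing CR
      open Rook CR
  in ∀ (m n : ℕ) (m≤n : m ≤ n) (A B : Mat m n) (x z : Carrier) →
    -- R(x;z;A+B)
    (cycR x z (A ⊕ B) ≈
      Σ (concatMap (λ s → concatMap (λ α → map (λ φ →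
            pow z (numCycles φ) * weight A φ * pow x s
              * cycR x z (sub B (compl α) (phiBar m≤n α φ)))
          (injOn n (λ i → memᶠ i α))) (Q s m)) (upTo (suc m))))
    -- r_l(z;A+B), 0 ≤ l ≤ m
    × (∀ (l : ℕ) → l ≤ m →
        cycRook z l (A ⊕ B) ≈
        Σ (concatMap (λ s → concatMap (λ α → map (λ φ →
              pow z (numCycles φ) * weight A φ
                * cycRook z (l ∸ s) (sub B (compl α) (phiBar m≤n α φ)))
            (injOn n (λ i → memᶠ i α))) (Q s m)) (upTo (suc l))))
    -- per(z;A+B)
    × (cycPer z (A ⊕ B) ≈
      Σ (concatMap (λ s → concatMap (λ α → map (λ φ →
            pow z (numCycles φ) * weight A φ
              * cycPer z (sub B (compl α) (phiBar m≤n α φ)))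
          (injOn n (λ i → memᶠ i α))) (Q s m)) (upTo (suc m))))
    -- R(x;A+B)
    × (rookR x (A ⊕ B) ≈
      Σ (concatMap (λ s → concatMap (λ α → map (λ β →
            per (sub A α β) * pow x s * rookR x (sub B (compl α) (compl β)))
          (Q s n)) (Q s m)) (upTo (suc m))))
    -- r_l(A+B), 0 ≤ l ≤ m
    × (∀ (l : ℕ) → l ≤ m →
        rook l (A ⊕ B) ≈
        Σ (concatMap (λ s → concatMap (λ α → map (λ β →
              per (sub A α β) * rook (l ∸ s) (sub B (compl α) (compl β)))
            (Q s n)) (Q s m)) (upTo (suc l))))
    -- per(A+B)
    × (per (A ⊕ B) ≈
      Σ (concatMap (λ s → concatMap (λ α → map (λ β →
            per (sub A α β) * per (sub B (compl α) (compl β)))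
          (Q s n)) (Q s m)) (upTo (suc m))))
theorem5 CR m n m≤n A B x z =
    cycR-⊕ m≤n A B x z
  , (λ l _ → cycRook-⊕ m≤n A B x z l)
  , cycPer-⊕ m≤n A B x z
  , rookR-⊕ A B x
  , (λ l _ → rook-⊕ A B x l)
  , per-⊕ A B x
  where
  open CyclicExpansion CR
  open Ordinary CR
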